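{- Let $\mathcal{H}$ be a finite family of connected graphs. For $\mu\in\{\mathrm{insc},\mathrm{insp},\mathrm{inpc},\mathrm{inpp}\}$ say that $\mathcal{H}$ satisfies (P-$\mu$) if there exists a constant $c(\mathcal{H})$ with $\mu(G)\le c(\mathcal{H})$ for every connected $\mathcal{H}$-free graph $G$. Then: (i) $\mathcal{H}$ satisfies (P-$\mathrm{insc}$) if and only if $\mathcal{H}\le\{K_n,S^*_n,P_n\}$ for some integer $n\ge4$; (ii) $\mathcal{H}$ satisfies (P-$\mathrm{insp}$) if and only if $\mathcal{H}\le\{K_n,S^*_n,\tilde S_n,P_n\}$ for some integer $n\ge4$; (iii) $\mathcal{H}$ satisfies (P-$\mathrm{inpc}$) if and only if $\mathcal{H}\le\{K_n,K_{1,n},F^{(1)}_n,F^{(2)}_n\}$ for some integer $n\ge4$; (iv) $\mathcal{H}$ satisfies (P-$\mathrm{inpp}$) if and only if $\mathcal{H}\le\{K_n,K_{1,n},F^{(1)}_n,F^{(2)}_n,F^{(4)}_n,F^{(5)}_n\}$ for some integer $n\ge4$.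
   Context: Graphs are finite and simple. $G$ is $\mathcal{H}$-free if it has no induced subgraph isomorphic to a member of $\mathcal{H}$. $\mathcal{H}_1\le\mathcal{H}_2$ means every member of $\mathcal{H}_2$ contains an induced subgraph isomorphic to some member of $\mathcal{H}_1$. For a family $\mathcal{A}$, an induced $\mathcal{A}$-cover of $G$ is a family of induced subgraphs of $G$ each isomorphic to a member of $\mathcal{A}$ whose vertex sets cover $V(G)$; an induced $\mathcal{A}$-partition has pairwise vertex-disjoint members. With $\mathcal{A}_s=\{K_1\}\cup\{K_{1,m}:m\ge1\}$ and $\mathcal{A}_p=\{P_m:m\ge1\}$: $\mathrm{insc}$, $\mathrm{insp}$ are the minimum sizes of an induced $\mathcal{A}_s$-cover, $\mathcal{A}_s$-partition; $\mathrm{inpc}$, $\mathrm{inpp}$ those of an induced $\mathcal{A}_p$-cover, $\mathcal{A}_p$-partition. $K_n$: complete graph; $K_{1,n}$: star of order $n+1$; $P_n$: path of order $n$. With $A=\{x_i,y_i,z_i:1\le i\le n\}$: $S^*_n$: vertices $A\setminus\{x_i:2\le i\le n\}$, edges $x_1y_i,y_iz_i$ ($1\le i\le n$). $\tilde S_n$: $S^*_n$ plus edges $x_1z_i$ ($1\le i\le n$). $F^{(1)}_n$: vertices $A\setminus\{x_i:3\le i\le n\}$, edges $x_1x_2,x_1y_1,x_1z_1$, $y_iy_{i+1},z_iz_{i+1}$ ($1\le i\le n-1$). $F^{(2)}_n$: vertices $A\setminus\{x_i:2\le i\le n\}$, edges $x_1y_1,x_1z_1,y_1z_1$, $y_iy_{i+1},z_iz_{i+1}$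 ($1\le i\le n-1$). $F^{(4)}_n$: vertices $\{x_1,x_2\}\cup\{y_i,z_i:1\le i\le n\}$, edges $x_1y_1,x_1z_1,x_2y_1,x_2z_1$, $y_iy_{i+1},z_iz_{i+1}$ ($1\le i\le n-1$). $F^{(5)}_n$: $F^{(4)}_n$ plus the edge $x_1x_2$. -}

module Defs where

open import Data.Nat using (ℕ; zero; suc; _+_; _*_; _≤_; _<ᵇ_; _≡ᵇ_)
open import Data.Bool using (Bool; true; false; _∧_; _∨_; not)
open import Data.Fin using (Fin; toℕ; _≟_)
open import Data.List using (List; []; _∷_; length)
open import Data.List.Membership.Propositional using (_∈_)
open import Data.List.Relation.Unary.Any using (Any)
open import Data.List.Relation.Unary.AllPairs using (AllPairs)
open import Data.Product using (Σ; ∃; _×_; _,_; proj₁)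
open import Data.Unit using (⊤)
open import Relation.Nullary using (¬_)
open import Relation.Nullary.Decidable using (⌊_⌋)
open import Relation.Binary.PropositionalEquality using (_≡_; _≢_)
open import Function.Definitions using (Injective)
open import Data.Bool using (T)

-- Finite simple graphs.
-- A graph has vertex set Fin V and a Boolean "edge indicator" E.
-- Adjacency is the symmetric, irreflexive closure: u ~ v iff u ≠ v and
-- (E u v or E v u).  Every finite simple graph arises this way.

record Graph : Set where
  constructor mkGraph
  field
    V : ℕ
    E : Fin V → Fin V → Bool

open Graph public

adj : (G : Graph) → Fin (V G) → Fin (V G) → Bool
adj G u v = not ⌊ u ≟ v ⌋ ∧ (E G u v ∨ E G v u)

data Reach (G : Graph) : Fin (V G) → Fin (V G) → Set where
  here : ∀ {u} → Reach G u u
  step : ∀ {u w v} → T (adj G u w) → Reach G w v → Reach G u v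

Connected : Graph → Set
Connected G = (1 ≤ V G) × (∀ u v → Reach G u v)

_↪_ : Graph → Graph → Set
H ↪ G = Σ (Fin (V H) → Fin (V G)) λ f →
          Injective _≡_ _≡_ f × (∀ u v → adj H u v ≡ adj G (f u) (f v))

Free : List Graph → Graph → Set
Free ℋ G = ∀ H → H ∈ ℋ → ¬ (H ↪ G)

_⊑_ : List Graph → List Graph → Set
ℋ₁ ⊑ ℋ₂ = ∀ H₂ → H₂ ∈ ℋ₂ → ∃ λ H₁ → H₁ ∈ ℋ₁ × (H₁ ↪ H₂)

infix 4 _≤?ᵇ_
_≤?ᵇ_ : ℕ → ℕ → Bool
a ≤?ᵇ b = a <ᵇ suc b

between : ℕ → ℕ → ℕ → Bool
between lo hi a = (lo ≤?ᵇ a) ∧ (a ≤?ᵇ hi)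

fromℕEdges : (k : ℕ) → (ℕ → ℕ → Bool) → Graph
fromℕEdges k e = mkGraph k (λ u v → e (toℕ u) (toℕ v))

K : ℕ → Graph
K n = fromℕEdges n (λ _ _ → true)

Star : ℕ → Graph
Star n = fromℕEdges (suc n) (λ a _ → a ≡ᵇ 0)

P : ℕ → Graph
P n = fromℕEdges n (λ a b → b ≡ᵇ suc a)

-- S*_n : x₁ = 0, yᵢ = i, zᵢ = n+i  (1 ≤ i ≤ n)
S* : ℕ → Graph
S* n = fromℕEdges (suc (n + n)) λ a b →
         ((a ≡ᵇ 0) ∧ between 1 n b) ∨ (between 1 n a ∧ (b ≡ᵇ n + a))

-- S~_n : S*_n plus x₁zᵢ
S~ : ℕ → Graph
S~ n = fromℕEdges (suc (n + n)) λ a b →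
         ((a ≡ᵇ 0) ∧ between 1 (n + n) b) ∨ (between 1 n a ∧ (b ≡ᵇ n + a))

-- F⁽¹⁾_n : x₁ = 0, x₂ = 1, yᵢ = 1+i, zᵢ = 1+n+i
F1 : ℕ → Graph
F1 n = fromℕEdges (suc (suc (n + n))) λ a b →
         ((a ≡ᵇ 0) ∧ ((b ≡ᵇ 1) ∨ (b ≡ᵇ 2) ∨ (b ≡ᵇ n + 2)))
         ∨ (between 2 n a ∧ (b ≡ᵇ suc a))
         ∨ (between (n + 2) (n + n) a ∧ (b ≡ᵇ suc a))

-- F⁽²⁾_n : x₁ = 0, yᵢ = i, zᵢ = n+i
F2 : ℕ → Graph
F2 n = fromℕEdges (suc (n + n)) λ a b →
         ((a ≡ᵇ 0) ∧ ((b ≡ᵇ 1) ∨ (b ≡ᵇ n + 1)))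
         ∨ ((a ≡ᵇ 1) ∧ (b ≡ᵇ n + 1))
         ∨ ((1 ≤?ᵇ a) ∧ (a <ᵇ n) ∧ (b ≡ᵇ suc a))
         ∨ ((n + 1 ≤?ᵇ a) ∧ (a <ᵇ n + n) ∧ (b ≡ᵇ suc a))

-- F⁽⁴⁾_n : x₁ = 0, x₂ = 1, yᵢ = 1+i, zᵢ = 1+n+i
F4edges : ℕ → ℕ → ℕ → Bool
F4edges n a b =
         (((a ≡ᵇ 0) ∨ (a ≡ᵇ 1)) ∧ ((b ≡ᵇ 2) ∨ (b ≡ᵇ n + 2)))
         ∨ (between 2 n a ∧ (b ≡ᵇ suc a))
         ∨ (between (n + 2) (n + n) a ∧ (b ≡ᵇ suc a))

F4 : ℕ → Graph
F4 n = fromℕEdges (suc (suc (n + n))) (F4edges n)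

F5 : ℕ → Graph
F5 n = fromℕEdges (suc (suc (n + n))) λ a b →
         ((a ≡ᵇ 0) ∧ (b ≡ᵇ 1)) ∨ F4edges n a b

-- Induced 𝒜-covers / partitions, for a family 𝒜 = {A m : m ∈ ℕ}.
-- A member of a cover is an induced subgraph of G isomorphic to some A m,
-- given by an induced embedding; its vertex set is the image.

Piece : (ℕ → Graph) → Graph → Set
Piece A G = Σ ℕ λ m → A m ↪ G

InPiece : ∀ {A G} → Fin (V G) → Piece A G → Set
InPiece {A} v (m , f , _) = ∃ λ (a : Fin (V (A m))) → f a ≡ v

DisjointPieces : ∀ {A G} → Piece A G → Piece A G → Set
DisjointPieces {A} {G} p q = ∀ (v : Fin (V G)) → InPiece {A} {G} v p → ¬ InPiece {A} {G} v q

IsCover : ∀ {A G} → List (Piece A G) → Set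
IsCover {A} {G} L = ∀ (v : Fin (V G)) → Any (InPiece {A} {G} v) L

IsPartition : ∀ {A G} → List (Piece A G) → Set
IsPartition {A} {G} L = IsCover {A} {G} L × AllPairs (DisjointPieces {A} {G}) L

CoverNum≤ : (ℕ → Graph) → Graph → ℕ → Set
CoverNum≤ A G c = Σ (List (Piece A G)) λ L → IsCover {A} {G} L × length L ≤ c

PartNum≤ : (ℕ → Graph) → Graph → ℕ → Set
PartNum≤ A G c = Σ (List (Piece A G)) λ L → IsPartition {A} {G} L × length L ≤ c

-- 𝒜_s = {K_1} ∪ {K_{1,m} : m ≥ 1} = {K_{1,m} : m ≥ 0}   (K_{1,0} = K_1)
𝒜s : ℕ → Graph
𝒜s m = Star m

𝒜p : ℕ → Graph
𝒜p m = P (suc m)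

insc≤ insp≤ inpc≤ inpp≤ : Graph → ℕ → Set
insc≤ = CoverNum≤ 𝒜s
insp≤ = PartNum≤ 𝒜s
inpc≤ = CoverNum≤ 𝒜p
inpp≤ = PartNum≤ 𝒜p

Bounded : (Graph → ℕ → Set) → List Graph → Set
Bounded μ≤ ℋ = ∃ λ c → ∀ G → Connected G → Free ℋ G → μ≤ G c

{-# OPTIONS --safe #-}
module Submission where

-- Necessity.  Large graphs of unbounded μ must contain members of ℋ.  The graphs K_n, K_{1,n},
-- P_n, S*_n, S̃_n are such graphs themselves; the F⁽ⁱ⁾_n are not, but a long path carrying many
-- copies of the extra vertex of F⁽ⁱ⁾, far apart, is one, and a small connected H inside it meets
-- at most one copy, hence embeds into F⁽ⁱ⁾_n.  A vertex whose neighbourhood is a clique must be an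
-- end of every induced path through it; in a partition one of two twins must be an end.
--
-- Sufficiency for stars.  By Ramsey, an irredundant set of neighbours of x dominating a set of
-- vertices is small, or x is the centre of an S*_n or S̃_n.  Applied along the at most n levels of
-- a breadth-first search this gives a bounded dominating set D.  In (i) the chromatic number is
-- bounded by the same argument, and each N(d), d ∈ D, is covered by stars at d, one per colour.  In
-- (ii) N(d) is split recursively, using that S̃_n is excluded.
--
-- Sufficiency for paths.  The degree is bounded.  Let c₀ c₁ … be a path descending through the
-- levels of a breadth-first search.  Away from its ends, every vertex of level j having a
-- neighbour on the path on level j - 1 or j + 1 is a twin of c_j, so the descendants of a vertex
-- on level n + 1 form, except for the last few levels, a blow-up of a path in which every
-- transversal is an induced path.  Without F⁽⁴⁾ and F⁽⁵⁾ there are no twins.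

open import Defs
open import Data.Bool using (Bool; true; false; _∧_; _∨_; T; if_then_else_)
import Data.Bool.Properties as Bool
open import Data.Empty using (⊥; ⊥-elim)
open import Data.Fin as Fin using (Fin; zero; suc; toℕ; _≟_)
import Data.Fin.Properties as Fin
open import Data.List using (List; []; _∷_; length; _++_; map; lookup; filter; allFin; deduplicate; concatMap; upTo)
import Data.List.Properties as List
open import Data.List.Membership.Propositional using (_∈_; _∉_; find; lose)
open import Data.List.Membership.Propositional.Properties
open import Data.List.Relation.Binary.Sublist.Propositional using (_⊆_; []; _∷ʳ_; _∷_; ⊆-trans)
open import Data.List.Relation.Binary.Sublist.Propositional.Properties using (All-resp-⊆)
open import Data.List.Relation.Unary.All as All using (All; []; _∷_)
import Data.List.Relation.Unary.All.Properties as All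
open import Data.List.Relation.Unary.AllPairs as AllPairs using (AllPairs; []; _∷_)
import Data.List.Relation.Unary.AllPairs.Properties as AllPairs
open import Data.List.Relation.Unary.Any as Any using (Any; here; there)
import Data.List.Relation.Unary.Any.Properties as Any
open import Data.List.Relation.Unary.Unique.Propositional using (Unique)
import Data.List.Relation.Unary.Unique.Propositional.Properties as Unique
open import Data.List.Relation.Unary.Unique.DecPropositional.Properties using (deduplicate-!)
open import Data.Nat as ℕ using (ℕ; zero; suc; _+_; _*_; _∸_; _^_; _≤_; _<_; z≤n; s≤s; _<ᵇ_; _≡ᵇ_)
open import Data.Nat.ListAction using (sum)
open import Data.Nat.Properties as ℕ using (≤-trans; ≤-reflexive; ≤-refl; <⇒≤; <⇒≢; <⇒≱; m≤m+n; m≤n+m; n≤1+n; ≰⇒>; ≮⇒≥; ≤-pred)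
open import Data.Nat.Tactic.RingSolver using (solve-∀)
open import Data.Product using (Σ; ∃; ∃₂; _×_; _,_; proj₁; proj₂)
open import Data.Sum using (_⊎_; inj₁; inj₂)
open import Data.Unit using (⊤; tt)
open import Function using (_∘_; id; case_of_)
open import Function.Bundles using (_⇔_; mk⇔)
open import Function.Definitions using (Injective)
open import Relation.Binary using (tri<; tri≈; tri>)
open import Relation.Binary.PropositionalEquality hiding (J)
open import Relation.Nullary using (¬_; Dec; yes; no)
open import Relation.Nullary.Decidable using (map′; ¬?; _×-dec_; _⊎-dec_)
open import Relation.Unary using (Decidable)

-- All lower bounds use one charge: a marked vertex, or a pair of twins, is charged to a piece and
-- to one of two places in it, so 2c + 1 marked items refute the bound c. One n must serve every
-- excluded graph at once. Connectivity confines a member of `ℋ` found in a long path to a window of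
-- its own order, and an n beyond the sum of all orders allows for every member that may turn up. A
-- cover may reuse the centre d for every colour, a partition may not. What the single star at d
-- leaves out of N(d) needs centres inside N(d); excluding S̃_n keeps these few, and the recursion
-- ends because passing to a neighbourhood lowers the clique number. The F⁽ⁱ⁾_n speak only about a
-- vertex with n levels of a descending path above and below it. So the top n + 1 levels, and about
-- n levels at the bottom below each vertex of level n + 1, are given up. As the degree is bounded,
-- these are boundedly many vertices, and one-vertex paths take care of them.

private variable
  X : Set
  G H J : Graph

-- Booleans, adjacency and embeddings

true≢false : ∀ {b : Bool} → b ≡ true → b ≡ false → ⊥
true≢false refl ()

≡-bool : ∀ {b c : Bool} → (b ≡ true → c ≡ true) → (c ≡ true → b ≡ true) → b ≡ c
≡-bool {true} {c} f g = sym (f refl)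
≡-bool {false} {true} f g = g refl
≡-bool {false} {false} f g = refl

≢true : ∀ {b : Bool} → ¬ b ≡ true → b ≡ false
≢true {true} h = ⊥-elim (h refl)
≢true {false} h = refl

∨-true⁻ : ∀ {b c} → b ∨ c ≡ true → b ≡ true ⊎ c ≡ true
∨-true⁻ {true} h = inj₁ refl
∨-true⁻ {false} h = inj₂ h

∨-true⁺ˡ : ∀ {b c} → b ≡ true → b ∨ c ≡ true
∨-true⁺ˡ refl = refl

∨-true⁺ʳ : ∀ {b c} → c ≡ true → b ∨ c ≡ true
∨-true⁺ʳ {b} refl = Bool.∨-zeroʳ b

∧-true⁻ : ∀ {b c} → b ∧ c ≡ true → b ≡ true × c ≡ true
∧-true⁻ {true} h = refl , h

≡ᵇ-true : ∀ {m n} → m ≡ n → (m ≡ᵇ n) ≡ true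
≡ᵇ-true {zero} refl = refl
≡ᵇ-true {suc m} refl = ≡ᵇ-true {m} refl

≡ᵇ-true⁻ : ∀ {m n} → (m ≡ᵇ n) ≡ true → m ≡ n
≡ᵇ-true⁻ {m} {n} h = ℕ.≡ᵇ⇒≡ m n (subst T (sym h) _)

≡ᵇ-false : ∀ {m n} → m ≢ n → (m ≡ᵇ n) ≡ false
≡ᵇ-false h = ≢true (h ∘ ≡ᵇ-true⁻)

≡ᵇ-cong : ∀ {m n m′ n′} → (m ≡ n → m′ ≡ n′) → (m′ ≡ n′ → m ≡ n) → (m ≡ᵇ n) ≡ (m′ ≡ᵇ n′)
≡ᵇ-cong f g = ≡-bool (≡ᵇ-true ∘ f ∘ ≡ᵇ-true⁻) (≡ᵇ-true ∘ g ∘ ≡ᵇ-true⁻)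

<ᵇ-true : ∀ {m n} → m < n → (m <ᵇ n) ≡ true
<ᵇ-true (s≤s {zero} h) = refl
<ᵇ-true (s≤s {suc m} h) = <ᵇ-true h

<ᵇ-true⁻ : ∀ {m n} → (m <ᵇ n) ≡ true → m < n
<ᵇ-true⁻ {m} {n} h = ℕ.<ᵇ⇒< m n (subst T (sym h) _)

<ᵇ-false : ∀ {m n} → ¬ m < n → (m <ᵇ n) ≡ false
<ᵇ-false h = ≢true (h ∘ <ᵇ-true⁻)

adj-≢ : ∀ G {u v} → u ≢ v → adj G u v ≡ E G u v ∨ E G v u
adj-≢ G {u} {v} u≢v with u ≟ v
... | yes p = ⊥-elim (u≢v p)
... | no _ = refl

adj-irrefl : ∀ G u → adj G u u ≡ false
adj-irrefl G u with u ≟ u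
... | yes p = refl
... | no q = ⊥-elim (q refl)

adj-sym : ∀ G u v → adj G u v ≡ adj G v u
adj-sym G u v with u ≟ v
... | yes refl rewrite adj-irrefl G u = refl
... | no q = trans (Bool.∨-comm (E G u v) (E G v u)) (sym (adj-≢ G (q ∘ sym)))

adj-flip : ∀ G {u v b} → adj G u v ≡ b → adj G v u ≡ b
adj-flip G {u} {v} h = trans (adj-sym G v u) h

adj⇒≢ : ∀ G {u v} → adj G u v ≡ true → u ≢ v
adj⇒≢ G {u} h refl = true≢false h (adj-irrefl G u)

-- Both requirements are symmetric in the pair, so increasing pairs suffice. The disjunction of edge
-- indicators replaces `adj H` so that a concrete `H` reduces to arithmetic on vertex numbers.
mkEmb< : (f : Fin (V H) → Fin (V G)) →
         (∀ u v → toℕ u < toℕ v → f u ≢ f v × (E H u v ∨ E H v u) ≡ adj G (f u) (f v)) →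
         H ↪ G
mkEmb< {H} {G} f hyp = f , inj , pres
  where
  inj : Injective _≡_ _≡_ f
  inj {u} {v} eq with ℕ.<-cmp (toℕ u) (toℕ v)
  ... | tri< lt _ _ = ⊥-elim (proj₁ (hyp u v lt) eq)
  ... | tri≈ _ e _ = Fin.toℕ-injective e
  ... | tri> _ _ gt = ⊥-elim (proj₁ (hyp v u gt) (sym eq))
  pres : ∀ u v → adj H u v ≡ adj G (f u) (f v)
  pres u v with ℕ.<-cmp (toℕ u) (toℕ v)
  ... | tri< lt _ _ = trans (adj-≢ H (λ e → <⇒≢ lt (cong toℕ e))) (proj₂ (hyp u v lt))
  ... | tri≈ _ e _ with refl ← Fin.toℕ-injective e = trans (adj-irrefl H u) (sym (adj-irrefl G (f u)))
  ... | tri> _ _ gt = trans (adj-sym H u v)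
                     (trans (adj-≢ H (λ e → <⇒≢ gt (cong toℕ e)))
                     (trans (proj₂ (hyp v u gt)) (adj-sym G (f v) (f u))))

↪-trans : H ↪ G → G ↪ J → H ↪ J
↪-trans (f , fi , fa) (g , gi , ga) = g ∘ f , fi ∘ gi , λ u v → trans (fa u v) (ga (f u) (f v))

-- Exhaustive search, one value at a time. `Q` has to respect pointwise equality because functions
-- that agree everywhere need not be equal here.
any-function? : ∀ {b} a (Q : (Fin a → Fin b) → Set) → (∀ {f g} → (∀ x → f x ≡ g x) → Q f → Q g) →
                (∀ f → Dec (Q f)) → Dec (∃ Q)
any-function? zero Q resp dec = map′ (λ q → _ , q) (λ (_ , q) → resp (λ ()) q) (dec (λ ()))
any-function? {b} (suc a) Q resp dec =
  map′ (λ (x , g , q) → _ , q) (λ (f , q) → f zero , f ∘ suc , resp (λ { zero → refl ; (suc _) → refl }) q)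
       (Fin.any? λ x → any-function? a (Q ∘ cons x)
          (λ e → resp λ { zero → refl ; (suc i) → e i }) (dec ∘ cons x))
  where
  cons : Fin b → (Fin a → Fin b) → Fin (suc a) → Fin b
  cons x g zero = x
  cons x g (suc i) = g i

-- Needed by `member-embeds`: without a decision procedure, a graph that is not `ℋ`-free would not
-- yield an actual member of `ℋ` inside it.
_↪?_ : ∀ H G → Dec (H ↪ G)
H ↪? G = any-function? (V H)
  (λ f → Injective _≡_ _≡_ f × (∀ u v → adj H u v ≡ adj G (f u) (f v)))
  (λ e (i , a) → (λ eq → i (trans (e _) (trans eq (sym (e _))))) ,
                 (λ u v → trans (a u v) (cong₂ (adj G) (e u) (e v))))
  (λ f → inj? f ×-dec Fin.all? (λ u → Fin.all? (λ v → adj H u v Bool.≟ adj G (f u) (f v))))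
  where
  inj? : ∀ f → Dec (Injective _≡_ _≡_ f)
  inj? f = map′ (λ h {u} {v} → h u v) (λ h u v → h)
    (Fin.all? λ u → Fin.all? λ v → dec→ (f u ≟ f v) (u ≟ v))
    where
    dec→ : ∀ {A B : Set} → Dec A → Dec B → Dec (A → B)
    dec→ _ (yes b) = yes (λ _ → b)
    dec→ (yes a) (no ¬b) = no (λ f → ¬b (f a))
    dec→ (no ¬a) (no ¬b) = yes (⊥-elim ∘ ¬a)

AllPairs-lookup : ∀ {R : X → X → Set} {xs} → AllPairs R xs → ∀ i j → toℕ i < toℕ j → R (lookup xs i) (lookup xs j)
AllPairs-lookup (p ∷ ps) zero (suc j) lt = All.lookup p (∈-lookup j)
AllPairs-lookup (p ∷ ps) (suc i) (suc j) (s≤s lt) = AllPairs-lookup ps i j lt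

clique⇒K : ∀ G n xs → length xs ≡ n → AllPairs (λ u v → adj G u v ≡ true) xs → K n ↪ G
clique⇒K G n xs refl ap = mkEmb< {K n} {G} (lookup xs) λ u v lt →
  let e = AllPairs-lookup ap u v lt in adj⇒≢ G e , sym e

Indep : ∀ G → List (Fin (V G)) → Set
Indep G = AllPairs (λ u v → u ≢ v × adj G u v ≡ false)

star⇒Star : ∀ G n x xs → length xs ≡ n → All (λ y → adj G x y ≡ true) xs → Indep G xs → Star n ↪ G
star⇒Star G n x xs refl nb ind = mkEmb< {Star n} {G} f ok
  where
  f : Fin (suc n) → Fin (V G)
  f zero = x
  f (suc i) = lookup xs i
  ok : ∀ u v → toℕ u < toℕ v → f u ≢ f v × (E (Star n) u v ∨ E (Star n) v u) ≡ adj G (f u) (f v)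
  ok zero (suc j) lt = let e = All.lookup nb (∈-lookup j) in adj⇒≢ G e , sym e
  ok (suc i) (suc j) (s≤s lt) = let (ne , e) = AllPairs-lookup ind i j lt in ne , sym e

stepᵇ : ℕ → ℕ → Bool
stepᵇ x y = (y ≡ᵇ suc x) ∨ (x ≡ᵇ suc y)

path⇒P : ∀ G m (c : ℕ → Fin (V G)) → (∀ {i j} → i < m → j < m → c i ≡ c j → i ≡ j) →
         (∀ {i j} → i < m → j < m → adj G (c i) (c j) ≡ stepᵇ i j) → P m ↪ G
path⇒P G m c inj ad = mkEmb< {P m} {G} (c ∘ toℕ) λ u v lt →
  (λ e → <⇒≢ lt (inj (Fin.toℕ<n u) (Fin.toℕ<n v) e)) , sym (ad (Fin.toℕ<n u) (Fin.toℕ<n v))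

-- Ramsey's theorem

AllPairs-resp-⊆ : ∀ {R : X → X → Set} {xs ys} → xs ⊆ ys → AllPairs R ys → AllPairs R xs
AllPairs-resp-⊆ [] [] = []
AllPairs-resp-⊆ (y ∷ʳ s) (p ∷ ps) = AllPairs-resp-⊆ s ps
AllPairs-resp-⊆ (refl ∷ s) (p ∷ ps) = All-resp-⊆ s p ∷ AllPairs-resp-⊆ s ps

take-⊆ : ∀ n (xs : List X) → n ≤ length xs → ∃ λ ys → ys ⊆ xs × length ys ≡ n
take-⊆ zero xs le = [] , []⊆ xs , refl
  where
  []⊆ : ∀ xs → [] ⊆ xs
  []⊆ [] = []
  []⊆ (x ∷ xs) = x ∷ʳ []⊆ xs
take-⊆ (suc n) (x ∷ xs) (s≤s le) = let (ys , s , e) = take-⊆ n xs le in x ∷ ys , refl ∷ s , cong suc e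

-- The Erdős-Szekeres recursion with one added for the head of the list; of the two parts into which
-- the head splits the tail, one then reaches its summand.
ramseyNumber : ℕ → ℕ → ℕ
ramseyNumber zero _ = 0
ramseyNumber (suc s) zero = 0
ramseyNumber (suc s) (suc t) = suc (ramseyNumber s (suc t) + ramseyNumber (suc s) t)

split : (r : X → Bool) (xs : List X) → ∃₂ λ ys zs → ys ⊆ xs × zs ⊆ xs ×
        All (λ y → r y ≡ true) ys × All (λ z → r z ≡ false) zs × length xs ≡ length ys + length zs
split r [] = [] , [] , [] , [] , [] , [] , refl
split r (x ∷ xs) with r x in eq | split r xs
... | true | ys , zs , s , t , a , b , e = x ∷ ys , zs , refl ∷ s , x ∷ʳ t , eq ∷ a , b , cong suc e
... | false | ys , zs , s , t , a , b , e = ys , x ∷ zs , x ∷ʳ s , refl ∷ t , a , eq ∷ b ,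
  trans (cong suc e) (sym (ℕ.+-suc (length ys) (length zs)))

+-split-≤ : ∀ {a b c d} → a + b ≤ c + d → a ≤ c ⊎ b ≤ d
+-split-≤ {a} {b} {c} {d} le with a ℕ.≤? c | b ℕ.≤? d
... | yes p | _ = inj₁ p
... | _ | yes q = inj₂ q
... | no p | no q = ⊥-elim (<⇒≱ (ℕ.+-mono-< (≰⇒> p) (≰⇒> q)) le)

-- The outcome is a sublist, so `All` and `AllPairs` properties of the given list survive.
-- `dominate` relies on this when it thins the same list of pairs twice.
ramsey : (r : X → X → Bool) → ∀ s t xs → ramseyNumber s t ≤ length xs →
         ∃ λ ys → ys ⊆ xs × (length ys ≡ s × AllPairs (λ x y → r x y ≡ true) ys ⊎
                             length ys ≡ t × AllPairs (λ x y → r x y ≡ false) ys)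
ramsey r zero t xs le = let (ys , s , e) = take-⊆ 0 xs z≤n in ys , s , inj₁ (e , nil e)
  where
  nil : ∀ {ys} → length ys ≡ 0 → AllPairs (λ x y → r x y ≡ true) ys
  nil {[]} e = []
ramsey r (suc s) zero xs le = let (ys , sb , e) = take-⊆ 0 xs z≤n in ys , sb , inj₂ (e , nil e)
  where
  nil : ∀ {ys} → length ys ≡ 0 → AllPairs (λ x y → r x y ≡ false) ys
  nil {[]} e = []
ramsey r (suc s) (suc t) (x ∷ xs) (s≤s le)
  with ys , zs , ys⊆ , zs⊆ , ya , za , e ← split (r x) xs
  with +-split-≤ {ramseyNumber s (suc t)} (subst (_ ≤_) e le)
... | inj₁ p with ramsey r s (suc t) ys p
...   | ws , ws⊆ , inj₁ (l , ap) = x ∷ ws , refl ∷ ⊆-trans ws⊆ ys⊆ , inj₁ (cong suc l , All-resp-⊆ ws⊆ ya ∷ ap)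
...   | ws , ws⊆ , inj₂ q = ws , x ∷ʳ ⊆-trans ws⊆ ys⊆ , inj₂ q
ramsey r (suc s) (suc t) (x ∷ xs) (s≤s le) | inj₂ p with ramsey r (suc s) t zs p
...   | ws , ws⊆ , inj₁ q = ws , x ∷ʳ ⊆-trans ws⊆ zs⊆ , inj₁ q
...   | ws , ws⊆ , inj₂ (l , ap) = x ∷ ws , refl ∷ ⊆-trans ws⊆ zs⊆ , inj₂ (cong suc l , All-resp-⊆ ws⊆ za ∷ ap)

-- Coordinates for the graphs F⁽ⁱ⁾

stepᵇ-true⁻ : ∀ {x y} → stepᵇ x y ≡ true → y ≡ suc x ⊎ x ≡ suc y
stepᵇ-true⁻ {x} {y} h with ∨-true⁻ {y ≡ᵇ suc x} h
... | inj₁ e = inj₁ (≡ᵇ-true⁻ e)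
... | inj₂ e = inj₂ (≡ᵇ-true⁻ e)

stepᵇ-up : ∀ {x y} → y ≡ suc x → stepᵇ x y ≡ true
stepᵇ-up e = ∨-true⁺ˡ (≡ᵇ-true e)

stepᵇ-down : ∀ {x y} → x ≡ suc y → stepᵇ x y ≡ true
stepᵇ-down {x} {y} e = ∨-true⁺ʳ {y ≡ᵇ suc x} (≡ᵇ-true e)

stepᵇ-sym : ∀ x y → stepᵇ x y ≡ stepᵇ y x
stepᵇ-sym x y = Bool.∨-comm (y ≡ᵇ suc x) _

stepᵇ-irrefl : ∀ x → stepᵇ x x ≡ false
stepᵇ-irrefl x = ≢true λ h → case stepᵇ-true⁻ {x} {x} h of λ { (inj₁ e) → ℕ.1+n≢n (sym e) ; (inj₂ e) → ℕ.1+n≢n (sym e) }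

-- F⁽¹⁾, F⁽²⁾, F⁽⁴⁾, F⁽⁵⁾ all consist of a path ("spine") and one extra vertex, which sees
-- positions {p}, {p, p+1}, {p ± 1}, {p, p ± 1} of the spine respectively.

data Kind : Set where
  pendant triangle twin₀ twin₁ : Kind

attach : Kind → ℕ → ℕ → Bool
attach pendant p x = x ≡ᵇ p
attach triangle p x = (x ≡ᵇ p) ∨ (x ≡ᵇ suc p)
attach twin₀ p x = stepᵇ p x
attach twin₁ p x = (x ≡ᵇ p) ∨ stepᵇ p x

F : Kind → ℕ → Graph
F pendant = F1
F triangle = F2
F twin₀ = F4
F twin₁ = F5

data Label : Set where
  extra : Label
  spine : ℕ → Label

spine-injective : ∀ {x y} → spine x ≡ spine y → x ≡ y
spine-injective refl = refl

labelAdj : Kind → ℕ → Label → Label → Bool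
labelAdj k p extra extra = false
labelAdj k p extra (spine x) = attach k p x
labelAdj k p (spine x) extra = attach k p x
labelAdj k p (spine x) (spine y) = stepᵇ x y

labelAdj-sym : ∀ k p l m → labelAdj k p l m ≡ labelAdj k p m l
labelAdj-sym k p extra extra = refl
labelAdj-sym k p extra (spine x) = refl
labelAdj-sym k p (spine x) extra = refl
labelAdj-sym k p (spine x) (spine y) = stepᵇ-sym x y

-- The spine of F⁽²⁾ occupies the positions 1 to 2n, the other spines 0 to 2n. `label-spine` asks
-- for the positions at distance less than n from n, which all kinds share and which are those that
-- `chain-window` meets.
record Labelling (k : Kind) (n : ℕ) : Set where
  field
    label : Fin (V (F k n)) → Label
    label-injective : Injective _≡_ _≡_ label
    label-adj : ∀ u v → adj (F k n) u v ≡ labelAdj k n (label u) (label v)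
    label-bound : ∀ u {x} → label u ≡ spine x → x ≤ n + n
    label-spine : ∀ x → 1 ≤ x → x < n + n → ∃ λ u → label u ≡ spine x
    label-extra : ∃ λ u → label u ≡ extra

between-≤ : ∀ {l h a} → between l h a ≡ true → l ≤ a × a ≤ h
between-≤ {l} {h} {a} e with ∧-true⁻ {l <ᵇ suc a} e
... | x , y = ≤-pred (<ᵇ-true⁻ x) , ≤-pred (<ᵇ-true⁻ y)

module _ (n : ℕ) where

  -- The numbers `2 + a` run through y₁, ..., yₙ and then z₁, ..., zₙ. Reversing the first arm makes
  -- the path read yₙ ... y₁, centre, z₁ ... zₙ, with the position `n` left free for the centre.
  spinePos : ℕ → ℕ
  spinePos a = if a <ᵇ n then n ∸ suc a else suc a

  spinePos-lo : ∀ {a} → a < n → spinePos a ≡ n ∸ suc a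
  spinePos-lo h rewrite <ᵇ-true h = refl

  spinePos-hi : ∀ {a} → n ≤ a → spinePos a ≡ suc a
  spinePos-hi h rewrite <ᵇ-false (ℕ.≤⇒≯ h) = refl

  n∸suc< : ∀ {a} → a < n → n ∸ suc a < n
  n∸suc< {a} h = ℕ.∸-monoʳ-< {n} {suc a} {0} (s≤s z≤n) h

  suc-n∸suc : ∀ {a} → a < n → suc (n ∸ suc a) ≡ n ∸ a
  suc-n∸suc {a} h = sym (ℕ.+-∸-assoc 1 h)

  -- Consecutive numbers are consecutive on the path except at the jump from yₙ to z₁, which
  -- `suc a ≢ n` excludes.
  spinePos-step⁻ : ∀ {a b} → a < b → stepᵇ (spinePos a) (spinePos b) ≡ true → b ≡ suc a × suc a ≢ n
  spinePos-step⁻ {a} {b} lt h with a ℕ.<? n | b ℕ.<? n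
  ... | yes p | yes q rewrite spinePos-lo p | spinePos-lo q with stepᵇ-true⁻ h
  ...   | inj₁ e = ⊥-elim (<⇒≱ (ℕ.∸-monoʳ-< (s≤s lt) q) (≤-trans (n≤1+n _) (≤-reflexive (sym e))))
  ...   | inj₂ e = let e′ = ℕ.∸-cancelˡ-≡ p (<⇒≤ q) (trans e (suc-n∸suc q)) in
                   sym e′ , λ e″ → <⇒≢ q (trans (sym e′) e″)
  spinePos-step⁻ {a} {b} lt h | yes p | no q rewrite spinePos-lo p | spinePos-hi (≮⇒≥ q) with stepᵇ-true⁻ h
  ...   | inj₁ e = ⊥-elim (q (subst (_< n) (sym (ℕ.suc-injective e)) (n∸suc< p)))
  ...   | inj₂ e = ⊥-elim (<⇒≱ (n∸suc< p) (≤-trans (≤-trans (≮⇒≥ q) (m≤n+m b 2)) (≤-reflexive (sym e))))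
  spinePos-step⁻ {a} {b} lt h | no p | yes q = ⊥-elim (p (ℕ.<-trans lt q))
  spinePos-step⁻ {a} {b} lt h | no p | no q rewrite spinePos-hi (≮⇒≥ p) | spinePos-hi (≮⇒≥ q) with stepᵇ-true⁻ h
  ...   | inj₁ e = ℕ.suc-injective e , λ e″ → p (≤-reflexive e″)
  ...   | inj₂ e = ⊥-elim (<⇒≱ lt (≤-trans (n≤1+n b) (≤-reflexive (sym (ℕ.suc-injective e)))))

  spinePos-step⁺ : ∀ {a} → suc a ≢ n → stepᵇ (spinePos a) (spinePos (suc a)) ≡ true
  spinePos-step⁺ {a} ne with a ℕ.<? n
  ... | yes p = let q = ℕ.≤∧≢⇒< p ne in
    stepᵇ-down (trans (spinePos-lo p) (trans (sym (suc-n∸suc q)) (cong suc (sym (spinePos-lo q)))))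
  ... | no p = stepᵇ-up (trans (spinePos-hi (≤-trans (≮⇒≥ p) (n≤1+n a))) (cong suc (sym (spinePos-hi (≮⇒≥ p)))))

  spinePos≢n : ∀ a → spinePos a ≢ n
  spinePos≢n a h with a ℕ.<? n
  ... | yes p = <⇒≢ (n∸suc< p) (trans (sym (spinePos-lo p)) h)
  ... | no p = p (≤-reflexive (trans (sym (spinePos-hi (≮⇒≥ p))) h))

  spinePos-centre⁻ : ∀ {a} → stepᵇ n (spinePos a) ≡ true → a ≡ 0 ⊎ a ≡ n
  spinePos-centre⁻ {a} h with a ℕ.<? n
  ... | yes p rewrite spinePos-lo p with stepᵇ-true⁻ h
  ...   | inj₁ e = ⊥-elim (<⇒≱ (n∸suc< p) (≤-trans (n≤1+n n) (≤-reflexive (sym e))))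
  ...   | inj₂ e = inj₁ (sym (ℕ.∸-cancelˡ-≡ z≤n (<⇒≤ p) (trans e (suc-n∸suc p))))
  spinePos-centre⁻ {a} h | no p rewrite spinePos-hi (≮⇒≥ p) with stepᵇ-true⁻ h
  ...   | inj₁ e = inj₂ (ℕ.suc-injective e)
  ...   | inj₂ e = ⊥-elim (p (≤-trans (n≤1+n _) (≤-reflexive (sym e))))

  spinePos-centre⁺ : ∀ {a} → 1 ≤ n → a ≡ 0 ⊎ a ≡ n → stepᵇ n (spinePos a) ≡ true
  spinePos-centre⁺ 1≤n (inj₁ refl) = stepᵇ-down (sym (trans (cong suc (spinePos-lo 1≤n)) (suc-n∸suc 1≤n)))
  spinePos-centre⁺ 1≤n (inj₂ refl) = stepᵇ-up (spinePos-hi ≤-refl)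

  spinePos-bound : ∀ {a} → a < n + n → spinePos a ≤ n + n
  spinePos-bound {a} lt with a ℕ.<? n
  ... | yes p = ≤-trans (≤-reflexive (spinePos-lo p)) (≤-trans (ℕ.m∸n≤m n (suc a)) (m≤m+n n n))
  ... | no p = ≤-trans (≤-reflexive (spinePos-hi (≮⇒≥ p))) lt

  spinePos-injective : ∀ {a b} → a < b → spinePos a ≢ spinePos b
  spinePos-injective {a} {b} lt h with a ℕ.<? n | b ℕ.<? n
  ... | yes p | yes q rewrite spinePos-lo p | spinePos-lo q = <⇒≢ lt (ℕ.suc-injective (ℕ.∸-cancelˡ-≡ p q h))
  ... | yes p | no q rewrite spinePos-lo p | spinePos-hi (≮⇒≥ q) = q (subst (_≤ n) h (ℕ.m∸n≤m n (suc a)))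
  ... | no p | yes q = ⊥-elim (p (ℕ.<-trans lt q))
  ... | no p | no q rewrite spinePos-hi (≮⇒≥ p) | spinePos-hi (≮⇒≥ q) = <⇒≢ lt (ℕ.suc-injective h)

  spinePos-surjective : ∀ x → x ≤ n + n → x ≢ n → ∃ λ a → a < n + n × spinePos a ≡ x
  spinePos-surjective x le ne with ℕ.<-cmp x n
  ... | tri< lt _ _ = n ∸ suc x , ≤-trans (n∸suc< lt) (m≤m+n n n) ,
        trans (spinePos-lo (n∸suc< lt)) (trans (cong (n ∸_) (suc-n∸suc lt)) (ℕ.m∸[m∸n]≡n (<⇒≤ lt)))
  ... | tri≈ _ e _ = ⊥-elim (ne e)
  ... | tri> _ _ gt with x | gt
  ...   | suc y | s≤s gt′ = y , le , spinePos-hi gt′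

  spineEdge : ℕ → ℕ → Bool
  spineEdge a b = (between 2 n a ∧ (b ≡ᵇ suc a)) ∨ (between (n + 2) (n + n) a ∧ (b ≡ᵇ suc a))

  between-true⁺ : ∀ {l h a} → l ≤ a → a ≤ h → between l h a ≡ true
  between-true⁺ x y = cong₂ _∧_ (<ᵇ-true (s≤s x)) (<ᵇ-true (s≤s y))

  spineEdge-true⁻ : ∀ {a b} → spineEdge a b ≡ true → b ≡ suc a × (2 ≤ a × a ≤ n ⊎ n + 2 ≤ a × a ≤ n + n)
  spineEdge-true⁻ {a} {b} h with ∨-true⁻ {between 2 n a ∧ (b ≡ᵇ suc a)} h
  ... | inj₁ h₁ with x , y ← ∧-true⁻ {between 2 n a} h₁ = ≡ᵇ-true⁻ y , inj₁ (between-≤ {2} {n} {a} x)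
  ... | inj₂ h₂ with x , y ← ∧-true⁻ {between (n + 2) (n + n) a} h₂ = ≡ᵇ-true⁻ y , inj₂ (between-≤ {n + 2} x)

  spineEdge-small : ∀ {a} b → a < 2 → spineEdge a b ≡ false
  spineEdge-small b lt = ≢true λ h → case proj₂ (spineEdge-true⁻ {b = b} h) of λ where
    (inj₁ (x , _)) → <⇒≱ lt x
    (inj₂ (x , _)) → <⇒≱ lt (≤-trans (m≤n+m 2 n) x)

  spineEdge-rev : ∀ {a b} → a < b → spineEdge b a ≡ false
  spineEdge-rev {a} {b} lt = ≢true λ h → <⇒≱ lt (≤-trans (n≤1+n b) (≤-reflexive (sym (proj₁ (spineEdge-true⁻ {b} {a} h)))))

  spineEdge-pos : ∀ {a b} → a < b → b < n + n → spineEdge (2 + a) (2 + b) ≡ stepᵇ (spinePos a) (spinePos b)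
  spineEdge-pos {a} {b} lt b< = ≡-bool f g
    where
    f : spineEdge (2 + a) (2 + b) ≡ true → stepᵇ (spinePos a) (spinePos b) ≡ true
    f h with spineEdge-true⁻ {2 + a} {2 + b} h
    ... | refl , inj₁ (_ , le) = spinePos-step⁺ (<⇒≢ le)
    ... | refl , inj₂ (le , _) = spinePos-step⁺ λ e → <⇒≱ (≤-reflexive (trans (cong suc e) (ℕ.+-comm 1 n)))
                                                     (≤-pred (≤-trans (≤-reflexive (sym (ℕ.+-suc n 1))) le))
    g : stepᵇ (spinePos a) (spinePos b) ≡ true → spineEdge (2 + a) (2 + b) ≡ true
    g h with refl , ne ← spinePos-step⁻ lt h | a ℕ.<? n
    ... | yes p = ∨-true⁺ˡ (cong₂ _∧_ (between-true⁺ {2} {n} (s≤s (s≤s z≤n)) (ℕ.≤∧≢⇒< p ne)) (≡ᵇ-true {a} refl))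
    ... | no p = ∨-true⁺ʳ {between 2 n (2 + a) ∧ (a ≡ᵇ a)} (cong₂ _∧_
            (between-true⁺ {n + 2} {n + n} (≤-trans (≤-reflexive (ℕ.+-comm n 2)) (s≤s (s≤s (≮⇒≥ p)))) b<) (≡ᵇ-true {a} refl))

  -- The vertex x₁ becomes the middle of the spine and x₂ the extra vertex: the pendant vertex in
  -- F⁽¹⁾, the twin of the middle in F⁽⁴⁾ and F⁽⁵⁾.
  label₁ : ℕ → Label
  label₁ 0 = spine n
  label₁ 1 = extra
  label₁ (suc (suc a)) = spine (spinePos a)

  label₁-< : ∀ {a b} → a < b → label₁ a ≢ label₁ b
  label₁-< {0} {1} _ ()
  label₁-< {0} {suc (suc b)} _ e = spinePos≢n b (sym (spine-injective e))
  label₁-< {1} {suc (suc b)} _ ()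
  label₁-< {1} {1} (s≤s ())
  label₁-< {suc (suc a)} {suc (suc b)} (s≤s (s≤s lt)) e = spinePos-injective lt (spine-injective e)
  label₁-< {suc (suc a)} {1} (s≤s ()) e

  drop-∨ : ∀ {b c d} → c ≡ false → d ≡ false → (b ∨ c) ∨ d ≡ b
  drop-∨ {b} refl refl = trans (Bool.∨-identityʳ _) (Bool.∨-identityʳ b)

  centreEdge : ∀ a → 1 ≤ n → (2 + a ≡ᵇ 2) ∨ (2 + a ≡ᵇ n + 2) ≡ stepᵇ n (spinePos a)
  centreEdge a 1≤n = ≡-bool f g
    where
    f : (2 + a ≡ᵇ 2) ∨ (2 + a ≡ᵇ n + 2) ≡ true → stepᵇ n (spinePos a) ≡ true
    f h with ∨-true⁻ {a ≡ᵇ 0} h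
    ... | inj₁ e = spinePos-centre⁺ 1≤n (inj₁ (≡ᵇ-true⁻ e))
    ... | inj₂ e = spinePos-centre⁺ 1≤n (inj₂ (ℕ.suc-injective (ℕ.suc-injective (trans (≡ᵇ-true⁻ e) (ℕ.+-comm n 2)))))
    g : stepᵇ n (spinePos a) ≡ true → (2 + a ≡ᵇ 2) ∨ (2 + a ≡ᵇ n + 2) ≡ true
    g h with spinePos-centre⁻ h
    ... | inj₁ refl = refl
    ... | inj₂ refl = ∨-true⁺ʳ {a ≡ᵇ 0} (≡ᵇ-true (ℕ.+-comm 2 a))

  private
    below : ∀ {a b} → suc (suc a) < suc (suc b) → a < b
    below (s≤s (s≤s lt)) = lt

  F1-edge : 1 ≤ n → ∀ {a b} → a < b → b < 2 + (n + n) →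
            (let e = λ x y → ((x ≡ᵇ 0) ∧ ((y ≡ᵇ 1) ∨ (y ≡ᵇ 2) ∨ (y ≡ᵇ n + 2))) ∨ spineEdge x y) →
            e a b ∨ e b a ≡ labelAdj pendant n (label₁ a) (label₁ b)
  F1-edge 1≤n {0} {1} _ _ = sym (≡ᵇ-true {n} refl)
  F1-edge 1≤n {0} {suc (suc b)} lt _ =
    trans (drop-∨ (spineEdge-small (2 + b) (s≤s z≤n)) (spineEdge-rev {0} {2 + b} lt)) (centreEdge b 1≤n)
  F1-edge 1≤n {1} {1} (s≤s ())
  F1-edge 1≤n {1} {suc (suc b)} lt _ =
    trans (cong₂ _∨_ (spineEdge-small (2 + b) ≤-refl) (spineEdge-rev {1} {2 + b} lt)) (sym (≡ᵇ-false (spinePos≢n b)))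
  F1-edge 1≤n {suc (suc a)} {1} (s≤s ())
  F1-edge 1≤n {suc (suc a)} {suc (suc b)} lt (s≤s (s≤s b<)) =
    trans (trans (cong (spineEdge (2 + a) (2 + b) ∨_) (spineEdge-rev {2 + a} {2 + b} lt)) (Bool.∨-identityʳ _)) (spineEdge-pos (below lt) b<)

  F4-edge : 1 ≤ n → ∀ {a b} → a < b → b < 2 + (n + n) →
            F4edges n a b ∨ F4edges n b a ≡ labelAdj twin₀ n (label₁ a) (label₁ b)
  F4-edge 1≤n {0} {1} lt _ =
    trans (cong₂ _∨_ (trans (cong₂ _∨_ (≡ᵇ-false {1} {n + 2} (λ e → <⇒≱ (s≤s (s≤s z≤n)) (≤-trans (m≤n+m 2 n) (≤-reflexive (sym e)))))
                             (spineEdge-small 1 (s≤s z≤n))) refl)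
            (trans (cong₂ _∨_ (≡ᵇ-false {0} {n + 2} (λ e → <⇒≱ (s≤s z≤n) (≤-trans (m≤n+m 2 n) (≤-reflexive (sym e)))))
                             (spineEdge-small 0 ≤-refl)) refl))
      (sym (stepᵇ-irrefl n))
  F4-edge 1≤n {0} {suc (suc b)} lt _ =
    trans (drop-∨ (spineEdge-small (2 + b) (s≤s z≤n)) (spineEdge-rev {0} {2 + b} lt)) (centreEdge b 1≤n)
  F4-edge 1≤n {1} {1} (s≤s ())
  F4-edge 1≤n {1} {suc (suc b)} lt _ =
    trans (drop-∨ (spineEdge-small (2 + b) ≤-refl) (spineEdge-rev {1} {2 + b} lt)) (centreEdge b 1≤n)
  F4-edge 1≤n {suc (suc a)} {1} (s≤s ())
  F4-edge 1≤n {suc (suc a)} {suc (suc b)} lt (s≤s (s≤s b<)) =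
    trans (trans (cong (spineEdge (2 + a) (2 + b) ∨_) (spineEdge-rev {2 + a} {2 + b} lt)) (Bool.∨-identityʳ _)) (spineEdge-pos (below lt) b<)

  F5-edge : 1 ≤ n → ∀ {a b} → a < b → b < 2 + (n + n) →
            (let e = λ x y → ((x ≡ᵇ 0) ∧ (y ≡ᵇ 1)) ∨ F4edges n x y) →
            e a b ∨ e b a ≡ labelAdj twin₁ n (label₁ a) (label₁ b)
  F5-edge 1≤n {0} {1} lt _ = sym (∨-true⁺ˡ (≡ᵇ-true {n} refl))
  F5-edge 1≤n {0} {suc (suc b)} lt b< = F4-edge 1≤n {0} {2 + b} lt b<
  F5-edge 1≤n {1} {1} (s≤s ())
  F5-edge 1≤n {1} {suc (suc b)} lt b< = trans (F4-edge 1≤n {1} {2 + b} lt b<)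
    (cong (_∨ stepᵇ n (spinePos b)) (sym (≡ᵇ-false (spinePos≢n b))))
  F5-edge 1≤n {suc (suc a)} {1} (s≤s ())
  F5-edge 1≤n {suc (suc a)} {suc (suc b)} lt b< = F4-edge 1≤n lt b<

  -- In F⁽²⁾ the extra vertex is x₁, and the edge y₁z₁ joins the arms directly. So y₁ moves up to
  -- position `n` beside z₁ at `n + 1`, and position 0 stays empty.
  spinePos₂ : ℕ → ℕ
  spinePos₂ a = if a <ᵇ n then n ∸ a else suc a

  spinePos₂-lo : ∀ {a} → a < n → spinePos₂ a ≡ n ∸ a
  spinePos₂-lo h rewrite <ᵇ-true h = refl

  spinePos₂-hi : ∀ {a} → n ≤ a → spinePos₂ a ≡ suc a
  spinePos₂-hi h rewrite <ᵇ-false (ℕ.≤⇒≯ h) = refl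

  -- The second alternative is the edge y₁z₁, the only spine edge between vertices that are not
  -- consecutively numbered (for n = 1 they are).
  spinePos₂-step⁻ : ∀ {a b} → a < b → stepᵇ (spinePos₂ a) (spinePos₂ b) ≡ true →
                    b ≡ suc a × suc a ≢ n ⊎ a ≡ 0 × b ≡ n
  spinePos₂-step⁻ {a} {b} lt h with a ℕ.<? n | b ℕ.<? n
  ... | yes p | yes q rewrite spinePos₂-lo p | spinePos₂-lo q with stepᵇ-true⁻ h
  ...   | inj₁ e = ⊥-elim (<⇒≱ (ℕ.∸-monoʳ-< lt (<⇒≤ q)) (≤-trans (n≤1+n _) (≤-reflexive (sym e))))
  ...   | inj₂ e = let e′ = ℕ.∸-cancelˡ-≡ p (<⇒≤ q) (ℕ.suc-injective (trans (suc-n∸suc p) e)) in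
                   inj₁ (sym e′ , λ e″ → <⇒≢ q (trans (sym e′) e″))
  spinePos₂-step⁻ {a} {b} lt h | yes p | no q rewrite spinePos₂-lo p | spinePos₂-hi (≮⇒≥ q) with stepᵇ-true⁻ h
  ...   | inj₁ e = let b≡ = ℕ.suc-injective e ; b≡n = ℕ.≤-antisym (subst (_≤ n) (sym b≡) (ℕ.m∸n≤m n a)) (≮⇒≥ q) in
                   inj₂ (ℕ.∸-cancelˡ-≡ (<⇒≤ p) z≤n (trans (sym b≡) b≡n) , b≡n)
  ...   | inj₂ e = ⊥-elim (<⇒≱ (s≤s (ℕ.m∸n≤m n a)) (≤-trans (s≤s (≮⇒≥ q)) (≤-trans (n≤1+n _) (≤-reflexive (sym e)))))
  spinePos₂-step⁻ {a} {b} lt h | no p | yes q = ⊥-elim (p (ℕ.<-trans lt q))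
  spinePos₂-step⁻ {a} {b} lt h | no p | no q rewrite spinePos₂-hi (≮⇒≥ p) | spinePos₂-hi (≮⇒≥ q) with stepᵇ-true⁻ h
  ...   | inj₁ e = inj₁ (ℕ.suc-injective e , λ e″ → p (≤-reflexive e″))
  ...   | inj₂ e = ⊥-elim (<⇒≱ lt (≤-trans (n≤1+n b) (≤-reflexive (sym (ℕ.suc-injective e)))))

  spinePos₂-step⁺ : ∀ {a} → suc a ≢ n → stepᵇ (spinePos₂ a) (spinePos₂ (suc a)) ≡ true
  spinePos₂-step⁺ {a} ne with a ℕ.<? n
  ... | yes p = stepᵇ-down (trans (spinePos₂-lo p) (trans (sym (suc-n∸suc p)) (cong suc (sym (spinePos₂-lo (ℕ.≤∧≢⇒< p ne))))))
  ... | no p = stepᵇ-up (trans (spinePos₂-hi (≤-trans (≮⇒≥ p) (n≤1+n a))) (cong suc (sym (spinePos₂-hi (≮⇒≥ p)))))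

  spinePos₂-middle : 1 ≤ n → stepᵇ (spinePos₂ 0) (spinePos₂ n) ≡ true
  spinePos₂-middle 1≤n = stepᵇ-up (trans (spinePos₂-hi ≤-refl) (cong suc (sym (spinePos₂-lo 1≤n))))

  spinePos₂-attach : ∀ {a} → 1 ≤ n → (a ≡ᵇ 0) ∨ (a ≡ᵇ n) ≡ attach triangle n (spinePos₂ a)
  spinePos₂-attach {a} 1≤n = ≡-bool f g
    where
    f : (a ≡ᵇ 0) ∨ (a ≡ᵇ n) ≡ true → attach triangle n (spinePos₂ a) ≡ true
    f h with ∨-true⁻ {a ≡ᵇ 0} h
    ... | inj₁ e with refl ← ≡ᵇ-true⁻ {a} e = ∨-true⁺ˡ (≡ᵇ-true (spinePos₂-lo 1≤n))
    ... | inj₂ e with refl ← ≡ᵇ-true⁻ {a} e = ∨-true⁺ʳ {spinePos₂ a ≡ᵇ n} (≡ᵇ-true (spinePos₂-hi ≤-refl))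
    g : attach triangle n (spinePos₂ a) ≡ true → (a ≡ᵇ 0) ∨ (a ≡ᵇ n) ≡ true
    g h with a ℕ.<? n | ∨-true⁻ {spinePos₂ a ≡ᵇ n} h
    ... | yes p | inj₁ e = ∨-true⁺ˡ (≡ᵇ-true (ℕ.∸-cancelˡ-≡ (<⇒≤ p) z≤n (trans (sym (spinePos₂-lo p)) (≡ᵇ-true⁻ e))))
    ... | yes p | inj₂ e = ⊥-elim (<⇒≱ (s≤s (ℕ.m∸n≤m n a)) (≤-reflexive (trans (sym (≡ᵇ-true⁻ e)) (spinePos₂-lo p))))
    ... | no p | inj₁ e = ⊥-elim (p (≤-reflexive (trans (sym (spinePos₂-hi (≮⇒≥ p))) (≡ᵇ-true⁻ e))))
    ... | no p | inj₂ e = ∨-true⁺ʳ {a ≡ᵇ 0} (≡ᵇ-true (ℕ.suc-injective (trans (sym (spinePos₂-hi (≮⇒≥ p))) (≡ᵇ-true⁻ {spinePos₂ a} e))))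

  spinePos₂-bound : ∀ {a} → a < n + n → spinePos₂ a ≤ n + n
  spinePos₂-bound {a} lt with a ℕ.<? n
  ... | yes p = ≤-trans (≤-reflexive (spinePos₂-lo p)) (≤-trans (ℕ.m∸n≤m n a) (m≤m+n n n))
  ... | no p = ≤-trans (≤-reflexive (spinePos₂-hi (≮⇒≥ p))) lt

  spinePos₂-injective : ∀ {a b} → a < b → spinePos₂ a ≢ spinePos₂ b
  spinePos₂-injective {a} {b} lt h with a ℕ.<? n | b ℕ.<? n
  ... | yes p | yes q rewrite spinePos₂-lo p | spinePos₂-lo q = <⇒≢ lt (ℕ.∸-cancelˡ-≡ (<⇒≤ p) (<⇒≤ q) h)
  ... | yes p | no q rewrite spinePos₂-lo p | spinePos₂-hi (≮⇒≥ q) = q (subst (_≤ n) h (ℕ.m∸n≤m n a))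
  ... | no p | yes q = ⊥-elim (p (ℕ.<-trans lt q))
  ... | no p | no q rewrite spinePos₂-hi (≮⇒≥ p) | spinePos₂-hi (≮⇒≥ q) = <⇒≢ lt (ℕ.suc-injective h)

  spinePos₂-surjective : ∀ x → 1 ≤ x → x ≤ n + n → ∃ λ a → a < n + n × spinePos₂ a ≡ x
  spinePos₂-surjective x@(suc y) 1≤x le with x ℕ.≤? n
  ... | yes p = n ∸ x , ≤-trans (n∸suc< p) (m≤m+n n n) , trans (spinePos₂-lo (n∸suc< p)) (ℕ.m∸[m∸n]≡n p)
  ... | no p = y , le , spinePos₂-hi (≤-pred (≰⇒> p))

  label₂ : ℕ → Label
  label₂ 0 = extra
  label₂ (suc a) = spine (spinePos₂ a)

  label₂-< : ∀ {a b} → a < b → label₂ a ≢ label₂ b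
  label₂-< {0} {suc b} _ ()
  label₂-< {suc a} {suc b} (s≤s lt) e = spinePos₂-injective lt (spine-injective e)

  F2-edge : 1 ≤ n → ∀ {a b} → a < b → b < 1 + (n + n) →
            (let e = λ x y → ((x ≡ᵇ 0) ∧ ((y ≡ᵇ 1) ∨ (y ≡ᵇ n + 1))) ∨ ((x ≡ᵇ 1) ∧ (y ≡ᵇ n + 1))
                             ∨ ((1 ≤?ᵇ x) ∧ (x <ᵇ n) ∧ (y ≡ᵇ suc x))
                             ∨ ((n + 1 ≤?ᵇ x) ∧ (x <ᵇ n + n) ∧ (y ≡ᵇ suc x))) →
            e a b ∨ e b a ≡ labelAdj triangle n (label₂ a) (label₂ b)
  F2-edge 1≤n {a} {b} lt b< rewrite ℕ.+-comm n 1 = go a b lt b<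
    where
    e : ℕ → ℕ → Bool
    e x y = ((x ≡ᵇ 0) ∧ ((y ≡ᵇ 1) ∨ (y ≡ᵇ suc n))) ∨ ((x ≡ᵇ 1) ∧ (y ≡ᵇ suc n))
            ∨ ((1 ≤?ᵇ x) ∧ (x <ᵇ n) ∧ (y ≡ᵇ suc x))
            ∨ ((suc n ≤?ᵇ x) ∧ (x <ᵇ n + n) ∧ (y ≡ᵇ suc x))
    e⁻ : ∀ x y → e (suc x) y ≡ true → x ≡ 0 × y ≡ suc n ⊎ y ≡ 2 + x × suc x ≢ n
    e⁻ x y h with ∨-true⁻ {(x ≡ᵇ 0) ∧ (y ≡ᵇ suc n)} h
    ... | inj₁ h₁ with p , q ← ∧-true⁻ {x ≡ᵇ 0} h₁ = inj₁ (≡ᵇ-true⁻ p , ≡ᵇ-true⁻ q)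
    ... | inj₂ h₂ with ∨-true⁻ {(suc x <ᵇ n) ∧ (y ≡ᵇ 2 + x)} h₂
    ...   | inj₁ h₃ with p , q ← ∧-true⁻ {suc x <ᵇ n} h₃ = inj₂ (≡ᵇ-true⁻ q , <⇒≢ (<ᵇ-true⁻ p))
    ...   | inj₂ h₃ with p , q ← ∧-true⁻ {n <ᵇ suc x} h₃ | p′ , q′ ← ∧-true⁻ {suc x <ᵇ n + n} (proj₂ (∧-true⁻ {n <ᵇ suc x} h₃)) =
      inj₂ (≡ᵇ-true⁻ q′ , λ e → <⇒≢ (<ᵇ-true⁻ {n} p) (sym e))
    go : ∀ a b → a < b → b < 1 + (n + n) → e a b ∨ e b a ≡ labelAdj triangle n (label₂ a) (label₂ b)
    go 0 (suc b) lt b< =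
      trans (cong₂ _∨_ (trans (cong (((b ≡ᵇ 0) ∨ (b ≡ᵇ n)) ∨_) z) (Bool.∨-identityʳ _))
                       (≢true λ h → case e⁻ b 0 h of λ { (inj₁ (_ , ())) ; (inj₂ ()) }))
      (trans (Bool.∨-identityʳ _) (spinePos₂-attach 1≤n))
      where
      z : ((n <ᵇ 0) ∧ (0 <ᵇ n + n) ∧ (suc b ≡ᵇ 1)) ≡ false
      z = cong (_∧ ((0 <ᵇ n + n) ∧ (suc b ≡ᵇ 1))) (<ᵇ-false {n} {0} λ ())
    go (suc a) (suc b) (s≤s lt) (s≤s b<) = ≡-bool f g
      where
      f : e (suc a) (suc b) ∨ e (suc b) (suc a) ≡ true → stepᵇ (spinePos₂ a) (spinePos₂ b) ≡ true
      f h with ∨-true⁻ {e (suc a) (suc b)} h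
      ... | inj₁ h₁ with e⁻ a (suc b) h₁
      ...   | inj₁ (refl , refl) = spinePos₂-middle 1≤n
      ...   | inj₂ (refl , ne) = spinePos₂-step⁺ ne
      f h | inj₂ h₁ with e⁻ b (suc a) h₁
      ...   | inj₁ (refl , _) = case lt of λ ()
      ...   | inj₂ (refl , _) = ⊥-elim (<⇒≱ lt (n≤1+n b))
      g : stepᵇ (spinePos₂ a) (spinePos₂ b) ≡ true → e (suc a) (suc b) ∨ e (suc b) (suc a) ≡ true
      g h with spinePos₂-step⁻ lt h
      ... | inj₂ (refl , refl) = ∨-true⁺ˡ (∨-true⁺ˡ (≡ᵇ-true {n} refl))
      ... | inj₁ (refl , ne) with a ℕ.<? n
      ...   | yes p = ∨-true⁺ˡ (∨-true⁺ʳ {(a ≡ᵇ 0) ∧ (suc a ≡ᵇ n)} (∨-true⁺ˡ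
                        (cong₂ _∧_ (<ᵇ-true (ℕ.≤∧≢⇒< p ne)) (≡ᵇ-true {a} refl))))
      ...   | no p = ∨-true⁺ˡ (∨-true⁺ʳ {(a ≡ᵇ 0) ∧ (suc a ≡ᵇ n)} (∨-true⁺ʳ {(suc a <ᵇ n) ∧ (a ≡ᵇ a)}
                        (cong₂ _∧_ (<ᵇ-true (s≤s (≮⇒≥ p))) (cong₂ _∧_ (<ᵇ-true b<) (≡ᵇ-true {a} refl)))))

mkLabelling : ∀ k n (ℓ : ℕ → Label) →
  (∀ {a b} → a < b → ℓ a ≢ ℓ b) →
  (∀ (u v : Fin (V (F k n))) → toℕ u < toℕ v → E (F k n) u v ∨ E (F k n) v u ≡ labelAdj k n (ℓ (toℕ u)) (ℓ (toℕ v))) →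
  (∀ {a x} → a < V (F k n) → ℓ a ≡ spine x → x ≤ n + n) →
  (∀ x → 1 ≤ x → x < n + n → ∃ λ a → a < V (F k n) × ℓ a ≡ spine x) →
  (∃ λ a → a < V (F k n) × ℓ a ≡ extra) →
  Labelling k n
mkLabelling k n ℓ inj ad bd sp (a , a< , ex) = record
  { label = ℓ ∘ toℕ
  ; label-injective = inj′
  ; label-adj = ad′
  ; label-bound = λ u → bd (Fin.toℕ<n u)
  ; label-spine = λ x l h → let (a , a< , e) = sp x l h in Fin.fromℕ< a< , trans (cong ℓ (Fin.toℕ-fromℕ< a<)) e
  ; label-extra = Fin.fromℕ< a< , trans (cong ℓ (Fin.toℕ-fromℕ< a<)) ex
  }
  where
  inj′ : Injective _≡_ _≡_ (ℓ ∘ toℕ)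
  inj′ {u} {v} eq with ℕ.<-cmp (toℕ u) (toℕ v)
  ... | tri< lt _ _ = ⊥-elim (inj lt eq)
  ... | tri≈ _ e _ = Fin.toℕ-injective e
  ... | tri> _ _ gt = ⊥-elim (inj gt (sym eq))
  diag : ∀ l → labelAdj k n l l ≡ false
  diag extra = refl
  diag (spine x) = stepᵇ-irrefl x
  ad′ : ∀ u v → adj (F k n) u v ≡ labelAdj k n (ℓ (toℕ u)) (ℓ (toℕ v))
  ad′ u v with ℕ.<-cmp (toℕ u) (toℕ v)
  ... | tri< lt _ _ = trans (adj-≢ (F k n) (λ e → <⇒≢ lt (cong toℕ e))) (ad u v lt)
  ... | tri≈ _ e _ with refl ← Fin.toℕ-injective e = trans (adj-irrefl (F k n) u) (sym (diag (ℓ (toℕ u))))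
  ... | tri> _ _ gt = trans (adj-sym (F k n) u v) (trans (adj-≢ (F k n) (λ e → <⇒≢ gt (cong toℕ e)))
                      (trans (ad v u gt) (labelAdj-sym k n (ℓ (toℕ v)) (ℓ (toℕ u)))))

label₁-spine : ∀ n x → 1 ≤ x → x < n + n → ∃ λ a → a < 2 + (n + n) × label₁ n a ≡ spine x
label₁-spine n x _ lt with x ℕ.≟ n
... | yes refl = 0 , s≤s z≤n , refl
... | no ne = let (a , a< , e) = spinePos-surjective n x (<⇒≤ lt) ne in 2 + a , s≤s (s≤s a<) , cong spine e

label₁-bound : ∀ n {a x} → a < 2 + (n + n) → label₁ n a ≡ spine x → x ≤ n + n
label₁-bound n {0} _ refl = m≤m+n n n
label₁-bound n {suc (suc a)} (s≤s (s≤s lt)) refl = spinePos-bound n lt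

labelling : ∀ k {n} → 1 ≤ n → Labelling k n
labelling pendant {n} 1≤n = mkLabelling pendant n (label₁ n) (label₁-< n)
  (λ u v lt → F1-edge n 1≤n lt (Fin.toℕ<n v)) (label₁-bound n) (label₁-spine n) (1 , s≤s (s≤s z≤n) , refl)
labelling twin₀ {n} 1≤n = mkLabelling twin₀ n (label₁ n) (label₁-< n)
  (λ u v lt → F4-edge n 1≤n lt (Fin.toℕ<n v)) (label₁-bound n) (label₁-spine n) (1 , s≤s (s≤s z≤n) , refl)
labelling twin₁ {n} 1≤n = mkLabelling twin₁ n (label₁ n) (label₁-< n)
  (λ u v lt → F5-edge n 1≤n lt (Fin.toℕ<n v)) (label₁-bound n) (label₁-spine n) (1 , s≤s (s≤s z≤n) , refl)
labelling triangle {n} 1≤n = mkLabelling triangle n (label₂ n) (label₂-< n)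
  (λ u v lt → F2-edge n 1≤n lt (Fin.toℕ<n v)) bd
  (λ x l h → let (a , a< , e) = spinePos₂-surjective n x l (<⇒≤ h) in suc a , s≤s a< , cong spine e)
  (0 , s≤s z≤n , refl)
  where
  bd : ∀ {a x} → a < 1 + (n + n) → label₂ n a ≡ spine x → x ≤ n + n
  bd {suc a} (s≤s lt) refl = spinePos₂-bound n lt

-- Counting the pieces of covers and partitions

true⇒T : ∀ {b} → b ≡ true → T b
true⇒T refl = _

T⇒true : ∀ {b} → T b → b ≡ true
T⇒true {true} _ = refl

Reach-trans : ∀ {u v w} → Reach G u v → Reach G v w → Reach G u w
Reach-trans here s = s
Reach-trans (step e r) s = step e (Reach-trans r s)

Reach-sym : ∀ {u v} → Reach G u v → Reach G v u
Reach-sym here = here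
Reach-sym {G} (step {u} {w} e r) = Reach-trans (Reach-sym r) (step (subst T (adj-sym G u w) e) here)

connected-to : (r : Fin (V G)) → (∀ v → Reach G v r) → Connected G
connected-to r h = ≤-trans (s≤s z≤n) (Fin.toℕ<n r) , λ u v → Reach-trans (h u) (Reach-sym (h v))

-- If no member of `ℋ` embedded, the graph would be `ℋ`-free and the bound would apply to it.
member-embeds : ∀ {μ≤ ℋ} ((c , _) : Bounded μ≤ ℋ) (X : Graph) → Connected X → ¬ μ≤ X c →
                ∃ λ H → H ∈ ℋ × (H ↪ X)
member-embeds {ℋ = ℋ} (c , bnd) X con ¬μ with Any.any? (_↪? X) ℋ
... | yes a = find a
... | no ¬a = ⊥-elim (¬μ (bnd X con λ H H∈ emb → ¬a (lose H∈ emb)))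

-- The charging argument behind every lower bound: `R j i t` charges the item `j` to place `t` of
-- the piece `i`. There are two places because a path has two ends, and because a star meets a
-- clique at most in its centre and one leaf.
count : ∀ {k ℓ} (R : Fin k → Fin ℓ → Fin 2 → Set) → (∀ j → ∃₂ (R j)) →
        (∀ {j j′ i t} → R j i t → R j′ i t → j ≡ j′) → k ≤ ℓ * 2
count {k} {ℓ} R ex sep = Fin.injective⇒≤ {f = f} inj
  where
  f : Fin k → Fin (ℓ * 2)
  f j = Fin.combine (proj₁ (ex j)) (proj₁ (proj₂ (ex j)))
  inj : Injective _≡_ _≡_ f
  inj {j} {j′} e with ex j | ex j′
  ... | i , t , r | i′ , t′ , r′ with Fin.combine-injective i t i′ t′ e
  ...   | refl , refl = sep r r′

coverIndex : ∀ {A} {L : List (Piece A G)} → IsCover {A} {G} L → ∀ v → ∃ λ i → InPiece {A} {G} v (lookup L i)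
coverIndex cov v = Any.index (cov v) , Any.lookup-index (cov v)

partitionIndex : ∀ {A} {L : List (Piece A G)} → AllPairs (DisjointPieces {A} {G}) L → ∀ {v} i j →
                 InPiece {A} {G} v (lookup L i) → InPiece {A} {G} v (lookup L j) → i ≡ j
partitionIndex ap i j p q with ℕ.<-cmp (toℕ i) (toℕ j)
... | tri< lt _ _ = ⊥-elim (AllPairs-lookup ap i j lt _ p q)
... | tri≈ _ e _ = Fin.toℕ-injective e
... | tri> _ _ gt = ⊥-elim (AllPairs-lookup ap j i gt _ q p)

-- Lower bounds for star covers and partitions

star-leaves : ∀ m a b → adj (Star m) (suc a) (suc b) ≡ false
star-leaves m a b = Bool.∧-zeroʳ _

starTag : ∀ m → Fin (suc m) → Fin 2
starTag m zero = zero
starTag m (suc _) = suc zero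

K-adj : ∀ n {u v : Fin n} → u ≢ v → adj (K n) u v ≡ true
K-adj n ne = adj-≢ (K n) ne

-- Leaves of an induced star are pairwise nonadjacent, so inside a complete graph a star has at most
-- one leaf.
K-insc : ∀ n c → CoverNum≤ 𝒜s (K n) c → n ≤ c * 2
K-insc n c (L , cov , le) = ≤-trans
  (count (λ j i t → Σ (InPiece {𝒜s} {K n} j (lookup L i)) λ p → starTag _ (proj₁ p) ≡ t)
    (λ j → let (i , p) = coverIndex {G = K n} {A = 𝒜s} {L} cov j in i , starTag _ (proj₁ p) , p , refl)
    (λ {j} {j′} {i} (p , e) (p′ , e′) → sep (lookup L i) p p′ (trans e (sym e′))))
  (ℕ.*-monoˡ-≤ 2 le)
  where
  sep : ∀ {j j′} (q : Piece 𝒜s (K n)) (p : InPiece {𝒜s} {K n} j q) (p′ : InPiece {𝒜s} {K n} j′ q) →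
        starTag _ (proj₁ p) ≡ starTag _ (proj₁ p′) → j ≡ j′
  sep q (zero , refl) (zero , refl) e = refl
  sep (m , f , inj , ad) (suc a , refl) (suc b , refl) e with f (suc a) ≟ f (suc b)
  ... | yes eq = eq
  ... | no ne = ⊥-elim (true≢false (K-adj n ne) (trans (sym (ad (suc a) (suc b))) (star-leaves m a b)))

-- That the common neighbour is the centre, and so lies in the same piece, matters in `S~-insp`,
-- where it shows that this neighbour is not the hub.
star-piece : ∀ {G} (q : Piece 𝒜s G) {u v} → InPiece {𝒜s} {G} u q → InPiece {𝒜s} {G} v q →
             u ≡ v ⊎ adj G u v ≡ true ⊎ (∃ λ x → InPiece {𝒜s} {G} x q × adj G x u ≡ true × adj G x v ≡ true)
star-piece q (zero , refl) (zero , refl) = inj₁ refl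
star-piece (m , f , inj , ad) (zero , refl) (suc b , refl) = inj₂ (inj₁ (sym (ad zero (suc b))))
star-piece {G} (m , f , inj , ad) (suc a , refl) (zero , refl) = inj₂ (inj₁ (adj-flip G (sym (ad zero (suc a)))))
star-piece (m , f , inj , ad) (suc a , refl) (suc b , refl) =
  inj₂ (inj₂ (f zero , (zero , refl) , sym (ad zero (suc a)) , sym (ad zero (suc b))))

star-no-triangle : ∀ {G} (q : Piece 𝒜s G) {u v w} →
  InPiece {𝒜s} {G} u q → InPiece {𝒜s} {G} v q → InPiece {𝒜s} {G} w q →
  adj G u v ≡ true → adj G u w ≡ true → adj G v w ≡ true → ⊥
star-no-triangle {G} (m , f , inj , ad) {u} {v} {w} (a , ea) (b , eb) (c , ec) uv uw vw = go a b c ea eb ec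
  where
  leaves : ∀ a b {u v} → f (suc a) ≡ u → f (suc b) ≡ v → adj G u v ≡ true → ⊥
  leaves a b refl refl h = true≢false h (trans (sym (ad (suc a) (suc b))) (star-leaves m a b))
  go : ∀ a b c → f a ≡ u → f b ≡ v → f c ≡ w → ⊥
  go (suc a) (suc b) c ea eb ec = leaves a b ea eb uv
  go (suc a) b (suc c) ea eb ec = leaves a c ea ec uw
  go a (suc b) (suc c) ea eb ec = leaves b c eb ec vw
  go zero zero c ea eb ec = adj⇒≢ G uv (trans (sym ea) eb)
  go zero (suc _) zero ea eb ec = adj⇒≢ G uw (trans (sym ea) ec)
  go (suc _) zero zero ea eb ec = adj⇒≢ G vw (trans (sym eb) ec)

-- The hypotheses put the marked vertices at pairwise distance at least three, while a star has
-- diameter at most two, so no star holds two of them.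
insc-packing : ∀ G {k c} (w : Fin k → Fin (V G)) → Injective _≡_ _≡_ w →
  (∀ {i j} → adj G (w i) (w j) ≡ true → ⊥) →
  (∀ {i j} x → adj G x (w i) ≡ true → adj G x (w j) ≡ true → i ≡ j) →
  CoverNum≤ 𝒜s G c → k ≤ c * 2
insc-packing G w inj far common (L , cov , le) = ≤-trans
  (count (λ j i _ → InPiece {𝒜s} {G} (w j) (lookup L i))
    (λ j → let (i , p) = coverIndex {G = G} {A = 𝒜s} {L} cov (w j) in i , zero , p)
    (λ {j} {j′} {i} p p′ → case star-piece {G} (lookup L i) p p′ of λ where
       (inj₁ e) → inj e
       (inj₂ (inj₁ e)) → ⊥-elim (far e)
       (inj₂ (inj₂ (x , _ , e , e′))) → common x e e′))
  (ℕ.*-monoˡ-≤ 2 le)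

P-adj : ∀ n u v → adj (P n) u v ≡ stepᵇ (toℕ u) (toℕ v)
P-adj n u v with u ≟ v
... | yes refl = sym (stepᵇ-irrefl (toℕ u))
... | no _ = refl

-- Every third vertex of the path is marked.
P-insc : ∀ n k {c} → k * 3 ≤ n → CoverNum≤ 𝒜s (P n) c → k ≤ c * 2
P-insc n k 3k≤n = insc-packing (P n) w inj (λ {i} {j} → far {i} {j}) (λ {i} {j} → common {i} {j})
  where
  bound : (j : Fin k) → toℕ j * 3 < n
  bound j = ℕ.<-≤-trans (ℕ.*-monoˡ-< 3 (Fin.toℕ<n j)) 3k≤n
  w : Fin k → Fin n
  w j = Fin.fromℕ< (bound j)
  w-val : ∀ j → toℕ (w j) ≡ toℕ j * 3
  w-val j = Fin.toℕ-fromℕ< (bound j)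
  inj : Injective _≡_ _≡_ w
  inj {i} {j} e = Fin.toℕ-injective (ℕ.*-cancelʳ-≡ (toℕ i) (toℕ j) 3 (trans (sym (w-val i)) (trans (cong toℕ e) (w-val j))))
  close : ∀ {i j : Fin k} → toℕ i * 3 ≤ 2 + toℕ j * 3 → toℕ i ≤ toℕ j
  close {i} {j} le = ≤-pred (ℕ.*-cancelʳ-< 3 (toℕ i) (suc (toℕ j)) (s≤s le))
  near : ∀ {j : Fin k} x → adj (P n) x (w j) ≡ true → toℕ x ≤ 1 + toℕ j * 3 × toℕ j * 3 ≤ 1 + toℕ x
  near {j} x h with stepᵇ-true⁻ {toℕ x} (trans (sym (P-adj n x (w j))) h)
  ... | inj₁ e rewrite w-val j = ≤-trans (m≤n+m (toℕ x) 2) (≤-reflexive (cong suc (sym e))) , ≤-reflexive e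
  ... | inj₂ e rewrite w-val j = ≤-reflexive e , ≤-trans (m≤n+m (toℕ j * 3) 2) (≤-reflexive (cong suc (sym e)))
  common : ∀ {i j : Fin k} x → adj (P n) x (w i) ≡ true → adj (P n) x (w j) ≡ true → i ≡ j
  common {i} {j} x h h′ = let (a , b) = near {i} x h ; (a′ , b′) = near {j} x h′ in
    Fin.toℕ-injective (ℕ.≤-antisym (close {i} {j} (≤-trans b (s≤s a′))) (close {j} {i} (≤-trans b′ (s≤s a))))
  far : ∀ {i j : Fin k} → adj (P n) (w i) (w j) ≡ true → ⊥
  far {i} {j} h =
    let (a , b) = near {j} (w i) h
        a′ = subst (λ t → t ≤ 1 + toℕ j * 3) (w-val i) a
        b′ = subst (λ t → toℕ j * 3 ≤ 1 + t) (w-val i) b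
    in adj⇒≢ (P n) h (cong w (Fin.toℕ-injective (ℕ.≤-antisym
         (close {i} {j} (≤-trans a′ (n≤1+n _))) (close {j} {i} (≤-trans b′ (n≤1+n _))))))

fromℕEdges-adj : ∀ k e {u v : Fin k} → adj (fromℕEdges k e) u v ≡ true →
                 e (toℕ u) (toℕ v) ≡ true ⊎ e (toℕ v) (toℕ u) ≡ true
fromℕEdges-adj k e {u} {v} h = ∨-true⁻ (trans (sym (adj-≢ (fromℕEdges k e) (adj⇒≢ (fromℕEdges k e) {u} {v} h))) h)

-- The leaves zⱼ are marked; the only neighbour of zⱼ is yⱼ.
S*-insc : ∀ n {c} → CoverNum≤ 𝒜s (S* n) c → n ≤ c * 2
S*-insc n = insc-packing (S* n) z inj (λ {i} {j} → far {i} {j}) (λ {i} {j} → common {i} {j})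
  where
  z : Fin n → Fin (suc (n + n))
  z j = suc (n Fin.↑ʳ j)
  z-val : ∀ j → toℕ (z j) ≡ suc (n + toℕ j)
  z-val j = cong suc (Fin.toℕ-↑ʳ n j)
  inj : Injective _≡_ _≡_ z
  inj e = Fin.↑ʳ-injective n _ _ (Fin.suc-injective e)
  big : ∀ {j} → ¬ suc (n + j) ≤ n
  big {j} = <⇒≱ (s≤s (m≤m+n n j))
  e : ℕ → ℕ → Bool
  e a b = ((a ≡ᵇ 0) ∧ between 1 n b) ∨ (between 1 n a ∧ (b ≡ᵇ n + a))
  nbrℕ : ∀ a j → e a (suc (n + j)) ≡ true ⊎ e (suc (n + j)) a ≡ true → a ≡ suc j
  nbrℕ a j (inj₁ h) with ∨-true⁻ {(a ≡ᵇ 0) ∧ between 1 n (suc (n + j))} h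
  ... | inj₁ h₁ = ⊥-elim (big (proj₂ (between-≤ {1} {n} (proj₂ (∧-true⁻ {a ≡ᵇ 0} h₁)))))
  ... | inj₂ h₂ = ℕ.+-cancelˡ-≡ n a (suc j)
            (trans (sym (≡ᵇ-true⁻ (proj₂ (∧-true⁻ {between 1 n a} h₂)))) (sym (ℕ.+-suc n j)))
  nbrℕ a j (inj₂ h) = ⊥-elim (big (proj₂ (between-≤ {1} {n} (proj₁ (∧-true⁻ {between 1 n (suc (n + j))} h)))))
  nbr : ∀ j x → adj (S* n) x (z j) ≡ true → toℕ x ≡ suc (toℕ j)
  nbr j x h = nbrℕ (toℕ x) (toℕ j) (subst (λ t → e (toℕ x) t ≡ true ⊎ e t (toℕ x) ≡ true) (z-val j)
                                          (fromℕEdges-adj (suc (n + n)) e {x} {z j} h))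
  common : ∀ {i j} x → adj (S* n) x (z i) ≡ true → adj (S* n) x (z j) ≡ true → i ≡ j
  common {i} {j} x h h′ = Fin.toℕ-injective (ℕ.suc-injective (trans (sym (nbr i x h)) (nbr j x h′)))
  far : ∀ {i j} → adj (S* n) (z i) (z j) ≡ true → ⊥
  far {i} {j} h = <⇒≢ (ℕ.<-≤-trans (Fin.toℕ<n j) (m≤m+n n (toℕ i))) (sym (ℕ.suc-injective (trans (sym (z-val i)) (nbr j (z i) h))))

-- Only one piece contains the hub. It cannot contain both yⱼ and zⱼ, since these form a triangle
-- with the hub, so each pair sends a vertex to another piece. A piece that avoids the hub stays
-- within one pair. In a cover the hub could be used again and again.
S~-insp : ∀ n {c} → PartNum≤ 𝒜s (S~ n) c → n ≤ c * 2
S~-insp n (L , (cov , ap) , le) = ≤-trans (count R ex (λ {j} {j′} {i} {t} → sep {j} {j′} {i} {t})) (ℕ.*-monoˡ-≤ 2 le)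
  where
  S = S~ n
  y z : Fin n → Fin (suc (n + n))
  y j = suc (j Fin.↑ˡ n)
  z j = suc (n Fin.↑ʳ j)
  y-val : ∀ j → toℕ (y j) ≡ suc (toℕ j)
  y-val j = cong suc (Fin.toℕ-↑ˡ j n)
  z-val : ∀ j → toℕ (z j) ≡ suc (n + toℕ j)
  z-val j = cong suc (Fin.toℕ-↑ʳ n j)
  In : Fin (suc (n + n)) → Fin (length L) → Set
  In v i = InPiece {𝒜s} {S} v (lookup L i)
  i₀ : Fin (length L)
  i₀ = proj₁ (coverIndex {G = S} {A = 𝒜s} {L} cov zero)
  in₀ : In zero i₀
  in₀ = proj₂ (coverIndex {G = S} {A = 𝒜s} {L} cov zero)
  B : Fin n → Fin (suc (n + n)) → Set
  B j v = toℕ v ≡ suc (toℕ j) ⊎ toℕ v ≡ suc (n + toℕ j)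
  R : Fin n → Fin (length L) → Fin 2 → Set
  R j i _ = i ≢ i₀ × ∃ λ v → B j v × In v i
  zero~ : ∀ v → adj S zero (suc v) ≡ true
  zero~ v = ∨-true⁺ˡ (∨-true⁺ˡ (<ᵇ-true (s≤s (Fin.toℕ<n v))))
  y~z : ∀ j → adj S (y j) (z j) ≡ true
  y~z j = trans (adj-≢ S {y j} {z j} λ e → <⇒≢ (ℕ.<-≤-trans (Fin.toℕ<n j) (m≤m+n n _))
                   (ℕ.suc-injective (trans (sym (y-val j)) (trans (cong toℕ e) (z-val j)))))
    (∨-true⁺ˡ (cong₂ _∧_ (cong₂ _∧_ {true} refl (<ᵇ-true (subst (λ x → x < suc n) (sym (y-val j)) (s≤s (Fin.toℕ<n j)))))
                         (≡ᵇ-true (trans (z-val j) (trans (sym (ℕ.+-suc n (toℕ j))) (cong (n +_) (sym (y-val j))))))))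
  ex : ∀ j → ∃₂ (R j)
  ex j with coverIndex {G = S} {A = 𝒜s} {L} cov (y j) | coverIndex {G = S} {A = 𝒜s} {L} cov (z j)
  ... | i , p | i′ , p′ with i ≟ i₀ | i′ ≟ i₀
  ...   | no ne | _ = i , zero , ne , y j , inj₁ (y-val j) , p
  ...   | yes _ | no ne = i′ , zero , ne , z j , inj₂ (z-val j) , p′
  ...   | yes refl | yes refl = ⊥-elim (star-no-triangle {S} (lookup L i₀) in₀ p p′ (zero~ _) (zero~ _) (y~z j))
  B-unique : ∀ {j j′ v} → B j v → B j′ v → j ≡ j′
  B-unique (inj₁ e) (inj₁ e′) = Fin.toℕ-injective (ℕ.suc-injective (trans (sym e) e′))
  B-unique {j} {j′} (inj₁ e) (inj₂ e′) = ⊥-elim (<⇒≢ (ℕ.<-≤-trans (Fin.toℕ<n j) (m≤m+n n (toℕ j′))) (ℕ.suc-injective (trans (sym e) e′)))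
  B-unique {j} {j′} (inj₂ e) (inj₁ e′) = ⊥-elim (<⇒≢ (ℕ.<-≤-trans (Fin.toℕ<n j′) (m≤m+n n (toℕ j))) (ℕ.suc-injective (trans (sym e′) e)))
  B-unique (inj₂ e) (inj₂ e′) = Fin.toℕ-injective (ℕ.+-cancelˡ-≡ n _ _ (ℕ.suc-injective (trans (sym e) e′)))
  e : ℕ → ℕ → Bool
  e a b = ((a ≡ᵇ 0) ∧ between 1 (n + n) b) ∨ (between 1 n a ∧ (b ≡ᵇ n + a))
  B-stepℕ : ∀ {j} → j < n → ∀ {v} x → v ≡ suc j ⊎ v ≡ suc (n + j) → e (suc x) v ≡ true ⊎ e v (suc x) ≡ true →
            suc x ≡ suc j ⊎ suc x ≡ suc (n + j)
  B-stepℕ {j} j<n x b (inj₁ h) with le , h′ ← ∧-true⁻ {between 1 n (suc x)} h with b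
  ... | inj₁ refl = ⊥-elim (<⇒≱ j<n (≤-pred (≤-trans (s≤s (m≤m+n n x))
                      (≤-reflexive (trans (sym (ℕ.+-suc n x)) (sym (≡ᵇ-true⁻ h′)))))))
  ... | inj₂ refl = inj₁ (ℕ.+-cancelˡ-≡ n _ _ (trans (sym (≡ᵇ-true⁻ {suc (n + j)} h′)) (sym (ℕ.+-suc n j))))
  B-stepℕ {j} j<n x (inj₁ refl) (inj₂ h) =
    inj₂ (trans (≡ᵇ-true⁻ {suc x} (proj₂ (∧-true⁻ {between 1 n (suc j)} h))) (ℕ.+-suc n j))
  B-stepℕ {j} j<n x (inj₂ refl) (inj₂ h) =
    ⊥-elim (<⇒≱ (s≤s (m≤m+n n j)) (proj₂ (between-≤ {1} {n} (proj₁ (∧-true⁻ {between 1 n (suc (n + j))} h)))))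
  B-step : ∀ {j v} x → B j v → adj S (suc x) v ≡ true → B j (suc x)
  B-step {j} {v} x b h = B-stepℕ (Fin.toℕ<n j) (toℕ x) b (fromℕEdges-adj (suc (n + n)) e {suc x} {v} h)
  B-step₀ : ∀ {j v} i → i ≢ i₀ → (x : Fin (suc (n + n))) → In x i → B j v → adj S x v ≡ true → B j x
  B-step₀ i ne zero inx b h = ⊥-elim (ne (partitionIndex {G = S} {A = 𝒜s} ap i i₀ inx in₀))
  B-step₀ i ne (suc x) inx b h = B-step x b h
  sep : ∀ {j j′ i t} → R j i t → R j′ i t → j ≡ j′
  sep {i = i} (ne , v , b , p) (_ , v′ , b′ , p′) with star-piece {S} (lookup L i) p p′
  ... | inj₁ refl = B-unique b b′
  ... | inj₂ (inj₁ e) = B-unique b (B-step₀ i ne v p b′ e)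
  ... | inj₂ (inj₂ (x , inx , e , e′)) = B-unique (B-step₀ i ne x inx b e) (B-step₀ i ne x inx b′ e′)

-- Ends of induced paths

stepᵇ-far : ∀ x → stepᵇ x (2 + x) ≡ false
stepᵇ-far x = ≢true λ h → case stepᵇ-true⁻ {x} {2 + x} h of λ where
  (inj₁ e) → ℕ.1+n≢n e
  (inj₂ e) → <⇒≢ (m≤n+m (suc x) 2) e

IsEnd : ∀ {m} → Fin (suc m) → Set
IsEnd {m} a = toℕ a ≡ 0 ⊎ toℕ a ≡ m

-- The two distinct nonadjacent neighbours are what a clique neighbourhood forbids; for a twin they
-- have to be its two side vertices.
end-or-inner : ∀ {m} (a : Fin (suc m)) → IsEnd a ⊎ ∃₂ λ b c →
               adj (P (suc m)) a b ≡ true × adj (P (suc m)) a c ≡ true × adj (P (suc m)) b c ≡ false × b ≢ c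
end-or-inner {m} a = go (toℕ a) refl
  where
  go : ∀ y → toℕ a ≡ y → IsEnd a ⊎ ∃₂ λ b c →
       adj (P (suc m)) a b ≡ true × adj (P (suc m)) a c ≡ true × adj (P (suc m)) b c ≡ false × b ≢ c
  go zero eq = inj₁ (inj₁ eq)
  go (suc x) eq with suc x ℕ.≟ m
  ... | yes e = inj₁ (inj₂ (trans eq e))
  ... | no ne = inj₂ (b , c ,
        trans (P-adj _ a b) (stepᵇ-down (trans eq (cong suc (sym b-val)))) ,
        trans (P-adj _ a c) (stepᵇ-up (trans c-val (cong suc (sym eq)))) ,
        trans (P-adj _ b c) (trans (cong₂ stepᵇ b-val c-val) (stepᵇ-far x)) ,
        λ e → <⇒≢ (m≤n+m (suc x) 1) (trans (sym b-val) (trans (cong toℕ e) c-val)))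
    where
    sx≤m : suc x ≤ m
    sx≤m = ≤-pred (subst (_< suc m) eq (Fin.toℕ<n a))
    b< : x < suc m
    b< = ≤-trans sx≤m (n≤1+n m)
    c< : 2 + x < suc m
    c< = s≤s (ℕ.≤∧≢⇒< sx≤m ne)
    b c : Fin (suc m)
    b = Fin.fromℕ< b<
    c = Fin.fromℕ< c<
    b-val : toℕ b ≡ x
    b-val = Fin.toℕ-fromℕ< b<
    c-val : toℕ c ≡ 2 + x
    c-val = Fin.toℕ-fromℕ< c<

-- If `a` and `a′` differed, then a, b, a′, c would be a four-cycle in a path.
P-middle-unique : ∀ m {a a′ b c : Fin m} → b ≢ c → adj (P m) a b ≡ true → adj (P m) a c ≡ true →
                  adj (P m) a′ b ≡ true → adj (P m) a′ c ≡ true → a ≡ a′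
P-middle-unique m {a} {a′} {b} {c} b≢c ab ac a′b a′c =
  Fin.toℕ-injective (go (≤→ a b ab) (≤→ a c ac) (≤→ a′ b a′b) (≤→ a′ c a′c))
  where
  ≤→ : ∀ x y → adj (P m) x y ≡ true → toℕ y ≡ suc (toℕ x) ⊎ toℕ x ≡ suc (toℕ y)
  ≤→ x y h = stepᵇ-true⁻ (trans (sym (P-adj m x y)) h)
  bc : toℕ b ≢ toℕ c
  bc = b≢c ∘ Fin.toℕ-injective
  cycle : ∀ {a b a′ c} → b ≡ suc a → a′ ≡ suc b → c ≡ suc a′ → a ≡ suc c → ⊥
  cycle {a} refl refl refl e = <⇒≢ (m≤n+m (suc a) 3) e
  go : toℕ b ≡ suc (toℕ a) ⊎ toℕ a ≡ suc (toℕ b) → toℕ c ≡ suc (toℕ a) ⊎ toℕ a ≡ suc (toℕ c) →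
       toℕ b ≡ suc (toℕ a′) ⊎ toℕ a′ ≡ suc (toℕ b) → toℕ c ≡ suc (toℕ a′) ⊎ toℕ a′ ≡ suc (toℕ c) → toℕ a ≡ toℕ a′
  go (inj₁ p) (inj₁ q) _ _ = ⊥-elim (bc (trans p (sym q)))
  go (inj₂ p) (inj₂ q) _ _ = ⊥-elim (bc (ℕ.suc-injective (trans (sym p) q)))
  go _ _ (inj₁ p) (inj₁ q) = ⊥-elim (bc (trans p (sym q)))
  go _ _ (inj₂ p) (inj₂ q) = ⊥-elim (bc (ℕ.suc-injective (trans (sym p) q)))
  go (inj₁ p) _ (inj₁ p′) _ = ℕ.suc-injective (trans (sym p) p′)
  go (inj₂ p) _ (inj₂ p′) _ = trans p (sym p′)
  go (inj₁ p) (inj₂ q) (inj₂ p′) (inj₁ q′) = ⊥-elim (cycle p p′ q′ q)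
  go (inj₂ p) (inj₁ q) (inj₁ p′) (inj₂ q′) = ⊥-elim (cycle q q′ p′ p)

endTag : ∀ {m} → Fin (suc m) → Fin 2
endTag zero = zero
endTag (suc _) = suc zero

end-unique : ∀ {m} {a a′ : Fin (suc m)} → IsEnd a → IsEnd a′ → endTag a ≡ endTag a′ → a ≡ a′
end-unique {a = zero} {zero} _ _ _ = refl
end-unique {a = suc a} {suc a′} (inj₂ e) (inj₂ e′) _ = Fin.toℕ-injective (trans e (sym e′))

-- Sites are sets of vertices rather than vertices, because of two twins it is not known which one
-- is the end.
ends-count : ∀ G {k} (W : Fin k → Fin (V G) → Set) → (∀ {j j′ v} → W j v → W j′ v → j ≡ j′) →
  (L : List (Piece 𝒜p G)) →
  (∀ j → ∃ λ i → ∃ λ (a : Fin (V (𝒜p (proj₁ (lookup L i))))) → IsEnd a × W j (proj₁ (proj₂ (lookup L i)) a)) →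
  k ≤ length L * 2
ends-count G W sep L ex = count
  (λ j i t → ∃ λ (a : Fin (V (𝒜p (proj₁ (lookup L i))))) → IsEnd a × W j (proj₁ (proj₂ (lookup L i)) a) × endTag a ≡ t)
  (λ j → let (i , a , e , w) = ex j in i , endTag a , a , e , w , refl)
  λ { {j} {j′} {i} (a , e , w , t) (a′ , e′ , w′ , t′) →
      sep w (subst (λ x → W j′ (proj₁ (proj₂ (lookup L i)) x)) (sym (end-unique e e′ (trans t (sym t′)))) w′) }

Simplicial : ∀ G → Fin (V G) → Set
Simplicial G v = ∀ {b c} → adj G v b ≡ true → adj G v c ≡ true → b ≢ c → adj G b c ≡ true

simplicial-inpc : ∀ G {k c} (w : Fin k → Fin (V G)) → Injective _≡_ _≡_ w → (∀ j → Simplicial G (w j)) →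
                  CoverNum≤ 𝒜p G c → k ≤ c * 2
simplicial-inpc G w inj simp (L , cov , le) = ≤-trans
  (ends-count G (λ j v → v ≡ w j) (λ e e′ → inj (trans (sym e) e′)) L ex) (ℕ.*-monoˡ-≤ 2 le)
  where
  ex : ∀ j → _
  ex j with coverIndex {G = G} {A = 𝒜p} {L} cov (w j)
  ... | i , a , e with end-or-inner a
  ...   | inj₁ end = i , a , end , e
  ...   | inj₂ (b , c , ab , ac , bc , b≢c) = ⊥-elim (true≢false
          (simp j (trans (cong (λ v → adj G v (f b)) (sym e)) (trans (sym (ad a b)) ab))
                  (trans (cong (λ v → adj G v (f c)) (sym e)) (trans (sym (ad a c)) ac)) (b≢c ∘ finj))
          (trans (sym (ad b c)) bc))
    where
    f = proj₁ (proj₂ (lookup L i))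
    finj = proj₁ (proj₂ (proj₂ (lookup L i)))
    ad = proj₂ (proj₂ (proj₂ (lookup L i)))

K-inpc : ∀ n {c} → CoverNum≤ 𝒜p (K n) c → n ≤ c * 2
K-inpc n = simplicial-inpc (K n) id id (λ j _ _ ne → K-adj n ne)

Star-inpc : ∀ n {c} → CoverNum≤ 𝒜p (Star n) c → n ≤ c * 2
Star-inpc n = simplicial-inpc (Star n) suc Fin.suc-injective λ where
  j {zero} {zero} _ _ ne → ⊥-elim (ne refl)
  j {suc b} {_} h _ _ → ⊥-elim (true≢false h (star-leaves n j b))
  j {zero} {suc c} _ h _ → ⊥-elim (true≢false h (star-leaves n j c))

part⇒cover : ∀ A G {c} → PartNum≤ A G c → CoverNum≤ A G c
part⇒cover A G (L , (cov , _) , le) = L , cov , le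

-- A long path with c extra vertices at the distant positions M, 2M, …, cM: by connectivity
-- and size, an H ∈ ℋ inside it can only meet one of them.

module Chain (k : Kind) (M c : ℕ) (M≥3 : 3 ≤ M) where

  -- The surplus beyond `M * c` makes every position `pos j + d` with `d < M` a vertex of the path,
  -- the last extra vertex included.
  len : ℕ
  len = M * (2 + c)

  CL : Set
  CL = Fin len ⊎ Fin c

  pos : Fin c → ℕ
  pos j = M * suc (toℕ j)

  clAdj : CL → CL → Bool
  clAdj (inj₁ x) (inj₁ y) = stepᵇ (toℕ x) (toℕ y)
  clAdj (inj₁ x) (inj₂ j) = attach k (pos j) (toℕ x)
  clAdj (inj₂ j) (inj₁ x) = attach k (pos j) (toℕ x)
  clAdj (inj₂ _) (inj₂ _) = false

  dec : Fin (len + c) → CL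
  dec = Fin.splitAt len

  enc : CL → Fin (len + c)
  enc = Fin.join len c

  chain : Graph
  chain = mkGraph (len + c) λ u v → clAdj (dec u) (dec v)

  clAdj-sym : ∀ l m → clAdj l m ≡ clAdj m l
  clAdj-sym (inj₁ x) (inj₁ y) = stepᵇ-sym (toℕ x) (toℕ y)
  clAdj-sym (inj₁ x) (inj₂ y) = refl
  clAdj-sym (inj₂ x) (inj₁ y) = refl
  clAdj-sym (inj₂ x) (inj₂ y) = refl

  clAdj-irrefl : ∀ l → clAdj l l ≡ false
  clAdj-irrefl (inj₁ x) = stepᵇ-irrefl (toℕ x)
  clAdj-irrefl (inj₂ y) = refl

  chain-adj : ∀ u v → adj chain u v ≡ clAdj (dec u) (dec v)
  chain-adj u v with u ≟ v
  ... | yes refl = sym (clAdj-irrefl (dec u))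
  ... | no _ = trans (cong (clAdj (dec u) (dec v) ∨_) (clAdj-sym (dec v) (dec u))) (Bool.∨-idem _)

  dec-enc : ∀ l → dec (enc l) ≡ l
  dec-enc = Fin.splitAt-join len c

  enc-dec : ∀ u → enc (dec u) ≡ u
  enc-dec = Fin.join-splitAt len c

  dec-injective : ∀ {u v} → dec u ≡ dec v → u ≡ v
  dec-injective {u} {v} e = trans (sym (enc-dec u)) (trans (cong enc e) (enc-dec v))

  enc-injective : ∀ {l m} → enc l ≡ enc m → l ≡ m
  enc-injective {l} {m} e = trans (sym (dec-enc l)) (trans (cong dec e) (dec-enc m))

  enc-adj : ∀ l m → adj chain (enc l) (enc m) ≡ clAdj l m
  enc-adj l m = trans (chain-adj (enc l) (enc m)) (cong₂ clAdj (dec-enc l) (dec-enc m))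

  M≥1 : 1 ≤ M
  M≥1 = ≤-trans (s≤s z≤n) M≥3

  instance
    M-nonZero : ℕ.NonZero M
    M-nonZero = ℕ.>-nonZero M≥1

  pos-injective : ∀ {i j} → pos i ≡ pos j → i ≡ j
  pos-injective {i} {j} e = Fin.toℕ-injective (ℕ.suc-injective (ℕ.*-cancelˡ-≡ (suc (toℕ i)) (suc (toℕ j)) M e))

  pos-close : ∀ {i j d} → d < M → pos i ≤ pos j + d → toℕ i ≤ toℕ j
  pos-close {i} {j} {d} d<M le = ≤-pred (≤-pred (ℕ.*-cancelˡ-< M (suc (toℕ i)) (2 + toℕ j)
    (ℕ.≤-<-trans le (ℕ.<-≤-trans (ℕ.+-monoʳ-< (pos j) d<M)
      (≤-reflexive (trans (ℕ.+-comm (pos j) M) (sym (ℕ.*-suc M (suc (toℕ j))))))))))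

  pos<len : ∀ j d → d < M → pos j + d < len
  pos<len j d d<M = ℕ.<-≤-trans (ℕ.+-monoʳ-< (pos j) d<M) (≤-trans
    (≤-reflexive (trans (ℕ.+-comm (pos j) M) (sym (ℕ.*-suc M (suc (toℕ j))))))
    (ℕ.*-monoʳ-≤ M (s≤s (ℕ.m≤n⇒m≤1+n (Fin.toℕ<n j)))))

  at : ∀ j d → d < M → Fin len
  at j d d<M = Fin.fromℕ< (pos<len j d d<M)

  at-val : ∀ j d (d<M : d < M) → toℕ (at j d d<M) ≡ pos j + d
  at-val j d d<M = Fin.toℕ-fromℕ< (pos<len j d d<M)

  attached : ∀ j → ∃ λ x → clAdj (inj₂ j) (inj₁ x) ≡ true
  attached j = go k refl
    where
    M>1 : 1 < M
    M>1 = ≤-trans (n≤1+n 2) M≥3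
    at₀ : toℕ (at j 0 M≥1) ≡ pos j
    at₀ = trans (at-val j 0 M≥1) (ℕ.+-identityʳ _)
    go : ∀ k′ → k′ ≡ k → ∃ λ x → clAdj (inj₂ j) (inj₁ x) ≡ true
    go pendant refl = at j 0 M≥1 , ≡ᵇ-true at₀
    go triangle refl = at j 0 M≥1 , ∨-true⁺ˡ (≡ᵇ-true at₀)
    go twin₀ refl = at j 1 M>1 , stepᵇ-up (trans (at-val j 1 M>1) (ℕ.+-comm (pos j) 1))
    go twin₁ refl = at j 0 M≥1 , ∨-true⁺ˡ (≡ᵇ-true at₀)

  len≥1 : 1 ≤ len
  len≥1 = ℕ.*-mono-≤ M≥1 (s≤s {n = suc c} z≤n)

  root : Fin len
  root = Fin.fromℕ< len≥1

  reach-spine : ∀ n (x : Fin len) → toℕ x ≡ n → Reach chain (enc (inj₁ x)) (enc (inj₁ root))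
  reach-spine zero x e = subst (λ y → Reach chain (enc (inj₁ x)) (enc (inj₁ y)))
    (Fin.toℕ-injective (trans e (sym (Fin.toℕ-fromℕ< len≥1)))) here
  reach-spine (suc n) x e = step (true⇒T (trans (enc-adj (inj₁ x) (inj₁ y)) (stepᵇ-down (trans e (cong suc (sym y-val)))))) (reach-spine n y y-val)
    where
    n< : n < len
    n< = ℕ.<-trans (≤-reflexive (sym e)) (Fin.toℕ<n x)
    y : Fin len
    y = Fin.fromℕ< n<
    y-val : toℕ y ≡ n
    y-val = Fin.toℕ-fromℕ< n<

  chain-connected : Connected chain
  chain-connected = connected-to (enc (inj₁ root)) λ v →
    subst (λ u → Reach chain u (enc (inj₁ root))) (enc-dec v) (go (dec v))
    where
    go : ∀ l → Reach chain (enc l) (enc (inj₁ root))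
    go (inj₁ x) = reach-spine (toℕ x) x refl
    go (inj₂ j) = let (x , h) = attached j in
      step (true⇒T (trans (enc-adj (inj₂ j) (inj₁ x)) h)) (reach-spine (toℕ x) x refl)

  chain-inpc : (∀ {p x y} → attach k p x ≡ true → attach k p y ≡ true → x ≢ y → stepᵇ x y ≡ true) →
               ∀ {d} → CoverNum≤ 𝒜p chain d → c ≤ d * 2
  chain-inpc clique = simplicial-inpc chain (enc ∘ inj₂) (λ e → inj₂-inj (enc-injective e)) λ j {b} {c} → simp j b c
    where
    inj₂-inj : ∀ {i j : Fin c} → _≡_ {A = CL} (inj₂ i) (inj₂ j) → i ≡ j
    inj₂-inj refl = refl
    simp : ∀ j b c → adj chain (enc (inj₂ j)) b ≡ true → adj chain (enc (inj₂ j)) c ≡ true → b ≢ c → adj chain b c ≡ true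
    simp j b c hb hc ne = trans (chain-adj b c) (go (dec b) (dec c) (r b hb) (r c hc) λ e → ne (dec-injective e))
      where
      r : ∀ b → adj chain (enc (inj₂ j)) b ≡ true → clAdj (inj₂ j) (dec b) ≡ true
      r b h = trans (cong (λ l → clAdj l (dec b)) (sym (dec-enc (inj₂ j)))) (trans (sym (chain-adj (enc (inj₂ j)) b)) h)
      go : ∀ l m → clAdj (inj₂ j) l ≡ true → clAdj (inj₂ j) m ≡ true → l ≢ m → clAdj l m ≡ true
      go (inj₁ x) (inj₁ y) hx hy ne = clique hx hy λ e → ne (cong inj₁ (Fin.toℕ-injective e))

-- `attach⁻` and `attach⁺` say that the extra vertex sees both neighbours of position `p` and
-- possibly `p` itself, which treats adjacent and nonadjacent twins at once.
module ChainTwin (k : Kind) (M c : ℕ) (M≥3 : 3 ≤ M)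
  (attach⁻ : ∀ {p x} → attach k p x ≡ true → x ≡ p ⊎ stepᵇ p x ≡ true)
  (attach⁺ : ∀ {p x} → stepᵇ p x ≡ true → attach k p x ≡ true) where

  open Chain k M c M≥3

  private
    M>1 : 1 < M
    M>1 = ≤-trans (n≤1+n 2) M≥3

  pos≥1 : ∀ j → 1 ≤ pos j
  pos≥1 j = ℕ.*-mono-≤ M≥1 (s≤s {n = toℕ j} z≤n)

  suc-pred-pos : ∀ j → suc (pos j ∸ 1) ≡ pos j
  suc-pred-pos j = trans (ℕ.+-comm 1 _) (ℕ.m∸n+n≡m (pos≥1 j))

  prev< : ∀ j → pos j ∸ 1 < len
  prev< j = ℕ.≤-<-trans (ℕ.m∸n≤m (pos j) 1) (ℕ.≤-<-trans (m≤m+n (pos j) 0) (pos<len j 0 M≥1))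

  midᶠ prevᶠ nextᶠ : Fin c → Fin len
  midᶠ j = at j 0 M≥1
  prevᶠ j = Fin.fromℕ< (prev< j)
  nextᶠ j = at j 1 M>1

  mid-val : ∀ j → toℕ (midᶠ j) ≡ pos j
  mid-val j = trans (at-val j 0 M≥1) (ℕ.+-identityʳ _)

  prev-val : ∀ j → suc (toℕ (prevᶠ j)) ≡ pos j
  prev-val j = trans (cong suc (Fin.toℕ-fromℕ< (prev< j))) (suc-pred-pos j)

  next-val : ∀ j → toℕ (nextᶠ j) ≡ suc (pos j)
  next-val j = trans (at-val j 1 M>1) (ℕ.+-comm (pos j) 1)

  mid prev next : Fin c → CL
  mid j = inj₁ (midᶠ j)
  prev j = inj₁ (prevᶠ j)
  next j = inj₁ (nextᶠ j)

  prev≢next : ∀ j → prev j ≢ next j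
  prev≢next j e = <⇒≢ (m≤n+m (suc (toℕ (prevᶠ j))) 1)
    (trans (cong toℕ (inj₁-inj e)) (trans (next-val j) (cong suc (sym (prev-val j)))))
    where
    inj₁-inj : ∀ {x y : Fin len} → _≡_ {A = CL} (inj₁ x) (inj₁ y) → x ≡ y
    inj₁-inj refl = refl

  step-cases : ∀ j {x} → stepᵇ (pos j) (toℕ x) ≡ true → inj₁ x ≡ prev j ⊎ inj₁ x ≡ next j
  step-cases j {x} h with stepᵇ-true⁻ {pos j} h
  ... | inj₁ e = inj₂ (cong inj₁ (Fin.toℕ-injective (trans e (sym (next-val j)))))
  ... | inj₂ e = inj₁ (cong inj₁ (Fin.toℕ-injective (ℕ.suc-injective (trans (sym e) (sym (prev-val j))))))

  Sides : Fin c → CL → CL → Set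
  Sides j l m = l ≡ prev j × m ≡ next j ⊎ l ≡ next j × m ≡ prev j

  sides : ∀ j {x y : Fin len} → stepᵇ (pos j) (toℕ x) ≡ true → stepᵇ (pos j) (toℕ y) ≡ true →
          inj₁ x ≢ inj₁ {B = Fin c} y → Sides j (inj₁ x) (inj₁ y)
  sides j {x} {y} hx hy ne with step-cases j {x} hx | step-cases j {y} hy
  ... | inj₁ e | inj₁ e′ = ⊥-elim (ne (trans e (sym e′)))
  ... | inj₁ e | inj₂ e′ = inj₁ (e , e′)
  ... | inj₂ e | inj₁ e′ = inj₂ (e , e′)
  ... | inj₂ e | inj₂ e′ = ⊥-elim (ne (trans e (sym e′)))

  nbrs-extra : ∀ j l m → clAdj (inj₂ j) l ≡ true → clAdj (inj₂ j) m ≡ true → l ≢ m → clAdj l m ≡ false → Sides j l m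
  nbrs-extra j (inj₁ x) (inj₁ y) hx hy ne na with attach⁻ hx | attach⁻ hy
  ... | inj₂ s | inj₂ t = sides j {x} {y} s t ne
  ... | inj₁ e | inj₁ e′ = ⊥-elim (ne (cong inj₁ (Fin.toℕ-injective (trans e (sym e′)))))
  ... | inj₁ e | inj₂ t = ⊥-elim (true≢false (subst (λ p → stepᵇ p (toℕ y) ≡ true) (sym e) t) na)
  ... | inj₂ s | inj₁ e = ⊥-elim (true≢false (trans (stepᵇ-sym (toℕ x) (toℕ y)) (subst (λ p → stepᵇ p (toℕ x) ≡ true) (sym e) s)) na)

  attached-mid : ∀ j j′ → attach k (pos j′) (pos j) ≡ true → j′ ≡ j
  attached-mid j j′ h with attach⁻ h
  ... | inj₁ e = sym (pos-injective e)
  ... | inj₂ s with stepᵇ-true⁻ {pos j′} s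
  ...   | inj₁ e = Fin.toℕ-injective (ℕ.≤-antisym
            (pos-close {j′} {j} M>1 (≤-trans (n≤1+n _) (≤-trans (≤-reflexive (sym e)) (m≤m+n _ 1))))
            (pos-close {j} {j′} M>1 (≤-reflexive (trans e (ℕ.+-comm 1 _)))))
  ...   | inj₂ e = Fin.toℕ-injective (ℕ.≤-antisym
            (pos-close {j′} {j} M>1 (≤-reflexive (trans e (ℕ.+-comm 1 _))))
            (pos-close {j} {j′} M>1 (≤-trans (n≤1+n _) (≤-trans (≤-reflexive (sym e)) (m≤m+n _ 1)))))

  -- If the twins are adjacent, the extra vertex is itself a neighbour of the middle one; but it
  -- sees both sides, so it belongs to no nonadjacent pair.
  nbrs-mid : ∀ j l m → clAdj (mid j) l ≡ true → clAdj (mid j) m ≡ true → l ≢ m → clAdj l m ≡ false → Sides j l m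
  nbrs-mid j (inj₁ x) (inj₁ y) hl hm ne na rewrite mid-val j = sides j {x} {y} hl hm ne
  nbrs-mid j (inj₁ x) (inj₂ i) hl hm ne na rewrite mid-val j with refl ← attached-mid j i hm = ⊥-elim (true≢false (attach⁺ hl) na)
  nbrs-mid j (inj₂ i) (inj₁ x) hl hm ne na rewrite mid-val j with refl ← attached-mid j i hl = ⊥-elim (true≢false (attach⁺ hm) na)
  nbrs-mid j (inj₂ i) (inj₂ i′) hl hm ne na rewrite mid-val j with refl ← attached-mid j i hl | refl ← attached-mid j i′ hm = ⊥-elim (ne refl)

  undec : ∀ {v l} → dec v ≡ l → v ≡ enc l
  undec {v} e = trans (sym (enc-dec v)) (cong enc e)

  Around : ∀ j (q : Piece 𝒜p chain) → Fin (V (𝒜p (proj₁ q))) → Set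
  Around j (m , f , _) a = ∃₂ λ β γ → f β ≡ enc (prev j) × f γ ≡ enc (next j) ×
                           adj (P (suc m)) a β ≡ true × adj (P (suc m)) a γ ≡ true

  around : ∀ j Z → (∀ l m → clAdj Z l ≡ true → clAdj Z m ≡ true → l ≢ m → clAdj l m ≡ false → Sides j l m) →
           ∀ (q : Piece 𝒜p chain) (a : Fin (V (𝒜p (proj₁ q)))) → proj₁ (proj₂ q) a ≡ enc Z → IsEnd a ⊎ Around j q a
  around j Z nbrs (m , f , finj , ad) a e with end-or-inner a
  ... | inj₁ end = inj₁ end
  ... | inj₂ (b , c , ab , ac , bc , b≢c) with nbrs (dec (f b)) (dec (f c)) (Z~ b ab) (Z~ c ac)
                                                    (λ eq → b≢c (finj (dec-injective eq)))
                                                    (trans (sym (chain-adj (f b) (f c))) (trans (sym (ad b c)) bc))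
    where
    Z~ : ∀ b → adj (P (suc m)) a b ≡ true → clAdj Z (dec (f b)) ≡ true
    Z~ b ab = trans (cong (λ l → clAdj l (dec (f b))) (trans (sym (dec-enc Z)) (cong dec (sym e))))
                    (trans (sym (chain-adj (f a) (f b))) (trans (sym (ad a b)) ab))
  ...   | inj₁ (p , n) = inj₂ (b , c , undec p , undec n , ab , ac)
  ...   | inj₂ (n , p) = inj₂ (c , b , undec p , undec n , ac , ab)

  -- If neither twin of a pair were an end, the pieces through them would both contain the two side
  -- vertices. Disjointness makes these pieces one path, and in a path only one vertex lies between
  -- two given ones.
  chain-inpp : ∀ {d} → PartNum≤ 𝒜p chain d → c ≤ d * 2
  chain-inpp (L , (cov , ap) , le) = ≤-trans (ends-count chain W sep L ex) (ℕ.*-monoˡ-≤ 2 le)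
    where
    W : Fin c → Fin (len + c) → Set
    W j v = v ≡ enc (inj₂ j) ⊎ v ≡ enc (mid j)
    inj₂-inj : ∀ {i j : Fin c} → _≡_ {A = CL} (inj₂ i) (inj₂ j) → i ≡ j
    inj₂-inj refl = refl
    mid-inj : ∀ {i j} → mid i ≡ mid j → i ≡ j
    mid-inj {i} {j} e = pos-injective (trans (sym (mid-val i)) (trans (cong chpos e) (mid-val j)))
      where
      chpos : CL → ℕ
      chpos (inj₁ x) = toℕ x
      chpos (inj₂ j) = 0
    sep : ∀ {j j′ v} → W j v → W j′ v → j ≡ j′
    sep {j} {j′} (inj₁ e) (inj₁ e′) = inj₂-inj (enc-injective (trans (sym e) e′))
    sep {j} {j′} (inj₁ e) (inj₂ e′) = case enc-injective {inj₂ j} {mid j′} (trans (sym e) e′) of λ ()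
    sep {j} {j′} (inj₂ e) (inj₁ e′) = case enc-injective {mid j} {inj₂ j′} (trans (sym e) e′) of λ ()
    sep (inj₂ e) (inj₂ e′) = mid-inj (enc-injective (trans (sym e) e′))
    ex : ∀ j → ∃ λ i → ∃ λ (a : Fin (V (𝒜p (proj₁ (lookup L i))))) → IsEnd a × W j (proj₁ (proj₂ (lookup L i)) a)
    ex j with coverIndex {G = chain} {A = 𝒜p} {L} cov (enc (inj₂ j)) | coverIndex {G = chain} {A = 𝒜p} {L} cov (enc (mid j))
    ... | i , a , e | i′ , a′ , e′ with around j (inj₂ j) (nbrs-extra j) (lookup L i) a e
                                      | around j (mid j) (nbrs-mid j) (lookup L i′) a′ e′
    ...   | inj₁ end | _ = i , a , end , inj₁ e
    ...   | inj₂ _ | inj₁ end = i′ , a′ , end , inj₂ e′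
    ...   | inj₂ (β , γ , fβ , fγ , aβ , aγ) | inj₂ (β′ , γ′ , fβ′ , fγ′ , aβ′ , aγ′)
      with refl ← partitionIndex {G = chain} {A = 𝒜p} ap i i′ (β , fβ) (β′ , fβ′)
      with refl ← proj₁ (proj₂ (proj₂ (lookup L i))) (trans fβ (sym fβ′))
         | refl ← proj₁ (proj₂ (proj₂ (lookup L i))) (trans fγ (sym fγ′))
      with refl ← P-middle-unique _ {a} {a′} {β} {γ}
             (λ { refl → prev≢next j (enc-injective (trans (sym fβ) fγ)) }) aβ aγ aβ′ aγ′
      = case enc-injective {inj₂ j} {mid j} (trans (sym e) e′) of λ ()

-- Small connected subgraphs of the long path

module _ (H : Graph) (position : Fin (V H) → ℕ)
         (slow : ∀ {u v} → adj H u v ≡ true → position v ≤ suc (position u)) where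

  -- A discrete intermediate value theorem: the position rises by at most one along an edge.
  intermediate : ∀ {u v} → Reach H u v → ∀ x → position u ≤ x → x ≤ position v → ∃ λ w → position w ≡ x
  intermediate {u} here x l h = u , ℕ.≤-antisym l h
  intermediate {u} (step {w = w} e r) x l h with position u ℕ.≟ x
  ... | yes eq = u , eq
  ... | no ne = intermediate r x (≤-trans (slow (T⇒true e)) (ℕ.≤∧≢⇒< l ne)) h

  -- Otherwise `V H + 1` consecutive positions would all be attained, necessarily by distinct
  -- vertices.
  window : Connected H → ∀ u v → position v < position u + V H
  window (_ , reach) u v with position v ℕ.<? position u + V H
  ... | yes p = p
  ... | no ¬p = ⊥-elim (ℕ.1+n≰n (Fin.injective⇒≤ {f = w} inj))
    where
    mid : ∀ (i : Fin (suc (V H))) → ∃ λ w → position w ≡ position u + toℕ i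
    mid i = intermediate (reach u v) (position u + toℕ i) (m≤m+n _ _)
              (≤-trans (ℕ.+-monoʳ-≤ (position u) (≤-pred (Fin.toℕ<n i))) (≮⇒≥ ¬p))
    w : Fin (suc (V H)) → Fin (V H)
    w i = proj₁ (mid i)
    inj : Injective _≡_ _≡_ w
    inj {i} {j} e = Fin.toℕ-injective (ℕ.+-cancelˡ-≡ (position u) _ _
      (trans (sym (proj₂ (mid i))) (trans (cong position e) (proj₂ (mid j)))))

module ChainWindow (k : Kind) (M c : ℕ) (M≥3 : 3 ≤ M) where

  open Chain k M c M≥3

  chpos : CL → ℕ
  chpos (inj₁ x) = toℕ x
  chpos (inj₂ j) = pos j

  stepᵇ-near : ∀ {x y} → stepᵇ x y ≡ true → x ≤ suc y × y ≤ suc x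
  stepᵇ-near {x} {y} h with stepᵇ-true⁻ {x} h
  ... | inj₁ e = ≤-trans (m≤n+m x 2) (≤-reflexive (cong suc (sym e))) , ≤-reflexive e
  ... | inj₂ e = ≤-reflexive e , ≤-trans (m≤n+m y 2) (≤-reflexive (cong suc (sym e)))

  attach-near : ∀ k p x → attach k p x ≡ true → p ≤ suc x × x ≤ suc p
  attach-near pendant p x h with refl ← ≡ᵇ-true⁻ {x} h = n≤1+n p , n≤1+n p
  attach-near triangle p x h with ∨-true⁻ {x ≡ᵇ p} h
  ... | inj₁ e = attach-near pendant p x e
  ... | inj₂ e with refl ← ≡ᵇ-true⁻ {x} e = m≤n+m p 2 , ≤-refl
  attach-near twin₀ p x h = stepᵇ-near h
  attach-near twin₁ p x h with ∨-true⁻ {x ≡ᵇ p} h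
  ... | inj₁ e = attach-near pendant p x e
  ... | inj₂ e = stepᵇ-near e

  chpos-slow : ∀ l m → clAdj l m ≡ true → chpos m ≤ suc (chpos l)
  chpos-slow (inj₁ x) (inj₁ y) h = proj₂ (stepᵇ-near h)
  chpos-slow (inj₁ x) (inj₂ j) h = proj₁ (attach-near k _ _ h)
  chpos-slow (inj₂ j) (inj₁ x) h = proj₂ (attach-near k _ _ h)

  module _ {p n : ℕ} where

    -- x′ is x in coordinates in which p becomes n.
    Shift : ℕ → ℕ → Set
    Shift x x′ = x′ + p ≡ x + n

    shift-≡ᵇ : ∀ d {x x′ y y′} → Shift x x′ → Shift y y′ → (y ≡ᵇ d + x) ≡ (y′ ≡ᵇ d + x′)
    shift-≡ᵇ d {x} {x′} {y} {y′} sx sy = ≡ᵇ-cong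
      (λ e → ℕ.+-cancelʳ-≡ p y′ (d + x′) (trans sy (trans (cong (_+ n) e) (trans (ℕ.+-assoc d x n) (trans (cong (d +_) (sym sx)) (sym (ℕ.+-assoc d x′ p)))))))
      (λ e → ℕ.+-cancelʳ-≡ n y (d + x) (trans (sym sy) (trans (cong (_+ p) e) (trans (ℕ.+-assoc d x′ p) (trans (cong (d +_) sx) (sym (ℕ.+-assoc d x n)))))))

    shift-stepᵇ : ∀ {x x′ y y′} → Shift x x′ → Shift y y′ → stepᵇ x y ≡ stepᵇ x′ y′
    shift-stepᵇ {x} {x′} {y} {y′} sx sy = cong₂ _∨_ (shift-≡ᵇ 1 {x} {x′} {y} {y′} sx sy) (shift-≡ᵇ 1 {y} {y′} {x} {x′} sy sx)

    shift-attach : ∀ k {x x′} → Shift x x′ → attach k p x ≡ attach k n x′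
    shift-attach pendant {x} {x′} s = shift-≡ᵇ 0 {p} {n} {x} {x′} (ℕ.+-comm n p) s
    shift-attach triangle {x} {x′} s = cong₂ _∨_ (shift-≡ᵇ 0 {p} {n} {x} {x′} (ℕ.+-comm n p) s) (shift-≡ᵇ 1 {p} {n} {x} {x′} (ℕ.+-comm n p) s)
    shift-attach twin₀ {x} {x′} s = shift-stepᵇ {p} {n} {x} {x′} (ℕ.+-comm n p) s
    shift-attach twin₁ {x} {x′} s = cong₂ _∨_ (shift-≡ᵇ 0 {p} {n} {x} {x′} (ℕ.+-comm n p) s) (shift-stepᵇ {p} {n} {x} {x′} (ℕ.+-comm n p) s)

  module _ (H : Graph) (con : Connected H) (n : ℕ) (H≤n : V H ≤ n) (n<M : n < M) (1≤n : 1 ≤ n) (emb : H ↪ chain) where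

    private
      f = proj₁ emb
      finj = proj₁ (proj₂ emb)
      fad = proj₂ (proj₂ emb)

    lab : Fin (V H) → CL
    lab u = dec (f u)

    lab-adj : ∀ u v → adj H u v ≡ clAdj (lab u) (lab v)
    lab-adj u v = trans (fad u v) (chain-adj (f u) (f v))

    near : ∀ u v → chpos (lab v) < chpos (lab u) + n
    near u v = ℕ.<-≤-trans
      (window H (chpos ∘ lab) (λ {u} {v} h → chpos-slow (lab u) (lab v) (trans (sym (lab-adj u v)) h)) con u v)
      (ℕ.+-monoʳ-≤ (chpos (lab u)) H≤n)

    -- The window is centred at the extra vertex that `H` meets; a second one would be at least
    -- `M > n` away. If `H` meets none, it lies on the bare path and any of its vertices can be the
    -- centre.
    centre : ∃ λ p → (∀ u → chpos (lab u) < p + n × p < chpos (lab u) + n) × (∀ u j → lab u ≡ inj₂ j → pos j ≡ p)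
    centre with Fin.any? (λ u → isExtra? (lab u))
      where
      isExtra? : ∀ l → Dec (∃ λ j → l ≡ inj₂ j)
      isExtra? (inj₁ x) = no λ ()
      isExtra? (inj₂ j) = yes (j , refl)
    ... | yes (u₀ , j₀ , e₀) = pos j₀ , (λ u → subst (λ l → chpos (lab u) < chpos l + n) e₀ (near u₀ u) ,
                                             subst (λ l → chpos l < chpos (lab u) + n) e₀ (near u u₀)) , same
      where
      same : ∀ u j → lab u ≡ inj₂ j → pos j ≡ pos j₀
      same u j e = cong pos (Fin.toℕ-injective (ℕ.≤-antisym
        (pos-close {j} {j₀} n<M (<⇒≤ (subst₂ (λ l m → chpos l < chpos m + n) e e₀ (near u₀ u))))
        (pos-close {j₀} {j} n<M (<⇒≤ (subst₂ (λ l m → chpos l < chpos m + n) e₀ e (near u u₀))))))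
    ... | no none = chpos (lab u₀) , (λ u → near u₀ u , near u u₀) , λ u j e → ⊥-elim (none (u , j , e))
      where
      u₀ : Fin (V H)
      u₀ = Fin.fromℕ< (proj₁ con)

    chain-window : H ↪ F k n
    chain-window = g , g-inj , g-adj
      where
      p : ℕ
      p = proj₁ centre
      open Labelling (labelling k {n} 1≤n)
      relabel : CL → Label
      -- This translation moves the centre `p` to the middle `n` of the spine; the window has radius
      -- less than `n`, so the subtraction does not truncate.
      relabel (inj₁ x) = spine ((toℕ x + n) ∸ p)
      relabel (inj₂ j) = extra
      InWindow : CL → Set
      InWindow l = (chpos l < p + n × p < chpos l + n) × (∀ j → l ≡ inj₂ j → pos j ≡ p)
      inWindow : ∀ u → InWindow (lab u)
      inWindow u = proj₁ (proj₂ centre) u , proj₂ (proj₂ centre) u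
      shift : ∀ {x} → InWindow (inj₁ x) → Shift {p} {n} (toℕ x) ((toℕ x + n) ∸ p)
      shift ((_ , h) , _) = ℕ.m∸n+n≡m (<⇒≤ h)
      vertex : ∀ l → InWindow l → ∃ λ u → label u ≡ relabel l
      vertex (inj₁ x) w@((h , h′) , _) = label-spine ((toℕ x + n) ∸ p) (ℕ.m<n⇒0<n∸m h′)
        (ℕ.+-cancelʳ-< p _ _ (subst (_< (n + n) + p) (sym (shift w))
          (ℕ.<-≤-trans (ℕ.+-monoˡ-< n h) (≤-reflexive (trans (ℕ.+-assoc p n n) (ℕ.+-comm p (n + n)))))))
      vertex (inj₂ j) _ = label-extra
      g : Fin (V H) → Fin (V (F k n))
      g u = proj₁ (vertex (lab u) (inWindow u))
      g-label : ∀ u → label (g u) ≡ relabel (lab u)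
      g-label u = proj₂ (vertex (lab u) (inWindow u))
      relabel-inj : ∀ l m → InWindow l → InWindow m → relabel l ≡ relabel m → l ≡ m
      relabel-inj (inj₁ x) (inj₁ y) w w′ e = cong inj₁ (Fin.toℕ-injective (ℕ.+-cancelʳ-≡ n _ _
        (trans (sym (shift w)) (trans (cong (_+ p) (spine-injective e)) (shift w′)))))
      relabel-inj (inj₂ i) (inj₂ j) (_ , w) (_ , w′) e = cong inj₂ (pos-injective (trans (w i refl) (sym (w′ j refl))))
      relabel-adj : ∀ l m → InWindow l → InWindow m → clAdj l m ≡ labelAdj k n (relabel l) (relabel m)
      relabel-adj (inj₁ x) (inj₁ y) w w′ = shift-stepᵇ {p} {n} {toℕ x} {_} {toℕ y} (shift w) (shift w′)
      relabel-adj (inj₁ x) (inj₂ j) w (_ , w′) rewrite w′ j refl = shift-attach k (shift w)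
      relabel-adj (inj₂ j) (inj₁ x) (_ , w′) w rewrite w′ j refl = shift-attach k (shift w)
      relabel-adj (inj₂ i) (inj₂ j) _ _ = refl
      g-inj : Injective _≡_ _≡_ g
      g-inj {u} {v} e = finj (dec-injective (relabel-inj (lab u) (lab v) (inWindow u) (inWindow v)
        (trans (sym (g-label u)) (trans (cong label e) (g-label v)))))
      g-adj : ∀ u v → adj H u v ≡ adj (F k n) (g u) (g v)
      g-adj u v = trans (lab-adj u v) (trans (relabel-adj (lab u) (lab v) (inWindow u) (inWindow v))
        (trans (sym (cong₂ (labelAdj k n) (g-label u) (g-label v))) (sym (label-adj (g u) (g v)))))

-- Necessity of the four conditions

K-connected : ∀ n → 1 ≤ n → Connected (K n)
K-connected (suc n) _ = connected-to {G = K (suc n)} zero go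
  where
  go : ∀ v → Reach (K (suc n)) v zero
  go zero = here
  go (suc v) = step (true⇒T (K-adj (suc n) {suc v} {zero} λ ())) here

Star-connected : ∀ n → Connected (Star n)
Star-connected n = connected-to {G = Star n} zero λ { zero → here ; (suc v) → step _ here }

P-connected : ∀ n → 1 ≤ n → Connected (P n)
P-connected (suc n) _ = connected-to {G = P (suc n)} zero λ v → go (toℕ v) v refl
  where
  go : ∀ i (v : Fin (suc n)) → toℕ v ≡ i → Reach (P (suc n)) v zero
  go zero zero e = here
  go (suc i) (suc v) e = step {w = Fin.inject₁ v}
    (true⇒T (trans (P-adj (suc n) (suc v) (Fin.inject₁ v)) (stepᵇ-down (cong suc (sym (Fin.toℕ-inject₁ v))))))
    (go i (Fin.inject₁ v) (trans (Fin.toℕ-inject₁ v) (ℕ.suc-injective e)))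

S~-connected : ∀ n → Connected (S~ n)
S~-connected n = connected-to {G = S~ n} zero go
  where
  go : ∀ v → Reach (S~ n) v zero
  go zero = here
  go (suc v) = step (true⇒T (adj-flip (S~ n) {zero} {suc v} (∨-true⁺ˡ (∨-true⁺ˡ (<ᵇ-true (s≤s (Fin.toℕ<n v))))))) here

S*-connected : ∀ n → Connected (S* n)
S*-connected n = connected-to {G = S* n} zero go
  where
  S = S* n
  y z : Fin n → Fin (suc (n + n))
  y j = suc (j Fin.↑ˡ n)
  z j = suc (n Fin.↑ʳ j)
  y→0 : ∀ j → Reach S (y j) zero
  y→0 j = step (true⇒T (adj-flip S {zero} {y j} (∨-true⁺ˡ (∨-true⁺ˡ (<ᵇ-true (s≤s
    (subst (_< n) (sym (Fin.toℕ-↑ˡ j n)) (Fin.toℕ<n j)))))))) here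
  z→y : ∀ j → adj S (z j) (y j) ≡ true
  z→y j = adj-flip S {y j} {z j} (trans (adj-≢ S {y j} {z j} λ e → <⇒≢ (ℕ.<-≤-trans (Fin.toℕ<n j) (m≤m+n n _))
                   (trans (sym (Fin.toℕ-↑ˡ j n)) (trans (cong toℕ (Fin.suc-injective e)) (Fin.toℕ-↑ʳ n j))))
    (∨-true⁺ˡ (cong₂ _∧_ (<ᵇ-true (s≤s (subst (_< n) (sym (Fin.toℕ-↑ˡ j n)) (Fin.toℕ<n j))))
      (≡ᵇ-true (trans (cong suc (Fin.toℕ-↑ʳ n j)) (trans (sym (ℕ.+-suc n (toℕ j))) (cong (λ t → n + suc t) (sym (Fin.toℕ-↑ˡ j n)))))))))
  go : ∀ v → Reach S v zero
  go zero = here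
  go (suc v) with Fin.splitAt n v | Fin.join-splitAt n n v
  ... | inj₁ j | refl = y→0 j
  ... | inj₂ j | refl = step (true⇒T (z→y j)) (y→0 j)

module _ (ℋ : List Graph) where

  Hits : Graph → Set
  Hits X = ∃ λ H → H ∈ ℋ × (H ↪ X)

  ⊑-from-All : ∀ {𝒳} → All Hits 𝒳 → ℋ ⊑ 𝒳
  ⊑-from-All all H₂ H₂∈ = All.lookup all H₂∈

  necessity-insc : Bounded insc≤ ℋ → ∃ λ n → 4 ≤ n × ℋ ⊑ (K n ∷ S* n ∷ P n ∷ [])
  necessity-insc bnd@(c , _) = n , m≤n+m 4 (suc (c * 2) * 3) , ⊑-from-All
    ( member-embeds bnd (K n) (K-connected n 1≤n) (λ h → big (K-insc n c h))
    ∷ member-embeds bnd (S* n) (S*-connected n) (λ h → big (S*-insc n h))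
    ∷ member-embeds bnd (P n) (P-connected n 1≤n) (λ h → ℕ.1+n≰n (P-insc n (suc (c * 2)) (m≤m+n _ 4) h))
    ∷ [])
    where
    -- The factor 3 is for `P-insc`, which marks every third vertex and has to find 2c + 1 of them;
    -- the 4 gives `4 ≤ n`.
    n : ℕ
    n = suc (c * 2) * 3 + 4
    1≤n : 1 ≤ n
    1≤n = s≤s z≤n
    big : ¬ n ≤ c * 2
    big = <⇒≱ (≤-trans (ℕ.m≤m*n (suc (c * 2)) 3) (m≤m+n _ 4))

  necessity-insp : Bounded insp≤ ℋ → ∃ λ n → 4 ≤ n × ℋ ⊑ (K n ∷ S* n ∷ S~ n ∷ P n ∷ [])
  necessity-insp bnd@(c , _) = n , m≤n+m 4 (suc (c * 2) * 3) , ⊑-from-All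
    ( member-embeds bnd (K n) (K-connected n 1≤n) (λ h → big (K-insc n c (part⇒cover 𝒜s (K n) h)))
    ∷ member-embeds bnd (S* n) (S*-connected n) (λ h → big (S*-insc n (part⇒cover 𝒜s (S* n) h)))
    ∷ member-embeds bnd (S~ n) (S~-connected n) (λ h → big (S~-insp n h))
    ∷ member-embeds bnd (P n) (P-connected n 1≤n) (λ h → ℕ.1+n≰n (P-insc n (suc (c * 2)) (m≤m+n _ 4) (part⇒cover 𝒜s (P n) h)))
    ∷ [])
    where
    n : ℕ
    n = suc (c * 2) * 3 + 4
    1≤n : 1 ≤ n
    1≤n = s≤s z≤n
    big : ¬ n ≤ c * 2
    big = <⇒≱ (≤-trans (ℕ.m≤m*n (suc (c * 2)) 3) (m≤m+n _ 4))

  order≤sum : ∀ {H ℋ} → H ∈ ℋ → V H ≤ sum (map V ℋ)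
  order≤sum (here refl) = m≤m+n _ _
  order≤sum {ℋ = J ∷ _} (there i) = ≤-trans (order≤sum i) (m≤n+m _ (V J))

  module _ (con : All Connected ℋ) (c : ℕ) where

    -- It has to exceed 2c for the complete graph and the star, and to reach the order of whichever
    -- member of `ℋ` is found inside a chain, which is not known in advance; hence the sum of all
    -- orders.
    pathBound : ℕ
    pathBound = suc (c * 2) + sum (map V ℋ) + 4

    module _ {μ≤ : Graph → ℕ → Set} (bnd : ∀ G → Connected G → Free ℋ G → μ≤ G c) where

      private
        n = pathBound
        M≥3 : 3 ≤ suc n
        M≥3 = ℕ.m≤n⇒m≤1+n (≤-trans (n≤1+n 3) (m≤n+m 4 (suc (c * 2) + sum (map V ℋ))))

      chain-hits : ∀ k → ¬ μ≤ (Chain.chain k (suc n) (suc (c * 2)) M≥3) c → Hits (F k n)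
      chain-hits k ¬μ = H₁ , H∈ , ChainWindow.chain-window k (suc n) (suc (c * 2)) M≥3 H₁ (All.lookup con H∈) n
                           (≤-trans (order≤sum H∈) (≤-trans (m≤n+m _ (suc (c * 2))) (m≤m+n _ 4)))
                           ≤-refl (s≤s z≤n) emb
        where
        hit = member-embeds {μ≤} {ℋ} (c , bnd) _ (Chain.chain-connected k (suc n) (suc (c * 2)) M≥3) ¬μ
        H₁ = proj₁ hit
        H∈ = proj₁ (proj₂ hit)
        emb = proj₂ (proj₂ hit)

      -- The argument `weaken` lets one proof serve both path parameters, a partition being a cover.
      cover-hits : (∀ G → μ≤ G c → inpc≤ G c) → All Hits (K n ∷ Star n ∷ F1 n ∷ F2 n ∷ [])
      cover-hits weaken =
          member-embeds {μ≤} (c , bnd) (K n) (K-connected n (s≤s z≤n)) (λ h → big (K-inpc n (weaken (K n) h)))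
        ∷ member-embeds {μ≤} (c , bnd) (Star n) (Star-connected n) (λ h → big (Star-inpc n (weaken (Star n) h)))
        ∷ chain-hits pendant (λ h → ℕ.1+n≰n (Chain.chain-inpc pendant (suc n) (suc (c * 2)) M≥3 (λ {p} {x} {y} → pendant-clique p x y) (weaken _ h)))
        ∷ chain-hits triangle (λ h → ℕ.1+n≰n (Chain.chain-inpc triangle (suc n) (suc (c * 2)) M≥3 (λ {p} {x} {y} → triangle-clique p x y) (weaken _ h)))
        ∷ []
        where
        big : ¬ n ≤ c * 2
        big = <⇒≱ (≤-trans (m≤m+n (suc (c * 2)) _) (m≤m+n _ 4))
        pendant-clique : ∀ p x y → attach pendant p x ≡ true → attach pendant p y ≡ true → x ≢ y → stepᵇ x y ≡ true
        pendant-clique p x y hx hy ne = ⊥-elim (ne (trans (≡ᵇ-true⁻ {x} hx) (sym (≡ᵇ-true⁻ {y} hy))))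
        triangle-clique : ∀ p x y → attach triangle p x ≡ true → attach triangle p y ≡ true → x ≢ y → stepᵇ x y ≡ true
        triangle-clique p x y hx hy ne with ∨-true⁻ {x ≡ᵇ p} hx | ∨-true⁻ {y ≡ᵇ p} hy
        ... | inj₁ e | inj₁ e′ = ⊥-elim (ne (trans (≡ᵇ-true⁻ {x} e) (sym (≡ᵇ-true⁻ {y} e′))))
        ... | inj₁ e | inj₂ e′ = stepᵇ-up (trans (≡ᵇ-true⁻ {y} e′) (cong suc (sym (≡ᵇ-true⁻ {x} e))))
        ... | inj₂ e | inj₁ e′ = stepᵇ-down {x} (trans (≡ᵇ-true⁻ {x} e) (cong suc (sym (≡ᵇ-true⁻ {y} e′))))
        ... | inj₂ e | inj₂ e′ = ⊥-elim (ne (trans (≡ᵇ-true⁻ {x} e) (sym (≡ᵇ-true⁻ {y} e′))))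

      partition-hits : (∀ G → μ≤ G c → inpp≤ G c) → All Hits (F4 n ∷ F5 n ∷ [])
      partition-hits weaken =
          chain-hits twin₀ (λ h → ℕ.1+n≰n (ChainTwin.chain-inpp twin₀ (suc n) (suc (c * 2)) M≥3 inj₂ id (weaken _ h)))
        ∷ chain-hits twin₁ (λ h → ℕ.1+n≰n (ChainTwin.chain-inpp twin₁ (suc n) (suc (c * 2)) M≥3
            (λ {p} {x} → twin₁⁻ p x) (λ {p} {x} h → ∨-true⁺ʳ {x ≡ᵇ p} h) (weaken _ h)))
        ∷ []
        where
        twin₁⁻ : ∀ p x → attach twin₁ p x ≡ true → x ≡ p ⊎ stepᵇ p x ≡ true
        twin₁⁻ p x h with ∨-true⁻ {x ≡ᵇ p} h
        ... | inj₁ e = inj₁ (≡ᵇ-true⁻ e)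
        ... | inj₂ e = inj₂ e

  necessity-inpc : All Connected ℋ → Bounded inpc≤ ℋ → ∃ λ n → 4 ≤ n × ℋ ⊑ (K n ∷ Star n ∷ F1 n ∷ F2 n ∷ [])
  necessity-inpc con (c , bnd) = pathBound con c , m≤n+m 4 (suc (c * 2) + sum (map V ℋ)) , ⊑-from-All (cover-hits con c {inpc≤} bnd λ _ h → h)

  necessity-inpp : All Connected ℋ → Bounded inpp≤ ℋ →
                   ∃ λ n → 4 ≤ n × ℋ ⊑ (K n ∷ Star n ∷ F1 n ∷ F2 n ∷ F4 n ∷ F5 n ∷ [])
  necessity-inpp con (c , bnd) = pathBound con c , m≤n+m 4 (suc (c * 2) + sum (map V ℋ)) , ⊑-from-All
    (glue (cover-hits con c {inpp≤} bnd (λ G → part⇒cover 𝒜p G)) (partition-hits con c {inpp≤} bnd λ _ h → h))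
    where
    glue : ∀ {n} → All Hits (K n ∷ Star n ∷ F1 n ∷ F2 n ∷ []) → All Hits (F4 n ∷ F5 n ∷ []) →
           All Hits (K n ∷ Star n ∷ F1 n ∷ F2 n ∷ F4 n ∷ F5 n ∷ [])
    glue (a ∷ b ∷ c ∷ d ∷ []) (e ∷ f ∷ []) = a ∷ b ∷ c ∷ d ∷ e ∷ f ∷ []

-- Irredundant domination and spiders

Dominated : ∀ G → List (Fin (V G)) → Fin (V G) → Set
Dominated G D v = Any (λ d → adj G d v ≡ true) D

dominated? : ∀ G D v → Dec (Dominated G D v)
dominated? G D v = Any.any? (λ d → adj G d v Bool.≟ true) D

-- S* and S̃ differ in whether the centre sees the far vertices zᵢ.
S : Bool → ℕ → Graph
S false = S*
S true = S~

module _ (n : ℕ) where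

  reach : Bool → ℕ
  reach false = n
  reach true = n + n

  edgeS : Bool → ℕ → ℕ → Bool
  edgeS β a b = ((a ≡ᵇ 0) ∧ between 1 (reach β) b) ∨ (between 1 n a ∧ (b ≡ᵇ n + a))

  between₁ : ∀ {h a} → between 1 h (suc a) ≡ true → a < h
  between₁ {h} {a} e = <ᵇ-true⁻ {a} {h} e

  edgeS-centre : ∀ β b → edgeS β 0 (suc b) ∨ edgeS β (suc b) 0 ≡ between 1 (reach β) (suc b)
  edgeS-centre β b = trans (cong₂ _∨_ (Bool.∨-identityʳ _)
    (trans (cong (between 1 n (suc b) ∧_) (≡ᵇ-false {0} λ e → <⇒≢ (≤-trans (s≤s z≤n) (m≤n+m (suc b) n)) e)) (Bool.∧-zeroʳ _)))
    (Bool.∨-identityʳ _)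

  edgeS⁻ : ∀ β a b → edgeS β (suc a) (suc b) ≡ true → a < n × b ≡ n + a
  edgeS⁻ β a b h with x , y ← ∧-true⁻ {between 1 n (suc a)} h =
    between₁ {n} {a} x , ℕ.suc-injective (trans (≡ᵇ-true⁻ {suc b} y) (ℕ.+-suc n a))

  edgeS-yy : ∀ β a b → a < n → b < n → edgeS β (suc a) (suc b) ∨ edgeS β (suc b) (suc a) ≡ false
  edgeS-yy β a b a<n b<n = ≢true λ h → case ∨-true⁻ {edgeS β (suc a) (suc b)} h of λ where
    (inj₁ e) → <⇒≱ b<n (≤-trans (m≤m+n n a) (≤-reflexive (sym (proj₂ (edgeS⁻ β a b e)))))
    (inj₂ e) → <⇒≱ a<n (≤-trans (m≤m+n n b) (≤-reflexive (sym (proj₂ (edgeS⁻ β b a e)))))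

  edgeS-zz : ∀ β a b → edgeS β (suc (n + a)) (suc (n + b)) ∨ edgeS β (suc (n + b)) (suc (n + a)) ≡ false
  edgeS-zz β a b = ≢true λ h → case ∨-true⁻ {edgeS β (suc (n + a)) (suc (n + b))} h of λ where
    (inj₁ e) → <⇒≱ (proj₁ (edgeS⁻ β (n + a) (n + b) e)) (m≤m+n n a)
    (inj₂ e) → <⇒≱ (proj₁ (edgeS⁻ β (n + b) (n + a) e)) (m≤m+n n b)

  edgeS-yz : ∀ β a b → a < n → edgeS β (suc a) (suc (n + b)) ∨ edgeS β (suc (n + b)) (suc a) ≡ (a ≡ᵇ b)
  edgeS-yz β a b a<n = ≡-bool f g
    where
    f : edgeS β (suc a) (suc (n + b)) ∨ edgeS β (suc (n + b)) (suc a) ≡ true → (a ≡ᵇ b) ≡ true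
    f h with ∨-true⁻ {edgeS β (suc a) (suc (n + b))} h
    ... | inj₁ e = ≡ᵇ-true (sym (ℕ.+-cancelˡ-≡ n b a (proj₂ (edgeS⁻ β a (n + b) e))))
    ... | inj₂ e = ⊥-elim (<⇒≱ (proj₁ (edgeS⁻ β (n + b) a e)) (m≤m+n n b))
    g : (a ≡ᵇ b) ≡ true → edgeS β (suc a) (suc (n + b)) ∨ edgeS β (suc (n + b)) (suc a) ≡ true
    g h with refl ← ≡ᵇ-true⁻ {a} h = ∨-true⁺ˡ (cong₂ _∧_ (<ᵇ-true a<n) (≡ᵇ-true (sym (ℕ.+-suc n a))))

data SVertex (n : ℕ) : ℕ → Set where
  centreV : SVertex n 0
  yV : ∀ (i : Fin n) → SVertex n (suc (toℕ i))
  zV : ∀ (i : Fin n) → SVertex n (suc (n + toℕ i))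

sVertex : ∀ n a → a < suc (n + n) → SVertex n a
sVertex n zero _ = centreV
sVertex n (suc a) (s≤s lt) with a ℕ.<? n
... | yes p = subst (λ x → SVertex n (suc x)) (Fin.toℕ-fromℕ< p) (yV (Fin.fromℕ< p))
... | no ¬p = subst (λ x → SVertex n (suc x))
    (trans (cong (n +_) (Fin.toℕ-fromℕ< lt′)) (ℕ.m+[n∸m]≡n (≮⇒≥ ¬p))) (zV (Fin.fromℕ< lt′))
  where
  lt′ : a ∸ n < n
  lt′ = ℕ.+-cancelˡ-< n _ _ (subst (_< n + n) (sym (ℕ.m+[n∸m]≡n (≮⇒≥ ¬p))) lt)

module _ (G : Graph) where

  private
    Vx = Fin (V G)
    Private : Vx × Vx → Vx × Vx → Set
    Private (y , z) (y′ , z′) = adj G y z′ ≡ false × adj G y′ z ≡ false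

  -- Distinctness within the yᵢ and within the zᵢ follows from privacy: yᵢ sees zᵢ but no other zⱼ.
  -- And yᵢ = zⱼ with i ≠ j would make yⱼ adjacent to yᵢ.
  spider⇒S : ∀ β n x (ws : List (Vx × Vx)) → length ws ≡ n →
    All (λ (y , z) → adj G x y ≡ true × adj G y z ≡ true × adj G x z ≡ β × x ≢ z) ws →
    AllPairs Private ws →
    AllPairs (λ (y , _) (y′ , _) → adj G y y′ ≡ false) ws →
    AllPairs (λ (_ , z) (_ , z′) → adj G z z′ ≡ false) ws → S β n ↪ G
  spider⇒S β n x ws refl all priv yy zz = mkEmb< {S β n} {G} f′ ok
    where
    y z : Fin n → Vx
    y i = proj₁ (lookup ws i)
    z i = proj₂ (lookup ws i)
    at : ∀ i → adj G x (y i) ≡ true × adj G (y i) (z i) ≡ true × adj G x (z i) ≡ β × x ≢ z i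
    at i = All.lookup all (∈-lookup i)
    y≁z : ∀ i j → i ≢ j → adj G (y i) (z j) ≡ false
    y≁z i j ne with ℕ.<-cmp (toℕ i) (toℕ j)
    ... | tri< lt _ _ = proj₁ (AllPairs-lookup priv i j lt)
    ... | tri≈ _ e _ = ⊥-elim (ne (Fin.toℕ-injective e))
    ... | tri> _ _ gt = proj₂ (AllPairs-lookup priv j i gt)
    f : ∀ {a} → SVertex n a → Vx
    f centreV = x
    f (yV i) = y i
    f (zV i) = z i
    good : ∀ {a b} (s : SVertex n a) (t : SVertex n b) → a < b →
           f s ≢ f t × edgeS n β a b ∨ edgeS n β b a ≡ adj G (f s) (f t)
    good centreV centreV ()
    good (yV i) centreV ()
    good (zV i) centreV ()
    good centreV (yV i) _ = adj⇒≢ G (proj₁ (at i)) ,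
      trans (edgeS-centre n β (toℕ i)) (trans (<ᵇ-true (ℕ.<-≤-trans (Fin.toℕ<n i) (le β))) (sym (proj₁ (at i))))
      where
      le : ∀ β → n ≤ reach n β
      le false = ≤-refl
      le true = m≤m+n n n
    good centreV (zV i) _ = proj₂ (proj₂ (proj₂ (at i))) ,
      trans (edgeS-centre n β (n + toℕ i)) (trans (val β) (sym (proj₁ (proj₂ (proj₂ (at i))))))
      where
      val : ∀ β → between 1 (reach n β) (suc (n + toℕ i)) ≡ β
      val false = <ᵇ-false (ℕ.≤⇒≯ (m≤m+n n (toℕ i)))
      val true = <ᵇ-true (ℕ.+-monoʳ-< n (Fin.toℕ<n i))
    good (yV i) (yV j) (s≤s lt) =
      (λ e → true≢false (proj₁ (proj₂ (at i))) (trans (cong (λ v → adj G v (z i)) e) (y≁z j i (λ { refl → ℕ.<-irrefl refl lt })))) ,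
      trans (edgeS-yy n β (toℕ i) (toℕ j) (Fin.toℕ<n i) (Fin.toℕ<n j)) (sym (AllPairs-lookup yy i j lt))
    good (zV i) (zV j) (s≤s lt) =
      (λ e → true≢false (proj₁ (proj₂ (at i))) (trans (cong (adj G (y i)) e) (y≁z i j (λ { refl → ℕ.<-irrefl refl lt })))) ,
      trans (edgeS-zz n β (toℕ i) (toℕ j)) (sym (AllPairs-lookup zz i j (ℕ.+-cancelˡ-< n _ _ lt)))
    good (zV i) (yV j) (s≤s lt) = ⊥-elim (<⇒≱ (ℕ.<-trans lt (Fin.toℕ<n j)) (m≤m+n n (toℕ i)))
    good (yV i) (zV j) lt with i ≟ j
    ... | yes refl = adj⇒≢ G (proj₁ (proj₂ (at i))) ,
      trans (edgeS-yz n β (toℕ i) (toℕ i) (Fin.toℕ<n i)) (trans (≡ᵇ-true {toℕ i} refl) (sym (proj₁ (proj₂ (at i)))))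
    ... | no ne = (λ e → true≢false (adj-flip G (proj₁ (proj₂ (at j)))) (trans (cong (λ v → adj G v (y j)) (sym e)) (AllPairs-yy i j ne))) ,
      trans (edgeS-yz n β (toℕ i) (toℕ j) (Fin.toℕ<n i)) (trans (≡ᵇ-false (ne ∘ Fin.toℕ-injective)) (sym (y≁z i j ne)))
      where
      AllPairs-yy : ∀ i j → i ≢ j → adj G (y i) (y j) ≡ false
      AllPairs-yy i j ne with ℕ.<-cmp (toℕ i) (toℕ j)
      ... | tri< lt _ _ = AllPairs-lookup yy i j lt
      ... | tri≈ _ e _ = ⊥-elim (ne (Fin.toℕ-injective e))
      ... | tri> _ _ gt = adj-flip G (AllPairs-lookup yy j i gt)
    V-S : ∀ β → V (S β n) ≡ suc (n + n)
    V-S false = refl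
    V-S true = refl
    vertex : ∀ (u : Fin (V (S β n))) → SVertex n (toℕ u)
    vertex u = sVertex n (toℕ u) (subst (toℕ u <_) (V-S β) (Fin.toℕ<n u))
    f′ : Fin (V (S β n)) → Vx
    f′ u = f (vertex u)
    edges : ∀ β (u v : Fin (V (S β n))) → E (S β n) u v ≡ edgeS n β (toℕ u) (toℕ v)
    edges false u v = refl
    edges true u v = refl
    ok : ∀ u v → toℕ u < toℕ v → f′ u ≢ f′ v × (E (S β n) u v ∨ E (S β n) v u) ≡ adj G (f′ u) (f′ v)
    ok u v lt = let (a , b) = good (vertex u) (vertex v) lt in
      a , trans (cong₂ _∨_ (edges β u v) (edges β v u)) b

  -- Deleting superfluous vertices one by one from A leaves a dominating set in which every
  -- vertex has a private neighbour; K collects the vertices already found necessary.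
  irredundant : (B : Vx → Set) (B? : Decidable B) (A : List Vx) → ∃ λ (ps : List (Vx × Vx)) →
    All (λ (d , p) → d ∈ A × B p × adj G d p ≡ true) ps × AllPairs Private ps ×
    (∀ b → B b → Dominated G A b → Dominated G (map proj₁ ps) b)
  irredundant B B? A = let (ps , a , b , _ , d) = go [] A in
    ps , a , b , λ v bv dom → case d v bv (inj₂ dom) of λ { (inj₁ ()) ; (inj₂ q) → q }
    where
    go : ∀ K A → ∃ λ (ps : List (Vx × Vx)) →
      All (λ (d , p) → d ∈ A × B p × adj G d p ≡ true) ps × AllPairs Private ps ×
      All (λ (d , p) → ¬ Dominated G K p) ps ×
      (∀ b → B b → Dominated G K b ⊎ Dominated G A b → Dominated G K b ⊎ Dominated G (map proj₁ ps) b)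
    go K [] = [] , [] , [] , [] , λ b _ d → d
    go K (a ∷ A) with Fin.any? (λ p → B? p ×-dec (adj G a p Bool.≟ true) ×-dec ¬? (dominated? G K p) ×-dec ¬? (dominated? G A p))
    ... | yes (p , Bp , ap , ¬K , ¬A) with go (a ∷ K) A
    ...   | ps , all , pr , ¬K′ , dom =
      (a , p) ∷ ps , (here refl , Bp , ap) ∷ All.map (λ (d∈ , q) → there d∈ , q) all ,
      All.zipWith (λ ((d∈ , _) , ¬k) → ≢true (λ h → ¬k (here h)) , ≢true (λ h → ¬A (lose d∈ h))) (all , ¬K′) ∷ pr ,
      ¬K ∷ All.map (λ ¬k k → ¬k (there k)) ¬K′ ,
      dom′
      where
      dom′ : ∀ b → B b → Dominated G K b ⊎ Dominated G (a ∷ A) b → Dominated G K b ⊎ Dominated G (a ∷ map proj₁ ps) b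
      dom′ b Bb d with dom b Bb (case d of λ { (inj₁ k) → inj₁ (there k) ; (inj₂ (here e)) → inj₁ (here e) ; (inj₂ (there e)) → inj₂ e })
      ... | inj₁ (here e) = inj₂ (here e)
      ... | inj₁ (there k) = inj₁ k
      ... | inj₂ e = inj₂ (there e)
    go K (a ∷ A) | no none with go K A
    ... | ps , all , pr , ¬K , dom = ps , All.map (λ (d∈ , q) → there d∈ , q) all , pr , ¬K , dom′
      where
      dom′ : ∀ b → B b → Dominated G K b ⊎ Dominated G (a ∷ A) b → Dominated G K b ⊎ Dominated G (map proj₁ ps) b
      dom′ b Bb (inj₁ k) = inj₁ k
      dom′ b Bb (inj₂ (there e)) = dom b Bb (inj₂ e)
      dom′ b Bb (inj₂ (here e)) with dominated? G K b | dominated? G A b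
      ... | yes k | _ = inj₁ k
      ... | no _ | yes a = dom b Bb (inj₂ a)
      ... | no ¬k | no ¬a = ⊥-elim (none (b , Bb , e , ¬k , ¬a))

-- The outer Ramsey number makes the yᵢ independent and leaves enough pairs for the inner one to
-- make the zᵢ independent.
domination : ℕ → ℕ
domination n = ramseyNumber n (ramseyNumber n n)

-- Used with `β = false` in `nextLevel`, where the set `B` lies two levels below `x`, and with
-- `β = true` in `starPart`, where it lies in the neighbourhood of the centre.
dominate : ∀ G β n → ¬ (K n ↪ G) → ¬ (S β n ↪ G) → ∀ x (A : List (Fin (V G))) →
  All (λ a → adj G x a ≡ true) A →
  (B : Fin (V G) → Set) → Decidable B → (∀ b → B b → adj G x b ≡ β × x ≢ b) →
  ∃ λ D → (∀ {d} → d ∈ D → d ∈ A) × length D ≤ domination n × (∀ b → B b → Dominated G A b → Dominated G D b)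
dominate G β n noK noS x A xA B B? xB with irredundant G B B? A
... | ps , all , priv , dom with domination n ℕ.≤? length ps
...   | no small = map proj₁ ps , sub , ≤-trans (≤-reflexive (List.length-map proj₁ ps)) (<⇒≤ (≰⇒> small)) , dom
  where
  sub : ∀ {d} → d ∈ map proj₁ ps → d ∈ A
  sub d∈ with ∈-map⁻ proj₁ d∈
  ... | p , p∈ , refl = proj₁ (All.lookup all p∈)
...   | yes large with ramsey (λ p q → adj G (proj₁ p) (proj₁ q)) n (ramseyNumber n n) ps large
...     | qs , _ , inj₁ (l , cl) = ⊥-elim (noK (clique⇒K G n (map proj₁ qs) (trans (List.length-map proj₁ qs) l) (AllPairs.map⁺ cl)))
...     | qs , qs⊆ , inj₂ (l , ind) with ramsey (λ p q → adj G (proj₂ p) (proj₂ q)) n n qs (≤-reflexive (sym l))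
...       | ws , _ , inj₁ (l′ , cl) = ⊥-elim (noK (clique⇒K G n (map proj₂ ws) (trans (List.length-map proj₂ ws) l′) (AllPairs.map⁺ cl)))
...       | ws , ws⊆ , inj₂ (l′ , ind′) = ⊥-elim (noS (spider⇒S G β n x ws l′
            (All.map (λ (d∈ , Bp , dp) → All.lookup xA d∈ , dp , xB _ Bp) (All-resp-⊆ (⊆-trans ws⊆ qs⊆) all))
            (AllPairs-resp-⊆ (⊆-trans ws⊆ qs⊆) priv) (AllPairs-resp-⊆ ws⊆ ind) ind′))

-- Breadth-first search

module BFS (G : Graph) (S : Fin (V G) → Set) (S? : Decidable S) (r : Fin (V G)) (Sr : S r) where

  private
    Vx = Fin (V G)

  -- The search is confined to `S` because `colour` runs it inside the vertex sets of its induction.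
  Ball : ℕ → Vx → Set
  Ball zero v = v ≡ r
  Ball (suc k) v = Ball k v ⊎ (S v × ∃ λ u → Ball k u × adj G u v ≡ true)

  ball? : ∀ k → Decidable (Ball k)
  ball? zero v = v ≟ r
  ball? (suc k) v = ball? k v ⊎-dec (S? v ×-dec Fin.any? (λ u → ball? k u ×-dec (adj G u v Bool.≟ true)))

  Level : ℕ → Vx → Set
  Level zero v = v ≡ r
  Level (suc k) v = Ball (suc k) v × ¬ Ball k v

  level? : ∀ k → Decidable (Level k)
  level? zero v = v ≟ r
  level? (suc k) v = ball? (suc k) v ×-dec ¬? (ball? k v)

  ball-⊆ : ∀ k {v} → Ball k v → S v
  ball-⊆ zero refl = Sr
  ball-⊆ (suc k) (inj₁ b) = ball-⊆ k b
  ball-⊆ (suc k) (inj₂ (s , _)) = s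

  ball-mono : ∀ {j k v} → j ≤ k → Ball j v → Ball k v
  ball-mono {zero} {zero} _ b = b
  ball-mono {zero} {suc k} _ b = inj₁ (ball-mono {zero} {k} z≤n b)
  ball-mono {suc j} {suc k} (s≤s le) (inj₁ b) = inj₁ (ball-mono le b)
  ball-mono {suc j} {suc k} (s≤s le) (inj₂ (s , u , b , e)) = inj₂ (s , u , ball-mono le b , e)

  level⇒ball : ∀ k {v} → Level k v → Ball k v
  level⇒ball zero l = l
  level⇒ball (suc k) l = proj₁ l

  level-⊆ : ∀ k {v} → Level k v → S v
  level-⊆ k l = ball-⊆ k (level⇒ball k l)

  ball⇒level : ∀ k {v} → Ball k v → ∃ λ i → i ≤ k × Level i v
  ball⇒level zero b = 0 , z≤n , b
  ball⇒level (suc k) {v} b with ball? k v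
  ... | yes b′ = let (i , le , l) = ball⇒level k b′ in i , ℕ.m≤n⇒m≤1+n le , l
  ... | no ¬b = suc k , ≤-refl , b , ¬b

  level-< : ∀ {i j v} → Ball i v → Level j v → j ≤ i
  level-< {j = zero} b l = z≤n
  level-< {i} {suc j} b l with i ℕ.≤? j
  ... | yes p = ⊥-elim (proj₂ l (ball-mono p b))
  ... | no ¬p = ≰⇒> ¬p

  level-unique : ∀ {i j v} → Level i v → Level j v → i ≡ j
  level-unique {i} {j} l l′ = ℕ.≤-antisym (level-< (level⇒ball j l′) l) (level-< (level⇒ball i l) l′)

  level-adj : ∀ {i j u v} → Level i u → Level j v → adj G u v ≡ true → j ≤ suc i
  level-adj {i} {j} lu lv e = level-< {suc i} (inj₂ (level-⊆ j lv , _ , level⇒ball i lu , e)) lv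

  level-nonadj : ∀ {i j u v} → Level i u → Level j v → suc i < j → adj G u v ≡ false
  level-nonadj lu lv lt = ≢true λ e → <⇒≱ lt (level-adj lu lv e)

  level-parent : ∀ i {v} → Level (suc i) v → ∃ λ u → Level i u × adj G u v ≡ true
  level-parent i (inj₁ b , ¬b) = ⊥-elim (¬b b)
  level-parent zero (inj₂ (s , u , b , e) , ¬b) = u , b , e
  level-parent (suc i) (inj₂ (s , u , b , e) , ¬b) = u , (b , λ b′ → ¬b (inj₂ (s , u , b′ , e))) , e

  -- A total function whose values beyond `m` are arbitrary; this keeps extending a chain and
  -- exchanging one of its vertices free of dependent indices.
  Chain : ℕ → (ℕ → Vx) → Set
  Chain m c = (∀ {i} → i ≤ m → Level i (c i)) × (∀ {i} → i < m → adj G (c i) (c (suc i)) ≡ true)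

  extend : (ℕ → Vx) → ℕ → Vx → ℕ → Vx
  extend c m w i with i ℕ.≤? m
  ... | yes _ = c i
  ... | no _ = w

  extend-old : ∀ c m w {i} → i ≤ m → extend c m w i ≡ c i
  extend-old c m w {i} le with i ℕ.≤? m
  ... | yes _ = refl
  ... | no q = ⊥-elim (q le)

  extend-new : ∀ c m w → extend c m w (suc m) ≡ w
  extend-new c m w with suc m ℕ.≤? m
  ... | yes p = ⊥-elim (ℕ.1+n≰n p)
  ... | no _ = refl

  chain-extend : ∀ {m c w} → Chain m c → Level (suc m) w → adj G (c m) w ≡ true → Chain (suc m) (extend c m w)
  chain-extend {m} {c} {w} (lev , ad) lw e = lev′ , ad′
    where
    lev′ : ∀ {i} → i ≤ suc m → Level i (extend c m w i)
    lev′ {i} le with i ℕ.≤? m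
    ... | yes p = lev p
    ... | no q = subst (λ x → Level x w) (ℕ.≤-antisym (≰⇒> q) le) lw
    ad′ : ∀ {i} → i < suc m → adj G (extend c m w i) (extend c m w (suc i)) ≡ true
    ad′ {i} (s≤s le) rewrite extend-old c m w le with suc i ℕ.≤? m
    ... | yes p = ad p
    ... | no q with refl ← ℕ.≤-antisym le (≤-pred (≰⇒> q)) = e

  chain-to : ∀ i {v} → Level i v → ∃ λ c → Chain i c × c i ≡ v
  chain-to zero {v} l = (λ _ → v) , ((λ { z≤n → l }) , λ ()) , refl
  chain-to (suc i) {v} l =
    let (u , lu , e) = level-parent i l
        (c , ch , cu) = chain-to i lu
    in extend c i v , chain-extend ch l (trans (cong (λ x → adj G x v) cu) e) , extend-new c i v

  -- No edge skips a level and a chain has one vertex on each level, so a chain is automatically an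
  -- induced path.
  chain-adj : ∀ {m c} → Chain m c → ∀ {i j} → i ≤ m → j ≤ m → adj G (c i) (c j) ≡ stepᵇ i j
  chain-adj {m} {c} (lev , ad) {i} {j} i≤ j≤ = ≡-bool f g
    where
    f : adj G (c i) (c j) ≡ true → stepᵇ i j ≡ true
    f h with ℕ.<-cmp i j
    ... | tri< lt _ _ = stepᵇ-up (ℕ.≤-antisym (level-adj (lev i≤) (lev j≤) h) lt)
    ... | tri≈ _ refl _ = ⊥-elim (true≢false h (adj-irrefl G (c i)))
    ... | tri> _ _ gt = stepᵇ-down (ℕ.≤-antisym (level-adj (lev j≤) (lev i≤) (adj-flip G h)) gt)
    g : stepᵇ i j ≡ true → adj G (c i) (c j) ≡ true
    g h with stepᵇ-true⁻ {i} {j} h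
    ... | inj₁ refl = ad j≤
    ... | inj₂ refl = adj-flip G (ad i≤)

  chain-injective : ∀ {m c} → Chain m c → ∀ {i j} → i ≤ m → j ≤ m → c i ≡ c j → i ≡ j
  chain-injective {m} {c} (lev , _) {i} {j} i≤ j≤ e = level-unique (lev i≤) (subst (Level j) (sym e) (lev j≤))

  chain⇒P : ∀ {m c} → Chain m c → P (suc m) ↪ G
  chain⇒P {m} {c} ch = path⇒P G (suc m) c (λ { (s≤s a) (s≤s b) → chain-injective ch a b })
                                          (λ { (s≤s a) (s≤s b) → chain-adj ch a b })

-- Domination level by level

module _ (n : ℕ) where

  levelBound : ℕ → ℕ
  levelBound zero = 1
  levelBound (suc m) = domination n * levelBound m

  componentBound : ℕ → ℕ
  componentBound zero = 1
  componentBound (suc m) = componentBound m + levelBound m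

module Component (G : Graph) (n : ℕ) (noK : ¬ (K n ↪ G)) (noS : ¬ (S* n ↪ G))
                 (S : Fin (V G) → Set) (S? : Decidable S) (r : Fin (V G)) (Sr : S r) where

  open BFS G S S? r Sr public

  private
    Vx = Fin (V G)

  -- A vertex two levels below `D` has a parent that is seen by some x in `D`. For each x, its
  -- neighbours on the level between are thinned to few that still dominate the same vertices; as x
  -- sees none of these, a failure would produce S*.
  nextLevel : ∀ i D → All (Level i) D → (∀ v → Level (suc i) v → Dominated G D v) →
              ∃ λ D′ → All (Level (suc i)) D′ × length D′ ≤ domination n * length D ×
                       (∀ v → Level (2 + i) v → Dominated G D′ v)
  nextLevel i D lev dom =
    let (D′ , l , b , d) = go D lev in D′ , l , b , λ v lv →
      let (u , lu , e) = level-parent (suc i) lv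
          (x , x∈ , xu) = find (dom u lu)
      in d x∈ lu xu lv e
    where
    kid? : ∀ x → Decidable (λ u → Level (suc i) u × adj G x u ≡ true)
    kid? x u = level? (suc i) u ×-dec (adj G x u Bool.≟ true)
    go : ∀ D → All (Level i) D → ∃ λ D′ → All (Level (suc i)) D′ × length D′ ≤ domination n * length D ×
         (∀ {x u v} → x ∈ D → Level (suc i) u → adj G x u ≡ true → Level (2 + i) v → adj G u v ≡ true → Dominated G D′ v)
    go [] _ = [] , [] , z≤n , λ ()
    go (x ∷ D) (lx ∷ lev) with go D lev | dominate G false n noK noS x (filter (kid? x) (allFin _))
         (All.tabulate λ u∈ → proj₂ (proj₂ (∈-filter⁻ (kid? x) {xs = allFin _} u∈)))
         (Level (2 + i)) (level? (2 + i))
         (λ b lb → level-nonadj lx lb ≤-refl , λ { refl → <⇒≢ (m≤n+m (suc i) 1) (level-unique lx lb) })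
    ... | D₁ , l₁ , b₁ , d₁ | D₂ , sub , b₂ , d₂ = D₂ ++ D₁ ,
      All.++⁺ (All.tabulate λ d∈ → proj₁ (proj₂ (∈-filter⁻ (kid? x) {xs = allFin _} (sub d∈)))) l₁ ,
      ≤-trans (≤-reflexive (List.length-++ D₂)) (≤-trans (ℕ.+-mono-≤ b₂ b₁) (≤-reflexive (sym (ℕ.*-suc (domination n) (length D))))) ,
      dom′
      where
      dom′ : ∀ {y u v} → y ∈ x ∷ D → Level (suc i) u → adj G y u ≡ true → Level (2 + i) v → adj G u v ≡ true → Dominated G (D₂ ++ D₁) v
      dom′ {u = u} {v} (here refl) lu xu lv e = Any.++⁺ˡ (d₂ v lv (lose (∈-filter⁺ (kid? x) (∈-allFin u) (lu , xu)) e))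
      dom′ (there y∈) lu xu lv e = Any.++⁺ʳ D₂ (d₁ y∈ lu xu lv e)

  levelDomination : ∀ i → ∃ λ D → All (Level i) D × length D ≤ levelBound n i × (∀ v → Level (suc i) v → Dominated G D v)
  levelDomination zero = r ∷ [] , refl ∷ [] , s≤s z≤n , λ v lv →
    let (u , lu , e) = level-parent 0 lv in here (subst (λ x → adj G x v ≡ true) lu e)
  levelDomination (suc i) =
    let (D , l , b , d) = levelDomination i
        (D′ , l′ , b′ , d′) = nextLevel i D l d
    in D′ , l′ , ≤-trans b′ (ℕ.*-monoʳ-≤ (domination n) b) , d′

  ballDomination : ∀ m → ∃ λ D → All S D × length D ≤ componentBound n m × (∀ v → Ball m v → v ∈ D ⊎ Dominated G D v)
  ballDomination zero = r ∷ [] , Sr ∷ [] , s≤s z≤n , λ v b → inj₁ (here b)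
  ballDomination (suc m) with ballDomination m | levelDomination m
  ... | D , l , b , d | D′ , l′ , b′ , d′ = D ++ D′ , All.++⁺ l (All.map (level-⊆ m) l′) ,
    ≤-trans (≤-reflexive (List.length-++ D)) (ℕ.+-mono-≤ b b′) , dom
    where
    dom : ∀ v → Ball (suc m) v → v ∈ (D ++ D′) ⊎ Dominated G (D ++ D′) v
    dom v bv with ball? m v
    ... | no ¬b = inj₂ (Any.++⁺ʳ D (d′ v (bv , ¬b)))
    ... | yes bv′ with d v bv′
    ...   | inj₁ e = inj₁ (∈-++⁺ˡ e)
    ...   | inj₂ e = inj₂ (Any.++⁺ˡ e)

  -- Level `m` is empty, since a chain down to it would be an induced path on m + 1 vertices. So the
  -- ball is closed under neighbours in `S`.
  ball-closed : ∀ m → ¬ (P (suc m) ↪ G) → ∀ {u v} → Ball m u → S v → adj G u v ≡ true → Ball m v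
  ball-closed m noP bu Sv e with ball⇒level m bu
  ... | i , le , lu with i ℕ.≟ m
  ...   | yes refl = ⊥-elim (noP (chain⇒P (proj₁ (proj₂ (chain-to m lu)))))
  ...   | no ne = ball-mono (ℕ.≤∧≢⇒< le ne) (inj₂ (Sv , _ , level⇒ball i lu , e))

-- Combining covers and partitions

module Pieces (A : ℕ → Graph) (G : Graph) where

  private
    Vx = Fin (V G)

  In : Vx → Piece A G → Set
  In = InPiece {A} {G}

  -- Pieces of a `Cover` may stick out of the set, those of a `Part` may not; this is what lets
  -- partitions of disjoint sets be joined.
  Cover Part : (Vx → Set) → ℕ → Set
  Cover S k = Σ (List (Piece A G)) λ L → (∀ {v} → S v → Any (In v) L) × length L ≤ k
  Part S k = Σ (List (Piece A G)) λ L → (∀ {v} → S v → Any (In v) L) × All (λ p → ∀ v → In v p → S v) L ×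
             AllPairs (DisjointPieces {A} {G}) L × length L ≤ k

  cover-∪ : ∀ {S T U k l} → (∀ {v} → U v → S v ⊎ T v) → Cover S k → Cover T l → Cover U (k + l)
  cover-∪ f (L , c , b) (M , d , b′) = L ++ M ,
    (λ u → case f u of λ { (inj₁ s) → Any.++⁺ˡ (c s) ; (inj₂ t) → Any.++⁺ʳ L (d t) }) ,
    ≤-trans (≤-reflexive (List.length-++ L)) (ℕ.+-mono-≤ b b′)

  cover-≤ : ∀ {S k l} → k ≤ l → Cover S k → Cover S l
  cover-≤ le (L , c , b) = L , c , ≤-trans b le

  cover-⊆ : ∀ {S T k} → (∀ {v} → T v → S v) → Cover S k → Cover T k
  cover-⊆ f (L , c , b) = L , c ∘ f , b

  cover-⋃ : ∀ {S : ℕ → Vx → Set} {k} m → (∀ i → Cover (S i) k) → Cover (λ v → ∃ λ i → i < m × S i v) (m * k)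
  cover-⋃ zero h = [] , (λ { (_ , () , _) }) , z≤n
  cover-⋃ {S} (suc m) h = cover-∪ f (h m) (cover-⋃ m h)
    where
    f : ∀ {v} → (∃ λ i → i < suc m × S i v) → S m v ⊎ (∃ λ i → i < m × S i v)
    f (i , lt , s) with i ℕ.≟ m
    ... | yes refl = inj₁ s
    ... | no ne = inj₂ (i , ℕ.≤∧≢⇒< (≤-pred lt) ne , s)

  cover-list : ∀ {X : Set} {S : X → Vx → Set} {k} xs → (∀ x → x ∈ xs → Cover (S x) k) →
               Cover (λ v → ∃ λ x → x ∈ xs × S x v) (length xs * k)
  cover-list [] h = [] , (λ { (_ , () , _) }) , z≤n
  cover-list (x ∷ xs) h = cover-∪ (λ { (_ , here refl , s) → inj₁ s ; (y , there y∈ , s) → inj₂ (y , y∈ , s) })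
                                 (h x (here refl)) (cover-list xs λ y y∈ → h y (there y∈))

  part-∪ : ∀ {S T U k l} → (∀ {v} → U v → S v ⊎ T v) → (∀ {v} → S v → U v) → (∀ {v} → T v → U v) →
           (∀ {v} → S v → T v → ⊥) → Part S k → Part T l → Part U (k + l)
  part-∪ f s t disj (L , c , i , p , b) (M , d , j , q , b′) = L ++ M ,
    (λ u → case f u of λ { (inj₁ s) → Any.++⁺ˡ (c s) ; (inj₂ t) → Any.++⁺ʳ L (d t) }) ,
    All.++⁺ (All.map (λ h v x → s (h v x)) i) (All.map (λ h v x → t (h v x)) j) ,
    AllPairs.++⁺ p q (All.map (λ h → All.map (λ h′ v a b → disj (h v a) (h′ v b)) j) i) ,
    ≤-trans (≤-reflexive (List.length-++ L)) (ℕ.+-mono-≤ b b′)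

  part-≤ : ∀ {S k l} → k ≤ l → Part S k → Part S l
  part-≤ le (L , c , i , p , b) = L , c , i , p , ≤-trans b le

  part-resp : ∀ {S T k} → (∀ {v} → T v → S v) → (∀ {v} → S v → T v) → Part S k → Part T k
  part-resp f g (L , c , i , p , b) = L , c ∘ f , All.map (λ h v x → g (h v x)) i , p , b

  part-piece : ∀ {S} (p : Piece A G) → (∀ {v} → S v → In v p) → (∀ {v} → In v p → S v) → Part S 1
  part-piece p f g = p ∷ [] , (λ s → here (f s)) , ((λ _ → g) ∷ []) , ([] ∷ []) , s≤s z≤n

-- Stars and bounded colourings

module _ (G : Graph) where

  private
    Vx = Fin (V G)

  nonadj⇒Indep : ∀ {T : Vx → Set} → (∀ {u v} → T u → T v → adj G u v ≡ false) → ∀ {xs} → All T xs → Unique xs → Indep G xs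
  nonadj⇒Indep h [] [] = []
  nonadj⇒Indep h (t ∷ ts) (u ∷ us) = All.zipWith (λ (t′ , ne) → ne , h t t′) (ts , u) ∷ nonadj⇒Indep h ts us

  starPiece : ∀ d (T : Vx → Set) → Decidable T → (∀ {v} → T v → adj G d v ≡ true) → (∀ {u v} → T u → T v → adj G u v ≡ false) →
              Σ (Piece 𝒜s G) λ p → (∀ {v} → v ≡ d ⊎ T v → InPiece {𝒜s} {G} v p) × (∀ {v} → InPiece {𝒜s} {G} v p → v ≡ d ⊎ T v)
  starPiece d T T? nb ind = (length xs , star⇒Star G (length xs) d xs refl (All.map nb allT)
                              (nonadj⇒Indep ind allT (Unique.filter⁺ T? (Unique.allFin⁺ (V G))))) , f , g
    where
    xs : List Vx
    xs = filter T? (allFin (V G))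
    allT : All T xs
    allT = All.all-filter T? (allFin (V G))
    f : ∀ {v} → v ≡ d ⊎ T v → _
    f (inj₁ refl) = zero , refl
    f {v} (inj₂ t) = let v∈ = ∈-filter⁺ T? (∈-allFin v) t in suc (Any.index v∈) , sym (Any.lookup-index v∈)
    g : ∀ {v} → _ → v ≡ d ⊎ T v
    g (zero , refl) = inj₁ refl
    g (suc i , refl) = inj₂ (All.lookup allT (∈-lookup i))

  CliqueFree : (Vx → Set) → ℕ → Set
  CliqueFree S t = ∀ xs → All S xs → AllPairs (λ u v → adj G u v ≡ true) xs → length xs ≡ t → ⊥

  cliqueFree-nbr : ∀ {S t d} → CliqueFree S (suc t) → S d → CliqueFree (λ v → S v × adj G d v ≡ true) t
  cliqueFree-nbr {d = d} cf Sd xs all ap l = cf (d ∷ xs) (Sd ∷ All.map proj₁ all) (All.map proj₂ all ∷ ap) (cong suc l)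

  cliqueFree-⊆ : ∀ {S T t} → (∀ {v} → T v → S v) → CliqueFree S t → CliqueFree T t
  cliqueFree-⊆ f cf xs all = cf xs (All.map f all)

  Colourable : (Vx → Set) → ℕ → Set
  Colourable S k = Σ (Vx → ℕ) λ col → (∀ {v} → S v → col v < k) × (∀ {u v} → S u → S v → adj G u v ≡ true → col u ≢ col v)

  colour-⊆ : ∀ {S T k} → (∀ {v} → T v → S v) → Colourable S k → Colourable T k
  colour-⊆ f (c , b , p) = c , b ∘ f , λ u v → p (f u) (f v)

  colour-≤ : ∀ {S k l} → k ≤ l → Colourable S k → Colourable S l
  colour-≤ le (c , b , p) = c , (λ s → ≤-trans (b s) le) , p

  colour-∪ : ∀ {S T k l} → Decidable S → Colourable S k → Colourable T l → Colourable (λ v → S v ⊎ T v) (k + l)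
  colour-∪ {S} {T} {k} {l} S? (c , b , p) (d , b′ , p′) = e , bound , proper
    where
    e : Vx → ℕ
    e v with S? v
    ... | yes _ = c v
    ... | no _ = k + d v
    right : ∀ {v} → ¬ S v → S v ⊎ T v → T v
    right ¬s (inj₁ s) = ⊥-elim (¬s s)
    right ¬s (inj₂ t) = t
    bound : ∀ {v} → S v ⊎ T v → e v < k + l
    bound {v} st with S? v
    ... | yes s = ℕ.<-≤-trans (b s) (m≤m+n k l)
    ... | no ¬s = ℕ.+-monoʳ-< k (b′ (right ¬s st))
    proper : ∀ {u v} → S u ⊎ T u → S v ⊎ T v → adj G u v ≡ true → e u ≢ e v
    proper {u} {v} su sv h eq with S? u | S? v
    ... | yes s | yes s′ = p s s′ h eq
    ... | yes s | no _ = <⇒≱ (b s) (≤-trans (m≤m+n k _) (≤-reflexive (sym eq)))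
    ... | no _ | yes s = <⇒≱ (b s) (≤-trans (m≤m+n k _) (≤-reflexive eq))
    ... | no ¬s | no ¬s′ = p′ (right ¬s su) (right ¬s′ sv) h (ℕ.+-cancelˡ-≡ k _ _ eq)

  -- No edge inside `S` leaves `C`, so both parts may use the same `k` colours. This is why the
  -- number of components does not enter the bound.
  colour-separate : ∀ {S C k} → Decidable C → (∀ {u v} → C u → S v → adj G u v ≡ true → C v) →
                    Colourable (λ v → S v × C v) k → Colourable (λ v → S v × ¬ C v) k → Colourable S k
  colour-separate {S} {C} {k} C? closed (c , b , p) (d , b′ , p′) = e , bound , proper
    where
    e : Vx → ℕ
    e v with C? v
    ... | yes _ = c v
    ... | no _ = d v
    bound : ∀ {v} → S v → e v < k
    bound {v} s with C? v
    ... | yes q = b (s , q)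
    ... | no q = b′ (s , q)
    proper : ∀ {u v} → S u → S v → adj G u v ≡ true → e u ≢ e v
    proper {u} {v} su sv h eq with C? u | C? v
    ... | yes q | yes q′ = p (su , q) (sv , q′) h eq
    ... | yes q | no q′ = q′ (closed q sv h)
    ... | no q | yes q′ = q (closed q′ su (adj-flip G h))
    ... | no q | no q′ = p′ (su , q) (sv , q′) h eq

  -- Each d in `D` costs one colour for itself and `k` for its neighbours.
  colour-dominated : ∀ {C k} D → All C D → (∀ d → d ∈ D → Colourable (λ v → C v × adj G d v ≡ true) k) →
                     Decidable C → Colourable (λ v → C v × (v ∈ D ⊎ Dominated G D v)) (length D * suc k)
  colour-dominated [] _ h C? = (λ _ → 0) , (λ { (_ , inj₁ ()) ; (_ , inj₂ ()) }) , λ { (_ , inj₁ ()) ; (_ , inj₂ ()) }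
  colour-dominated {C} {k} (d ∷ D) (Cd ∷ CD) h C? = colour-⊆ f
    (colour-∪ (λ v → (v ≟ d) ⊎-dec (C? v ×-dec (adj G d v Bool.≟ true)))
      (colour-∪ (_≟ d) ((λ _ → 0) , (λ _ → s≤s z≤n) , λ { refl refl e → ⊥-elim (adj⇒≢ G e refl) }) (h d (here refl)))
      (colour-dominated D CD (λ x x∈ → h x (there x∈)) C?))
    where
    f : ∀ {v} → C v × (v ∈ d ∷ D ⊎ Dominated G (d ∷ D) v) →
        (v ≡ d ⊎ C v × adj G d v ≡ true) ⊎ C v × (v ∈ D ⊎ Dominated G D v)
    f (c , inj₁ (here e)) = inj₁ (inj₁ e)
    f (c , inj₁ (there i)) = inj₂ (c , inj₁ i)
    f (c , inj₂ (here e)) = inj₁ (inj₂ (c , e))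
    f (c , inj₂ (there i)) = inj₂ (c , inj₂ i)

chromaticBound : ℕ → ℕ → ℕ
chromaticBound n zero = 0
chromaticBound n (suc t) = componentBound n n * suc (chromaticBound n t)

-- By induction on the clique number: a component has a small dominating set, and
-- neighbourhoods have smaller clique number.
colour : ∀ G n → ¬ (K n ↪ G) → ¬ (S* n ↪ G) → ¬ (P (suc n) ↪ G) → ∀ t (S : Fin (V G) → Set) → Decidable S →
         CliqueFree G S t → Colourable G S (chromaticBound n t)
colour G n noK noS noP zero S S? cf = ⊥-elim (cf [] [] [] refl)
colour G n noK noS noP (suc t) S S? cf = below (V G) S S? cf (λ {v} _ → Fin.toℕ<n v)
  where
  -- An inner induction that removes components: `N` bounds the vertex numbers in `S`, and splitting
  -- off the ball around the vertex numbered `N - 1` lowers this bound.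
  below : ∀ N (S : Fin (V G) → Set) → Decidable S → CliqueFree G S (suc t) → (∀ {v} → S v → toℕ v < N) →
          Colourable G S (chromaticBound n (suc t))
  below zero S S? cf lt = (λ _ → 0) , (λ s → case lt s of λ ()) , λ s → case lt s of λ ()
  below (suc N) S S? cf lt with Fin.any? (λ v → S? v ×-dec (toℕ v ℕ.≟ N))
  ... | no none = below N S S? cf λ s → ℕ.≤∧≢⇒< (≤-pred (lt s)) λ e → none (_ , s , e)
  ... | yes (r , Sr , r≡N) = colour-separate G (ball? n) (ball-closed n noP) inside outside
    where
    open Component G n noK noS S S? r Sr
    outside : Colourable G (λ v → S v × ¬ Ball n v) (chromaticBound n (suc t))
    outside = below N _ (λ v → S? v ×-dec ¬? (ball? n v)) (cliqueFree-⊆ G proj₁ cf)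
      λ (s , ¬b) → ℕ.≤∧≢⇒< (≤-pred (lt s))
        λ e → ¬b (ball-mono {0} {n} z≤n (Fin.toℕ-injective (trans e (sym r≡N))))
    inside : Colourable G (λ v → S v × Ball n v) (chromaticBound n (suc t))
    inside = let (D , SD , len , dom) = ballDomination n in
      colour-⊆ G (λ (s , b) → s , dom _ b)
        (colour-≤ G (ℕ.*-monoˡ-≤ _ len)
          (colour-dominated G D SD (λ d d∈ → colour G n noK noS noP t _ (λ v → S? v ×-dec (adj G d v Bool.≟ true))
             (cliqueFree-nbr G cf (All.lookup SD d∈))) S?))

-- Induced star covers

module _ (G : Graph) (con : Connected G) where

  private
    r : Fin (V G)
    r = Fin.fromℕ< (proj₁ con)

  module Whole = BFS G (λ _ → ⊤) (λ _ → yes tt) r tt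

  all-levels : ∀ v → ∃ λ i → Whole.Level i v
  all-levels v = go (proj₂ con r v) (0 , refl)
    where
    go : ∀ {u w} → Reach G u w → (∃ λ i → Whole.Level i u) → ∃ λ i → Whole.Level i w
    go here l = l
    go {u} (step {w = w} e p) (i , l) with Whole.ball⇒level (suc i) {w} (inj₂ (tt , u , Whole.level⇒ball i l , T⇒true e))
    ... | j , _ , l′ = go p (j , l′)

  connected-domination : ∀ n → ¬ (K n ↪ G) → ¬ (S* n ↪ G) → ¬ (P (suc n) ↪ G) →
    ∃ λ D → length D ≤ componentBound n n × (∀ v → v ∈ D ⊎ Dominated G D v)
  connected-domination n noK noS noP = let (D , _ , len , dom) = ballDomination n in D , len , λ v → dom v (everything v)
    where
    open Component G n noK noS (λ _ → ⊤) (λ _ → yes tt) r tt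
    everything : ∀ v → Ball n v
    everything v = go (proj₂ con r v) (ball-mono {0} {n} z≤n refl)
      where
      go : ∀ {u w} → Reach G u w → Ball n u → Ball n w
      go here b = b
      go (step e p) b = go p (ball-closed n noP b tt (T⇒true e))

-- The successor in the bound is the one-vertex star at the centre itself, since the colour classes
-- account only for leaves.
insc-bound : ∀ G n → Connected G → ¬ (K n ↪ G) → ¬ (S* n ↪ G) → ¬ (P (suc n) ↪ G) →
             insc≤ G (componentBound n n * suc (chromaticBound n n))
insc-bound G n con noK noS noP =
  let (L , c , b) = cover-≤ (ℕ.*-monoˡ-≤ _ len) (cover-list D λ d _ → starCover d)
  in L , (λ v → c (centreOf v)) , b
  where
  open Pieces 𝒜s G
  cf : CliqueFree G (λ _ → ⊤) n
  cf xs _ ap l = noK (clique⇒K G n xs l ap)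
  colouring = colour G n noK noS noP n (λ _ → ⊤) (λ _ → yes tt) cf
  col = proj₁ colouring
  domination′ = connected-domination G con n noK noS noP
  D = proj₁ domination′
  len = proj₁ (proj₂ domination′)
  star : ∀ d i → Cover (λ v → adj G d v ≡ true × col v ≡ i) 1
  star d i = let (p , f , g) = starPiece G d _ (λ v → (adj G d v Bool.≟ true) ×-dec (col v ℕ.≟ i)) proj₁
                    (λ (_ , e) (_ , e′) → ≢true λ h → proj₂ (proj₂ colouring) tt tt h (trans e (sym e′)))
             in p ∷ [] , (λ x → here (f (inj₂ x))) , s≤s z≤n
  single : ∀ d → Cover (λ v → v ≡ d) 1
  single d = let (p , f , g) = starPiece G d (λ _ → ⊥) (λ _ → no λ ()) (λ ()) (λ ()) in p ∷ [] , (λ x → here (f (inj₁ x))) , s≤s z≤n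
  starCover : ∀ d → Cover (λ v → v ≡ d ⊎ adj G d v ≡ true) (suc (chromaticBound n n))
  starCover d = cover-∪ id (single d)
    (cover-≤ (≤-reflexive (ℕ.*-identityʳ _))
      (cover-⊆ (λ {v} e → col v , proj₁ (proj₂ colouring) tt , e , refl) (cover-⋃ (chromaticBound n n) (star d))))
  centreOf : ∀ v → ∃ λ d → d ∈ D × (v ≡ d ⊎ adj G d v ≡ true)
  centreOf v with proj₂ (proj₂ domination′) v
  ... | inj₁ v∈ = v , v∈ , inj₁ refl
  ... | inj₂ dm = let (d , d∈ , e) = find dm in d , d∈ , inj₂ e

-- Induced star partitions

starPartBound : ℕ → ℕ → ℕ
starPartBound n zero = 0
-- One star at the centre, then at most `domination n` new centres among its neighbours, each left
-- with a set of smaller clique number.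
starPartBound n (suc t) = suc (domination n * starPartBound n t)

module StarPartition (G : Graph) (n : ℕ) (noK : ¬ (K n ↪ G)) (noS~ : ¬ (S~ n ↪ G)) where

  open Pieces 𝒜s G
  open import Data.List.Membership.DecPropositional {A = Fin (V G)} _≟_ using (_∈?_)

  private
    Vx = Fin (V G)

  maximalIndep : ∀ (S : Vx → Set) → Decidable S → ∀ vs → ∃ λ I → All S I × (∀ {u v} → u ∈ I → v ∈ I → adj G u v ≡ false) ×
                 (∀ {v} → v ∈ vs → S v → v ∈ I ⊎ Dominated G I v)
  maximalIndep S S? [] = [] , [] , (λ ()) , λ ()
  maximalIndep S S? (v ∷ vs) with maximalIndep S S? vs
  ... | I , SI , ind , mx with S? v | dominated? G I v
  ...   | no ¬s | _ = I , SI , ind , λ { (here refl) s → ⊥-elim (¬s s) ; (there i) s → mx i s }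
  ...   | yes _ | yes d = I , SI , ind , λ { (here refl) s → inj₂ d ; (there i) s → mx i s }
  ...   | yes s | no ¬d = v ∷ I , s ∷ SI , ind′ , λ where
          (here refl) _ → inj₁ (here refl)
          (there i) s → case mx i s of λ { (inj₁ j) → inj₁ (there j) ; (inj₂ d) → inj₂ (there d) }
    where
    apart : ∀ {u} → u ∈ I → adj G u v ≡ false
    apart u∈ = ≢true λ e → ¬d (lose u∈ e)
    ind′ : ∀ {u w} → u ∈ v ∷ I → w ∈ v ∷ I → adj G u w ≡ false
    ind′ (here refl) (here refl) = adj-irrefl G v
    ind′ (here refl) (there w∈) = adj-flip G (apart w∈)
    ind′ (there u∈) (here refl) = apart u∈
    ind′ (there u∈) (there w∈) = ind u∈ w∈

  -- Every vertex of `B` goes to the first d in `D` that sees it, which keeps the blocks disjoint.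
  -- What remains for a later d depends on the earlier ones, so the hypothesis has to allow an
  -- arbitrary decidable set of neighbours.
  blocks : ∀ {N} D → Unique D → (B : Vx → Set) → Decidable B → (∀ {v} → v ∈ D → ¬ B v) → (∀ {v} → B v → Dominated G D v) →
           (∀ d → d ∈ D → (S : Vx → Set) → Decidable S → (∀ {v} → S v → B v × adj G d v ≡ true) → Part (λ v → v ≡ d ⊎ S v) N) →
           Part (λ v → v ∈ D ⊎ B v) (length D * N)
  blocks [] _ B B? disj dom h = [] , (λ { (inj₂ b) → case dom b of λ () }) , [] , [] , z≤n
  blocks (d ∷ D) (d∉ ∷ uniq) B B? disj dom h = part-∪ f g g′ disj′
    (h d (here refl) (λ v → B v × adj G d v ≡ true) (λ v → B? v ×-dec (adj G d v Bool.≟ true)) id)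
    (blocks D uniq (λ v → B v × adj G d v ≢ true) (λ v → B? v ×-dec ¬? (adj G d v Bool.≟ true)) (λ v∈ (b , _) → disj (there v∈) b)
      (λ (b , ne) → case dom b of λ { (here e) → ⊥-elim (ne e) ; (there x) → x })
      (λ x x∈ S S? sub → h x (there x∈) S S? (λ s → let ((b , _) , e) = sub s in b , e)))
    where
    f : ∀ {v} → v ∈ d ∷ D ⊎ B v → (v ≡ d ⊎ B v × adj G d v ≡ true) ⊎ (v ∈ D ⊎ B v × adj G d v ≢ true)
    f (inj₁ (here e)) = inj₁ (inj₁ e)
    f (inj₁ (there i)) = inj₂ (inj₁ i)
    f {v} (inj₂ b) with adj G d v Bool.≟ true
    ... | yes e = inj₁ (inj₂ (b , e))
    ... | no ne = inj₂ (inj₂ (b , ne))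
    g : ∀ {v} → v ≡ d ⊎ B v × adj G d v ≡ true → v ∈ d ∷ D ⊎ B v
    g (inj₁ e) = inj₁ (here e)
    g (inj₂ (b , _)) = inj₂ b
    g′ : ∀ {v} → v ∈ D ⊎ B v × adj G d v ≢ true → v ∈ d ∷ D ⊎ B v
    g′ (inj₁ i) = inj₁ (there i)
    g′ (inj₂ (b , _)) = inj₂ b
    disj′ : ∀ {v} → v ≡ d ⊎ B v × adj G d v ≡ true → v ∈ D ⊎ B v × adj G d v ≢ true → ⊥
    disj′ (inj₁ refl) (inj₁ i) = All.lookup d∉ i refl
    disj′ (inj₁ refl) (inj₂ (b , _)) = disj (here refl) b
    disj′ (inj₂ (b , _)) (inj₁ i) = disj (there i) b
    disj′ (inj₂ (_ , e)) (inj₂ (_ , ne)) = ne e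

  -- Take a maximal independent set I of S, let D ⊆ I be small and dominate S ∖ I.  Then d with
  -- I ∖ D is a star, and the rest is dealt with by the stars around D, where the clique number
  -- has dropped.
  starPart : ∀ t d (S : Vx → Set) → Decidable S → (∀ {v} → S v → adj G d v ≡ true) → CliqueFree G S t →
             Part (λ v → v ≡ d ⊎ S v) (starPartBound n t)
  starPart zero d S S? nb cf = ⊥-elim (cf [] [] [] refl)
  starPart (suc t) d S S? nb cf with maximalIndep S S? (allFin (V G))
  ... | I , SI , ind , mx with dominate G true n noK noS~ d I (All.map nb SI) (λ v → S v × v ∉ I) (λ v → S? v ×-dec ¬? (v ∈? I))
                                 (λ b (s , _) → nb s , adj⇒≢ G (nb s))
  ...   | D₀ , D₀⊆ , len , dom = part-∪ f g g′ disj
      (let (p , a , b) = starPiece G d (λ v → v ∈ I × v ∉ D) (λ v → (v ∈? I) ×-dec ¬? (v ∈? D)) (λ (i , _) → nb (All.lookup SI i))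
                           (λ (i , _) (j , _) → ind i j)
       in part-piece p a b)
      (part-≤ (ℕ.*-monoˡ-≤ (starPartBound n t) (≤-trans (List.length-deduplicate _≟_ D₀) len))
        (blocks D (deduplicate-! _≟_ D₀) (λ v → S v × v ∉ I) (λ v → S? v ×-dec ¬? (v ∈? I))
          (λ v∈ (_ , v∉) → v∉ (D⊆ v∈)) dominated
          (λ x x∈ T T? sub → starPart t x T T? (λ s → proj₂ (sub s))
            (cliqueFree-⊆ G (λ s → proj₁ (proj₁ (sub s)) , proj₂ (sub s)) (cliqueFree-nbr G cf (All.lookup SI (D⊆ x∈)))))))
    where
    D : List Vx
    D = deduplicate _≟_ D₀
    D⊆ : ∀ {v} → v ∈ D → v ∈ I
    D⊆ v∈ = D₀⊆ (∈-deduplicate⁻ _≟_ D₀ v∈)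
    dominated : ∀ {v} → S v × v ∉ I → Dominated G D v
    dominated {v} (s , v∉) = case mx (∈-allFin v) s of λ where
      (inj₁ i) → ⊥-elim (v∉ i)
      (inj₂ dm) → let (x , x∈ , e) = find (dom v (s , v∉) dm) in lose (∈-deduplicate⁺ _≟_ x∈) e
    d∉I : d ∉ I
    d∉I i = adj⇒≢ G (nb (All.lookup SI i)) refl
    f : ∀ {v} → v ≡ d ⊎ S v → (v ≡ d ⊎ v ∈ I × v ∉ D) ⊎ (v ∈ D ⊎ S v × v ∉ I)
    f (inj₁ e) = inj₁ (inj₁ e)
    f {v} (inj₂ s) with v ∈? I | v ∈? D
    ... | no v∉ | _ = inj₂ (inj₂ (s , v∉))
    ... | yes i | no ¬d = inj₁ (inj₂ (i , ¬d))
    ... | yes i | yes d = inj₂ (inj₁ d)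
    g : ∀ {v} → v ≡ d ⊎ v ∈ I × v ∉ D → v ≡ d ⊎ S v
    g (inj₁ e) = inj₁ e
    g (inj₂ (i , _)) = inj₂ (All.lookup SI i)
    g′ : ∀ {v} → v ∈ D ⊎ S v × v ∉ I → v ≡ d ⊎ S v
    g′ (inj₁ x) = inj₂ (All.lookup SI (D⊆ x))
    g′ (inj₂ (s , _)) = inj₂ s
    disj : ∀ {v} → v ≡ d ⊎ v ∈ I × v ∉ D → v ∈ D ⊎ S v × v ∉ I → ⊥
    disj (inj₁ refl) (inj₁ x) = d∉I (D⊆ x)
    disj (inj₁ refl) (inj₂ (s , _)) = adj⇒≢ G (nb s) refl
    disj (inj₂ (_ , ¬d)) (inj₁ x) = ¬d x
    disj (inj₂ (i , _)) (inj₂ (_ , ¬i)) = ¬i i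

insp-bound : ∀ G n → Connected G → ¬ (K n ↪ G) → ¬ (S* n ↪ G) → ¬ (S~ n ↪ G) → ¬ (P (suc n) ↪ G) →
             insp≤ G (componentBound n n * starPartBound n n)
insp-bound G n con noK noS noS~ noP with connected-domination G con n noK noS noP
... | D₀ , len , dom =
  let (L , c , _ , p , b) = part-≤ (ℕ.*-monoˡ-≤ (starPartBound n n) (≤-trans (List.length-deduplicate _≟_ D₀) len))
        (blocks D (deduplicate-! _≟_ D₀) (_∉ D) (λ v → ¬? (v ∈? D)) (λ i ¬i → ¬i i) dominated
          (λ d d∈ S S? sub → starPart n d S S? (λ s → proj₂ (sub s)) (λ xs _ ap l → noK (clique⇒K G n xs l ap))))
  in L , ((λ v → c (case v ∈? D of λ { (yes i) → inj₁ i ; (no ¬i) → inj₂ ¬i })) , p) , b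
  where
  open Pieces 𝒜s G
  open StarPartition G n noK noS~
  open import Data.List.Membership.DecPropositional {A = Fin (V G)} _≟_ using (_∈?_)
  D = deduplicate _≟_ D₀
  dominated : ∀ {v} → v ∉ D → Dominated G D v
  dominated {v} v∉ = case dom v of λ where
    (inj₁ i) → ⊥-elim (v∉ (∈-deduplicate⁺ _≟_ i))
    (inj₂ dm) → let (x , x∈ , e) = find dm in lose (∈-deduplicate⁺ _≟_ x∈) e

-- Vertices beside a descending path

stepᵇ-+ : ∀ o x y → stepᵇ (x + o) (y + o) ≡ stepᵇ x y
stepᵇ-+ o x y = cong₂ _∨_ (≡ᵇ-cong (ℕ.+-cancelʳ-≡ o y (suc x)) (cong (_+ o))) (≡ᵇ-cong (ℕ.+-cancelʳ-≡ o x (suc y)) (cong (_+ o)))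

attach-+ : ∀ k o p x → attach k (p + o) (x + o) ≡ attach k p x
attach-+ pendant o p x = ≡ᵇ-cong (ℕ.+-cancelʳ-≡ o x p) (cong (_+ o))
attach-+ triangle o p x = cong₂ _∨_ (attach-+ pendant o p x) (≡ᵇ-cong (ℕ.+-cancelʳ-≡ o x (suc p)) (cong (_+ o)))
attach-+ twin₀ o p x = stepᵇ-+ o p x
attach-+ twin₁ o p x = cong₂ _∨_ (attach-+ pendant o p x) (stepᵇ-+ o p x)

module Rays (G : Graph) (con : Connected G) (n : ℕ) (1≤n : 1 ≤ n) where

  open Whole G con

  private
    Vx = Fin (V G)

  -- The spine is laid along the chain with offset `p ∸ n`, so that the attachment at `n` falls on
  -- `p`; `n ≤ p` and `p + n ≤ M` provide the two arms.
  embed : ∀ k {M c v} p → Chain M c → n ≤ p → p + n ≤ M → (∀ i → i ≤ M → v ≢ c i) →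
          (∀ i → i ≤ M → adj G v (c i) ≡ attach k p i) → F k n ↪ G
  embed k {M} {c} {v} p ch n≤p p≤M new att = f , f-inj , f-adj
    where
    open Labelling (labelling k {n} 1≤n)
    o : ℕ
    o = p ∸ n
    n+o : n + o ≡ p
    n+o = ℕ.m+[n∸m]≡n n≤p
    place : Label → Vx
    place extra = v
    place (spine x) = c (x + o)
    Ok : Label → Set
    Ok l = ∀ {x} → l ≡ spine x → x + o ≤ M
    ok : ∀ u → Ok (label u)
    ok u {x} e = ≤-trans (ℕ.+-monoˡ-≤ o (label-bound u e))
      (≤-trans (≤-reflexive (trans (ℕ.+-assoc n n o) (trans (cong (n +_) n+o) (ℕ.+-comm n p)))) p≤M)
    place-inj : ∀ l m → Ok l → Ok m → place l ≡ place m → l ≡ m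
    place-inj extra extra _ _ _ = refl
    place-inj extra (spine x) _ b e = ⊥-elim (new _ (b refl) e)
    place-inj (spine x) extra a _ e = ⊥-elim (new _ (a refl) (sym e))
    place-inj (spine x) (spine y) a b e = cong spine (ℕ.+-cancelʳ-≡ o x y (chain-injective ch (a refl) (b refl) e))
    att′ : ∀ x → x + o ≤ M → attach k n x ≡ adj G v (c (x + o))
    att′ x h = trans (sym (attach-+ k o n x)) (trans (cong (λ q → attach k q (x + o)) n+o) (sym (att (x + o) h)))
    place-adj : ∀ l m → Ok l → Ok m → labelAdj k n l m ≡ adj G (place l) (place m)
    place-adj extra extra _ _ = sym (adj-irrefl G v)
    place-adj extra (spine x) _ b = att′ x (b refl)
    place-adj (spine x) extra a _ = trans (att′ x (a refl)) (adj-sym G v (c (x + o)))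
    place-adj (spine x) (spine y) a b = sym (trans (chain-adj ch (a refl) (b refl)) (stepᵇ-+ o x y))
    f : Fin (V (F k n)) → Vx
    f = place ∘ label
    f-inj : Injective _≡_ _≡_ f
    f-inj {u} {w} e = label-injective (place-inj (label u) (label w) (ok u) (ok w) e)
    f-adj : ∀ u w → adj (F k n) u w ≡ adj G (f u) (f w)
    f-adj u w = trans (label-adj u w) (place-adj (label u) (label w) (ok u) (ok w))

  -- v sees at most the positions j, j + 1, j + 2 of the chain: seeing exactly one of j and j + 2
  -- yields F⁽¹⁾ or F⁽²⁾, seeing both of them yields F⁽⁴⁾ or F⁽⁵⁾.
  module Beside {M c v j} (ch : Chain M c) (n≤j : n ≤ j) (j≤M : 2 + j + n ≤ M) (lv : Level (suc j) v) (v≢ : v ≢ c (suc j)) where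

    private
      a d b : Bool
      a = adj G v (c j)
      d = adj G v (c (1 + j))
      b = adj G v (c (2 + j))

      new : ∀ i → i ≤ M → v ≢ c i
      new i i≤ refl = v≢ (cong c (level-unique (proj₁ ch i≤) lv))

      see : ∀ i → i ≤ M → adj G v (c i) ≡ true → i ≡ j ⊎ i ≡ 1 + j ⊎ i ≡ 2 + j
      see i i≤ e with ℕ.<-cmp i (1 + j)
      ... | tri≈ _ q _ = inj₂ (inj₁ q)
      ... | tri< lt _ _ = inj₁ (ℕ.≤-antisym (≤-pred lt) (≤-pred (level-adj (proj₁ ch i≤) lv (adj-flip G e))))
      ... | tri> _ _ gt = inj₂ (inj₂ (ℕ.≤-antisym (level-adj lv (proj₁ ch i≤) e) gt))

      configuration : ∀ k p → n ≤ p → p ≤ 2 + j → attach k p j ≡ a → attach k p (1 + j) ≡ d → attach k p (2 + j) ≡ b →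
                      (∀ i → attach k p i ≡ true → i ≡ j ⊎ i ≡ 1 + j ⊎ i ≡ 2 + j) → F k n ↪ G
      configuration k p n≤p p≤ ha hd hb only = embed k p ch n≤p (≤-trans (ℕ.+-monoˡ-≤ n p≤) j≤M) new λ i i≤ →
        ≡-bool (λ h → to i h (see i i≤ h)) (λ h → from i h (only i h))
        where
        to : ∀ i → adj G v (c i) ≡ true → i ≡ j ⊎ i ≡ 1 + j ⊎ i ≡ 2 + j → attach k p i ≡ true
        to i h (inj₁ refl) = trans ha h
        to i h (inj₂ (inj₁ refl)) = trans hd h
        to i h (inj₂ (inj₂ refl)) = trans hb h
        from : ∀ i → attach k p i ≡ true → i ≡ j ⊎ i ≡ 1 + j ⊎ i ≡ 2 + j → adj G v (c i) ≡ true
        from i h (inj₁ refl) = trans (sym ha) h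
        from i h (inj₂ (inj₁ refl)) = trans (sym hd) h
        from i h (inj₂ (inj₂ refl)) = trans (sym hb) h

      ≡ᵇ-refl : ∀ x → (x ≡ᵇ x) ≡ true
      ≡ᵇ-refl x = ≡ᵇ-true {x} refl

      1+≢ : ∀ x → (suc x ≡ᵇ x) ≡ false
      1+≢ x = ≡ᵇ-false {suc x} {x} ℕ.1+n≢n

      ≢1+ : ∀ x → (x ≡ᵇ suc x) ≡ false
      ≢1+ x = ≡ᵇ-false {x} {suc x} (ℕ.1+n≢n ∘ sym)

      2+≢ : ∀ x → (2 + x ≡ᵇ x) ≡ false
      2+≢ x = ≡ᵇ-false {2 + x} {x} λ e → <⇒≢ (m≤n+m (suc x) 1) (sym e)

      ≢2+ : ∀ x → (x ≡ᵇ 2 + x) ≡ false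
      ≢2+ x = ≡ᵇ-false {x} {2 + x} λ e → <⇒≢ (m≤n+m (suc x) 1) e

    module _ (noF1 : ¬ (F1 n ↪ G)) (noF2 : ¬ (F2 n ↪ G)) where

      both-or-neither : adj G v (c j) ≡ adj G v (c (2 + j))
      both-or-neither = go a d b refl refl refl
        where
        go : ∀ x y z → x ≡ a → y ≡ d → z ≡ b → x ≡ z
        go true _ true _ _ _ = refl
        go false _ false _ _ _ = refl
        go true false false ha hd hb = ⊥-elim (noF1 (configuration pendant j n≤j (m≤n+m j 2)
          (trans (≡ᵇ-refl j) ha) (trans (1+≢ j) hd) (trans (2+≢ j) hb) λ i h → inj₁ (≡ᵇ-true⁻ h)))
        go true true false ha hd hb = ⊥-elim (noF2 (configuration triangle j n≤j (m≤n+m j 2)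
          (trans (∨-true⁺ˡ (≡ᵇ-refl j)) ha) (trans (∨-true⁺ʳ {suc j ≡ᵇ j} (≡ᵇ-refl j)) hd)
          (trans (cong₂ _∨_ (2+≢ j) (1+≢ j)) hb)
          λ i h → case ∨-true⁻ {i ≡ᵇ j} h of λ { (inj₁ e) → inj₁ (≡ᵇ-true⁻ e) ; (inj₂ e) → inj₂ (inj₁ (≡ᵇ-true⁻ e)) }))
        -- The centre of F⁽¹⁾ is now at `2 + j`, which is why the chain has to extend to
        -- `2 + j + n`.
        go false false true ha hd hb = ⊥-elim (noF1 (configuration pendant (2 + j) (≤-trans n≤j (m≤n+m j 2)) ≤-refl
          (trans (≢2+ j) ha) (trans (≢1+ j) hd) (trans (≡ᵇ-refl j) hb) λ i h → inj₂ (inj₂ (≡ᵇ-true⁻ h))))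
        go false true true ha hd hb = ⊥-elim (noF2 (configuration triangle (1 + j) (≤-trans n≤j (m≤n+m j 1)) (n≤1+n _)
          (trans (cong₂ _∨_ (≢1+ j) (≢2+ j)) ha) (trans (∨-true⁺ˡ (≡ᵇ-refl j)) hd)
          (trans (∨-true⁺ʳ {suc j ≡ᵇ j} (≡ᵇ-refl j)) hb)
          λ i h → case ∨-true⁻ {i ≡ᵇ 1 + j} h of λ { (inj₁ e) → inj₂ (inj₁ (≡ᵇ-true⁻ e)) ; (inj₂ e) → inj₂ (inj₂ (≡ᵇ-true⁻ e)) }))

      module _ (noF4 : ¬ (F4 n ↪ G)) (noF5 : ¬ (F5 n ↪ G)) where

        neither : adj G v (c j) ≡ false
        neither = ≢true λ h → go d h (trans (sym both-or-neither) h) refl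
          where
          stepOnly : ∀ i → stepᵇ (1 + j) i ≡ true → i ≡ j ⊎ i ≡ 1 + j ⊎ i ≡ 2 + j
          stepOnly i h = case stepᵇ-true⁻ {1 + j} {i} h of λ { (inj₁ e) → inj₂ (inj₂ e) ; (inj₂ e) → inj₁ (sym (ℕ.suc-injective e)) }
          n≤1+j : n ≤ 1 + j
          n≤1+j = ≤-trans n≤j (n≤1+n j)
          go : ∀ y → a ≡ true → b ≡ true → y ≡ d → ⊥
          go false ha hb hd = noF4 (configuration twin₀ (1 + j) n≤1+j (n≤1+n _)
            (trans (stepᵇ-down {1 + j} {j} refl) (sym ha)) (trans (stepᵇ-irrefl (1 + j)) hd) (trans (stepᵇ-up {1 + j} refl) (sym hb)) stepOnly)
          go true ha hb hd = noF5 (configuration twin₁ (1 + j) n≤1+j (n≤1+n _)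
            (trans (∨-true⁺ʳ {j ≡ᵇ 1 + j} (stepᵇ-down {1 + j} {j} refl)) (sym ha)) (trans (∨-true⁺ˡ (≡ᵇ-refl (1 + j))) hd)
            (trans (∨-true⁺ʳ {2 + j ≡ᵇ 1 + j} (stepᵇ-up {1 + j} refl)) (sym hb))
            λ i h → case ∨-true⁻ {i ≡ᵇ 1 + j} h of λ { (inj₁ e) → inj₂ (inj₁ (≡ᵇ-true⁻ e)) ; (inj₂ e) → stepOnly i e })

  lev : Vx → ℕ
  lev v = proj₁ (all-levels G con v)

  lev-level : ∀ v → Level (lev v) v
  lev-level v = proj₂ (all-levels G con v)

  level⇒lev : ∀ {i v} → Level i v → lev v ≡ i
  level⇒lev l = level-unique (lev-level _) l

  nbrs kids : Vx → List Vx
  nbrs v = filter (λ w → adj G v w Bool.≟ true) (allFin (V G))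
  kids v = filter (λ w → lev w ℕ.≟ suc (lev v)) (nbrs v)

  kids⁺ : ∀ {v w} → lev w ≡ suc (lev v) → adj G v w ≡ true → w ∈ kids v
  kids⁺ {v} {w} l e = ∈-filter⁺ (λ w → lev w ℕ.≟ suc (lev v)) (∈-filter⁺ (λ w → adj G v w Bool.≟ true) (∈-allFin w) e) l

  kids⁻ : ∀ {v w} → w ∈ kids v → lev w ≡ suc (lev v) × adj G v w ≡ true
  kids⁻ {v} {w} w∈ = let (w∈′ , l) = ∈-filter⁻ (λ w → lev w ℕ.≟ suc (lev v)) {xs = nbrs v} w∈ in
    l , proj₂ (∈-filter⁻ (λ w → adj G v w Bool.≟ true) {xs = allFin (V G)} w∈′)

  -- The list enumerates descending walks, so entries may repeat; the bound by powers of the degree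
  -- is then immediate.
  down : Vx → ℕ → List Vx
  down u zero = u ∷ []
  down u (suc k) = concatMap kids (down u k)

  down⁺ : ∀ {u k v w} → v ∈ down u k → w ∈ kids v → w ∈ down u (suc k)
  down⁺ v∈ w∈ = Any.concatMap⁺ kids (Any.map (λ { refl → w∈ }) v∈)

  down⁻ : ∀ {u} k {w} → w ∈ down u (suc k) → ∃ λ v → v ∈ down u k × w ∈ kids v
  down⁻ {u} k w∈ = find (Any.concatMap⁻ kids {xs = down u k} w∈)

  down-cons : ∀ {x w} k {v} → w ∈ kids x → v ∈ down w k → v ∈ down x (suc k)
  down-cons {x} zero w∈ (here refl) = down⁺ {x} {0} (here refl) w∈
  down-cons {x} (suc k) w∈ v∈ = let (y , y∈ , v∈′) = down⁻ k v∈ in down⁺ {x} {suc k} (down-cons k w∈ y∈) v∈′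

  down-split : ∀ {u} b a {v} → v ∈ down u (b + a) → ∃ λ w → w ∈ down u a × v ∈ down w b
  down-split zero a v∈ = _ , v∈ , here refl
  down-split (suc b) a v∈ = let (y , y∈ , v∈′) = down⁻ (b + a) v∈
                                (w , w∈ , y∈′) = down-split b a y∈
                            in w , w∈ , down⁺ {w} {b} y∈′ v∈′

  down-lev : ∀ {u} k {v} → v ∈ down u k → lev v ≡ k + lev u
  down-lev zero (here refl) = refl
  down-lev (suc k) v∈ = let (y , y∈ , v∈′) = down⁻ k v∈ in trans (proj₁ (kids⁻ v∈′)) (cong suc (down-lev k y∈))

  root : Vx
  root = Fin.fromℕ< (proj₁ con)

  down-root : ∀ i {v} → Level i v → v ∈ down root i
  down-root zero refl = here refl
  down-root (suc i) l = let (u , lu , e) = level-parent i l in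
    down⁺ {root} {i} (down-root i lu) (kids⁺ (trans (level⇒lev l) (cong suc (sym (level⇒lev lu)))) e)

  downs : Vx → ℕ → List Vx
  downs u m = concatMap (down u) (upTo m)

  downs⁺ : ∀ {u m k v} → k < m → v ∈ down u k → v ∈ downs u m
  downs⁺ {u} {m} {k} lt v∈ = Any.concatMap⁺ (down u) (Any.map (λ { refl → v∈ }) (∈-upTo⁺ lt))

  length-concatMap : ∀ {X Y : Set} (f : X → List Y) b xs → (∀ x → x ∈ xs → length (f x) ≤ b) → length (concatMap f xs) ≤ length xs * b
  length-concatMap f b [] h = z≤n
  length-concatMap f b (x ∷ xs) h = ≤-trans (≤-reflexive (List.length-++ (f x)))
    (ℕ.+-mono-≤ (h x (here refl)) (length-concatMap f b xs λ y y∈ → h y (there y∈)))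

  chain-down : ∀ {u i} k {w} → Level i u → w ∈ down u k → ∃ λ c → Chain (k + i) c × c i ≡ u × c (k + i) ≡ w
  chain-down zero lu (here refl) = let (c , ch , e) = chain-to _ lu in c , ch , e , e
  chain-down {u} {i} (suc k) {w} lu w∈ =
    let (y , y∈ , w∈′) = down⁻ k w∈
        (c , ch , e , e′) = chain-down k lu y∈
        lw = subst (λ x → Level x w) (trans (proj₁ (kids⁻ w∈′)) (cong suc (trans (down-lev k y∈) (cong (k +_) (level⇒lev lu))))) (lev-level w)
    in extend c (k + i) w , chain-extend ch lw (trans (cong (λ x → adj G x w) e′) (proj₂ (kids⁻ w∈′))) ,
       trans (extend-old c (k + i) w (m≤n+m i k)) e , extend-new c (k + i) w

  chain-short : ∀ {m c} → Chain m c → m < V G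
  chain-short {m} {c} ch = Fin.injective⇒≤ {f = λ (i : Fin (suc m)) → c (toℕ i)} λ {i} {j} e →
    Fin.toℕ-injective (chain-injective ch (≤-pred (Fin.toℕ<n i)) (≤-pred (Fin.toℕ<n j)) e)

  -- Chains have distinct vertices, so the descent stops within `V G` steps, which supplies the
  -- fuel. Beyond the first empty generation all are empty, as a vertex there would have an ancestor
  -- in it.
  deepest : ∀ {u i} → Level i u → ∃ λ k → (∃ λ w → w ∈ down u k) × (∀ k′ {v} → v ∈ down u k′ → k′ ≤ k)
  deepest {u} {i} lu = go (V G) 0 (ℕ.+-identityʳ _) (u , here refl)
    where
    go : ∀ fuel k → fuel + k ≡ V G → (∃ λ w → w ∈ down u k) → ∃ λ k → (∃ λ w → w ∈ down u k) × (∀ k′ {v} → v ∈ down u k′ → k′ ≤ k)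
    go zero k refl (w , w∈) = ⊥-elim (<⇒≱ (chain-short (proj₁ (proj₂ (chain-down k lu w∈)))) (m≤m+n k i))
    go (suc fuel) k e (w , w∈) with down u (suc k) in eq
    ... | x ∷ xs = go fuel (suc k) (trans (ℕ.+-suc fuel k) e) (x , subst (x ∈_) (sym eq) (here refl))
    ... | [] = k , (w , w∈) , bound
      where
      bound : ∀ k′ {v} → v ∈ down u k′ → k′ ≤ k
      bound k′ {v} v∈ with k′ ℕ.≤? k
      ... | yes p = p
      ... | no q = let (y , y∈ , _) = down-split (k′ ∸ suc k) (suc k) (subst (λ x → v ∈ down u x) (sym (ℕ.m∸n+n≡m (≰⇒> q))) v∈)
                   in case subst (y ∈_) eq y∈ of λ ()

  chainPiece : ∀ {M c} N q → Chain M c → q + N ≤ M → Σ (Piece 𝒜p G) λ p →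
               (∀ i → i ≤ q → InPiece {𝒜p} {G} (c (i + N)) p) × (∀ {v} → InPiece {𝒜p} {G} v p → ∃ λ i → i ≤ q × v ≡ c (i + N))
  chainPiece {M} {c} N q ch q≤ =
    (q , path⇒P G (suc q) (λ i → c (i + N))
      (λ { {i} {j} (s≤s a) (s≤s b) e → ℕ.+-cancelʳ-≡ N i j (chain-injective ch (le a) (le b) e) })
      (λ { {i} {j} (s≤s a) (s≤s b) → trans (chain-adj ch (le a) (le b)) (stepᵇ-+ N i j) })) ,
    (λ i i≤ → Fin.fromℕ< (s≤s i≤) , cong (λ x → c (x + N)) (Fin.toℕ-fromℕ< (s≤s i≤))) ,
    (λ { (a , refl) → toℕ a , ≤-pred (Fin.toℕ<n a) , refl })
    where
    le : ∀ {i} → i ≤ q → i + N ≤ M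
    le i≤ = ≤-trans (ℕ.+-monoˡ-≤ N i≤) q≤

  vertexPiece : ∀ v → Σ (Piece 𝒜p G) λ p → InPiece {𝒜p} {G} v p × (∀ {w} → InPiece {𝒜p} {G} w p → w ≡ v)
  vertexPiece v = (0 , path⇒P G 1 (λ _ → v) (λ { (s≤s z≤n) (s≤s z≤n) _ → refl }) (λ { (s≤s z≤n) (s≤s z≤n) → adj-irrefl G v })) ,
    (zero , refl) , λ { (zero , e) → sym e }

-- Path covers in graphs of bounded degree

degreeBound : ℕ → ℕ
-- The successor keeps the base of the powers nonzero, hence the powers monotone in the exponent.
degreeBound n = suc (ramseyNumber n n)

-- A common bound for three kinds of exceptional lists: the n + 1 top levels, the n + 2 generations
-- below a short head, and the n + 3 generations from the vertex of a long ray at which control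
-- ends.
leftoverBound : ℕ → ℕ
leftoverBound n = (4 + n) * degreeBound n ^ (4 + n)

module BoundedDegree (G : Graph) (con : Connected G) (n : ℕ) (1≤n : 1 ≤ n)
                     (noK : ¬ (K n ↪ G)) (noStar : ¬ (Star n ↪ G)) where

  open Whole G con
  open Rays G con n 1≤n public

  private
    Vx = Fin (V G)
    Δ = degreeBound n

  nbrs-bound : ∀ v → length (nbrs v) < Δ
  nbrs-bound v with ramseyNumber n n ℕ.≤? length (nbrs v)
  ... | no small = <⇒≤ (s≤s (≰⇒> small))
  ... | yes large with ramsey (adj G) n n (nbrs v) large
  ...   | xs , _ , inj₁ (l , cl) = ⊥-elim (noK (clique⇒K G n xs l cl))
  ...   | xs , xs⊆ , inj₂ (l , ind) = ⊥-elim (noStar (star⇒Star G n v xs l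
            (All-resp-⊆ xs⊆ (All.all-filter (λ w → adj G v w Bool.≟ true) (allFin (V G))))
            (AllPairs.zip (AllPairs-resp-⊆ xs⊆ (Unique.filter⁺ (λ w → adj G v w Bool.≟ true) (Unique.allFin⁺ (V G))) , ind))))

  kids-bound : ∀ v → length (kids v) ≤ Δ
  kids-bound v = ≤-trans (List.length-filter (λ w → lev w ℕ.≟ suc (lev v)) (nbrs v)) (<⇒≤ (nbrs-bound v))

  down-bound : ∀ u k → length (down u k) ≤ Δ ^ k
  down-bound u zero = ≤-refl
  down-bound u (suc k) = ≤-trans (length-concatMap kids Δ (down u k) (λ x _ → kids-bound x))
    (≤-trans (ℕ.*-monoˡ-≤ Δ (down-bound u k)) (≤-reflexive (ℕ.*-comm (Δ ^ k) Δ)))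

  downs-bound : ∀ u {m l} → m ≤ l → length (downs u m) ≤ l * Δ ^ l
  downs-bound u {m} {l} m≤l = ≤-trans (length-concatMap (down u) (Δ ^ l) (upTo m)
      (λ k k∈ → ≤-trans (down-bound u k) (ℕ.^-monoʳ-≤ Δ (≤-trans (<⇒≤ (∈-upTo⁻ k∈)) m≤l))))
    (ℕ.*-monoˡ-≤ (Δ ^ l) (≤-trans (≤-reflexive (List.length-upTo m)) m≤l))

  -- The first level on which `Beside` applies, as it concerns a vertex of level j + 1 with n ≤ j.
  N : ℕ
  N = suc n

  -- The chain runs from the root through `u` to a deepest descendant of `u`. Of its length below
  -- `u`, n + 2 levels are set aside, so that `range` is the hypothesis of `Beside` at `j = i + N`
  -- for all `i ≤ ℓ`.
  record LongRay (u : Vx) : Set where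
    field
      ℓ : ℕ
      c : ℕ → Vx
      chain : Chain (ℓ + (2 + n) + N) c
      starts : c N ≡ u
      depth : ∀ k {v} → v ∈ down u k → k ≤ ℓ + (2 + n)

    range : ∀ {i} → i ≤ ℓ → 2 + (i + N) + n ≤ ℓ + (2 + n) + N
    range {i} i≤ = ≤-trans (≤-reflexive (lemma i n)) (ℕ.+-monoˡ-≤ N (ℕ.+-monoˡ-≤ (2 + n) i≤))
      where
      lemma : ∀ i n → 2 + (i + suc n) + n ≡ i + (2 + n) + suc n
      lemma = solve-∀

    suc-range : ∀ {i} → i ≤ suc ℓ → i + N ≤ ℓ + (2 + n) + N
    suc-range i≤ = ℕ.+-monoˡ-≤ N (≤-trans i≤ (≤-trans (s≤s (m≤m+n ℓ (1 + n))) (≤-reflexive (sym (ℕ.+-suc ℓ (1 + n))))))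

    on-level : ∀ {i} → i ≤ suc ℓ → Level (i + N) (c (i + N))
    on-level i≤ = proj₁ chain (suc-range i≤)

  ray : ∀ u → lev u ≡ N → (∀ k {v} → v ∈ down u k → k < 2 + n) ⊎ LongRay u
  ray u lu with deepest (subst (λ x → Level x u) lu (lev-level u))
  ... | k , (w , w∈) , depth with 2 + n ℕ.≤? k
  ...   | no short = inj₁ λ k v∈ → ℕ.≤-<-trans (depth k v∈) (≰⇒> short)
  ...   | yes long with k ∸ (2 + n) | ℕ.m∸n+n≡m long
  ...     | ℓ | refl = let (c , ch , e , _) = chain-down k (subst (λ x → Level x u) lu (lev-level u)) w∈ in
              inj₂ record { ℓ = ℓ ; c = c ; chain = ch ; starts = e ; depth = depth }

  -- On a long ray these are the descendants of `c (ℓ + N)`. Since `depth` bounds all descendants of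
  -- `u`, they reach at most n + 2 levels further down, which makes n + 3 generations.
  leftover : ∀ {u} → (∀ k {v} → v ∈ down u k → k < 2 + n) ⊎ LongRay u → List Vx
  leftover {u} (inj₁ _) = downs u (2 + n)
  leftover (inj₂ ρ) = downs (c (ℓ + N)) (3 + n)
    where open LongRay ρ

  leftover-bound : ∀ {u} (ρ : _ ⊎ LongRay u) → length (leftover ρ) ≤ leftoverBound n
  leftover-bound {u} (inj₁ _) = downs-bound u (m≤n+m (2 + n) 2)
  leftover-bound (inj₂ ρ) = downs-bound (c (ℓ + N)) (m≤n+m (3 + n) 1)
    where open LongRay ρ

  top : List Vx
  top = downs root N

  heads : List Vx
  heads = down root N

  covered-by : ∀ v → v ∈ top ⊎ (∃ λ u → u ∈ heads × lev u ≡ N × ∃ λ k → v ∈ down u k)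
  covered-by v with lev v ℕ.<? N
  ... | yes p = inj₁ (downs⁺ p (down-root (lev v) (lev-level v)))
  ... | no q = let (u , u∈ , v∈) = down-split (lev v ∸ N) N (subst (λ x → v ∈ down root x) (sym (ℕ.m∸n+n≡m (≮⇒≥ q))) (down-root (lev v) (lev-level v)))
               in inj₂ (u , u∈ , trans (down-lev N u∈) (trans (cong (N +_) (level⇒lev {0} refl)) (ℕ.+-identityʳ N)) , lev v ∸ N , v∈)

  tail∈leftover : ∀ {u} (ρ : LongRay u) {w v} k → w ∈ kids (LongRay.c ρ (LongRay.ℓ ρ + N)) → v ∈ down w k →
                  k + suc (LongRay.ℓ ρ) ≤ LongRay.ℓ ρ + (2 + n) → v ∈ leftover (inj₂ ρ)
  tail∈leftover ρ k w∈ v∈ le = downs⁺ (s≤s (s≤s (≤-pred (ℕ.+-cancelʳ-≤ ℓ (suc k) (2 + n)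
      (≤-trans (≤-reflexive (sym (ℕ.+-suc k ℓ))) (≤-trans le (≤-reflexive (ℕ.+-comm ℓ (2 + n)))))))))
    (down-cons k w∈ v∈)
    where open LongRay ρ

  module _ (noF1 : ¬ (F1 n ↪ G)) (noF2 : ¬ (F2 n ↪ G)) where

    module Blowup {M c} (ch : Chain M c) where

      -- Exactly the vertices that can replace `c j` in the chain, by `replace-chain`; the
      -- existential only names the predecessor of `j`.
      Twin : ℕ → Vx → Set
      Twin j v = v ≡ c j ⊎ Level j v × (∃ λ i → j ≡ suc i × adj G (c i) v ≡ true) × adj G v (c (suc j)) ≡ true

      replace : ℕ → Vx → ℕ → Vx
      replace j v i with i ℕ.≟ j
      ... | yes _ = v
      ... | no _ = c i

      replace-at : ∀ j v → replace j v j ≡ v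
      replace-at j v with j ℕ.≟ j
      ... | yes _ = refl
      ... | no q = ⊥-elim (q refl)

      replace-off : ∀ {j v i} → i ≢ j → replace j v i ≡ c i
      replace-off {j} {v} {i} ne with i ℕ.≟ j
      ... | yes e = ⊥-elim (ne e)
      ... | no _ = refl

      replace-chain : ∀ {j v} → Level j v → (∃ λ i → j ≡ suc i × adj G (c i) v ≡ true) → adj G v (c (suc j)) ≡ true →
                      Chain M (replace j v)
      replace-chain {j} {v} lv (j′ , refl , up) dn = lev′ , ad
        where
        lev′ : ∀ {i} → i ≤ M → Level i (replace j v i)
        lev′ {i} le with i ℕ.≟ j
        ... | yes refl = lv
        ... | no _ = proj₁ ch le
        ad : ∀ {i} → i < M → adj G (replace j v i) (replace j v (suc i)) ≡ true
        ad {i} lt with i ℕ.≟ j | suc i ℕ.≟ j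
        ... | yes refl | yes e = ⊥-elim (ℕ.1+n≢n e)
        ... | yes refl | no _ = dn
        ... | no _ | yes refl = up
        ... | no _ | no _ = proj₂ ch lt

      kid-twin : ∀ {j v} → n ≤ j → 2 + j + n ≤ M → Level (suc j) v → adj G (c j) v ≡ true → Twin (suc j) v
      kid-twin {j} {v} n≤j j≤M lv e with v ≟ c (suc j)
      ... | yes q = inj₁ q
      ... | no q = inj₂ (lv , (j , refl , e) ,
                         trans (sym (Beside.both-or-neither ch n≤j j≤M lv q noF1 noF2)) (adj-flip G e))

      -- Put `v` in the place of `c j`. In the new chain `w` sees the vertex above it, hence also
      -- `c (2 + j)`; read in the old chain, this makes `w` see `c j` too.
      twin-step : ∀ {j v w} → n ≤ j → 2 + j + n ≤ M → Twin j v → Level (suc j) w → adj G v w ≡ true → Twin (suc j) w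
      twin-step n≤j j≤M (inj₁ refl) lw e = kid-twin n≤j j≤M lw e
      twin-step {j} {v} {w} n≤j j≤M (inj₂ (lv , up , dn)) lw e with w ≟ c (suc j)
      ... | yes q = inj₁ q
      ... | no q = inj₂ (lw , (j , refl , adj-flip G (trans (Beside.both-or-neither ch n≤j j≤M lw q noF1 noF2) below)) , below)
        where
        below : adj G w (c (2 + j)) ≡ true
        below = trans (sym (cong (adj G w) (replace-off λ e → <⇒≢ (m≤n+m (suc j) 1) (sym e))))
               (trans (sym (Beside.both-or-neither (replace-chain lv up dn) n≤j j≤M lw (λ r → q (trans r (replace-off ℕ.1+n≢n))) noF1 noF2))
                      (trans (cong (adj G w) (replace-at j v)) (adj-flip G e)))

      -- The same exchange read upwards: `w` sees `c (2 + j)`, hence also the vertex `v` that has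
      -- taken the place of `c j`.
      twin-adj : ∀ {j v w} → n ≤ j → 2 + j + n ≤ M → Twin j v → Twin (suc j) w → adj G v w ≡ true
      twin-adj {j} n≤j j≤M (inj₁ refl) (inj₁ refl) = proj₂ ch (≤-trans (m≤n+m (suc j) 1) (≤-trans (m≤m+n (2 + j) n) j≤M))
      twin-adj n≤j j≤M (inj₂ (_ , _ , dn)) (inj₁ refl) = dn
      twin-adj n≤j j≤M (inj₁ refl) (inj₂ (_ , (_ , refl , up) , _)) = up
      twin-adj {j} {v} {w} n≤j j≤M (inj₂ (lv , up , dn)) (inj₂ (lw , _ , dn′)) with w ≟ c (suc j)
      ... | yes q = trans (cong (adj G v) q) dn
      ... | no q = adj-flip G (trans (sym (cong (adj G w) (replace-at j v)))
              (trans (Beside.both-or-neither (replace-chain lv up dn) n≤j j≤M lw (λ r → q (trans r (replace-off ℕ.1+n≢n))) noF1 noF2)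
                     (trans (cong (adj G w) (replace-off λ e → <⇒≢ (m≤n+m (suc j) 1) (sym e))) dn′)))

    open Pieces 𝒜p G

    cover-vertices : ∀ xs → Cover (_∈ xs) (length xs)
    cover-vertices xs = cover-≤ (≤-reflexive (ℕ.*-identityʳ (length xs))) (cover-⊆ (λ {v} v∈ → v , v∈ , refl)
      (cover-list {S = λ x v → v ≡ x} xs λ x _ → let (p , i , _) = vertexPiece x in p ∷ [] , (λ { refl → here i }) , s≤s z≤n))

    nth : List Vx → ℕ → Vx → Vx
    nth [] t d = d
    nth (x ∷ xs) zero d = x
    nth (x ∷ xs) (suc t) d = nth xs t d

    nth-∈ : ∀ xs t d → nth xs t d ∈ xs ⊎ nth xs t d ≡ d
    nth-∈ [] t d = inj₂ refl
    nth-∈ (x ∷ xs) zero d = inj₁ (here refl)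
    nth-∈ (x ∷ xs) (suc t) d with nth-∈ xs t d
    ... | inj₁ i = inj₁ (there i)
    ... | inj₂ e = inj₂ e

    nth-index : ∀ {xs v} d → v ∈ xs → ∃ λ t → t < length xs × nth xs t d ≡ v
    nth-index d (here refl) = 0 , s≤s z≤n , refl
    nth-index d (there i) = let (t , lt , e) = nth-index d i in suc t , s≤s lt , e

    module _ {u} (lu : lev u ≡ N) (ρ : LongRay u) where

      open LongRay ρ
      open Blowup chain

      private
        n≤ : ∀ i → n ≤ i + N
        n≤ i = ≤-trans (n≤1+n n) (m≤n+m N i)

      twins : ∀ i {v} → v ∈ down u i → i ≤ suc ℓ → Twin (i + N) v
      twins zero (here refl) _ = inj₁ (sym starts)
      twins (suc i) {v} v∈ (s≤s i≤) = let (y , y∈ , v∈′) = down⁻ i v∈ in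
        twin-step (n≤ i) (range i≤) (twins i y∈ (ℕ.m≤n⇒m≤1+n i≤))
          (subst (λ x → Level x v) (trans (down-lev (suc i) v∈) (cong (suc i +_) lu)) (lev-level v)) (proj₂ (kids⁻ v∈′))

      -- Below level `N` the path number `t` takes the t-th kid of each chain vertex, and the chain
      -- vertex itself where there are fewer kids.
      transversal : ℕ → ℕ → Vx
      transversal t j with j ℕ.≤? N
      ... | yes _ = c j
      transversal t zero | no _ = c zero
      transversal t (suc j) | no _ = nth (kids (c j)) t (c (suc j))

      transversal-above : ∀ t i → transversal t (suc (i + N)) ≡ nth (kids (c (i + N))) t (c (suc (i + N)))
      transversal-above t i with suc (i + N) ℕ.≤? N
      ... | yes p = ⊥-elim (<⇒≱ p (m≤n+m N i))
      ... | no _ = refl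

      transversal-twin : ∀ t i → i ≤ suc ℓ → Twin (i + N) (transversal t (i + N))
      transversal-twin t i i≤ with (i + N) ℕ.≤? N
      ... | yes _ = inj₁ refl
      transversal-twin t zero i≤ | no q = ⊥-elim (q ≤-refl)
      transversal-twin t (suc i) (s≤s i≤) | no q with nth-∈ (kids (c (i + N))) t (c (suc i + N))
      ... | inj₂ e = inj₁ e
      ... | inj₁ i∈ = kid-twin {i + N} {x} (n≤ i) (range i≤)
              (subst (λ j → Level j x) (trans (proj₁ (kids⁻ i∈)) (cong suc (level⇒lev (on-level (ℕ.m≤n⇒m≤1+n i≤))))) (lev-level x))
              (proj₂ (kids⁻ i∈))
        where
        x : Vx
        x = nth (kids (c (i + N))) t (c (suc i + N))

      twin-level : ∀ {i v} → i ≤ suc ℓ → Twin (i + N) v → Level (i + N) v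
      twin-level i≤ (inj₁ refl) = on-level i≤
      twin-level i≤ (inj₂ (l , _)) = l

      -- By `twin-adj` any choice of one twin per level is a chain, so the choices on different
      -- levels need not be coordinated.
      transversal-chain : ∀ t → Chain (suc ℓ + N) (transversal t)
      transversal-chain t = lev′ , ad
        where
        small : ∀ {j} → j ≤ N → transversal t j ≡ c j
        small {j} le with j ℕ.≤? N
        ... | yes _ = refl
        ... | no q = ⊥-elim (q le)
        above : ∀ {j} → N ≤ j → ∃ λ i → j ≡ i + N
        above {j} le = j ∸ N , sym (ℕ.m∸n+n≡m le)
        lev′ : ∀ {j} → j ≤ suc ℓ + N → Level j (transversal t j)
        lev′ {j} le with ℕ.≤-total j N
        ... | inj₁ p = subst (Level j) (sym (small p)) (proj₁ chain (≤-trans p (m≤n+m N _)))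
        ... | inj₂ p with above p
        ...   | i , refl = let i≤ = ℕ.+-cancelʳ-≤ N i (suc ℓ) le in twin-level i≤ (transversal-twin t i i≤)
        ad : ∀ {j} → j < suc ℓ + N → adj G (transversal t j) (transversal t (suc j)) ≡ true
        ad {j} lt with suc j ℕ.≤? N
        ... | yes p = trans (cong (λ x → adj G x (c (suc j))) (small (<⇒≤ p)))
                            (proj₂ chain (≤-trans p (m≤n+m N _)))
        ... | no q with above (≤-pred (≰⇒> q))
        ...   | i , refl = let i≤ = ℕ.+-cancelʳ-≤ N i ℓ (≤-pred lt) in
                trans (cong (adj G (transversal t (i + N))) (sym (transversal-above t i)))
                  (twin-adj (n≤ i) (range i≤) (transversal-twin t i (ℕ.m≤n⇒m≤1+n i≤)) (transversal-twin t (suc i) (s≤s i≤)))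

      transversal-hits : ∀ i {v} → v ∈ kids (c (i + N)) → ∃ λ t → t < degreeBound n × transversal t (suc i + N) ≡ v
      transversal-hits i v∈ = let (t , lt , e) = nth-index (c (suc i + N)) v∈ in t , ℕ.<-≤-trans lt (kids-bound _) , trans (transversal-above t i) e

      -- All twins of a level are kids of one vertex, so the degree bounds their number and
      -- boundedly many transversals meet them all.
      twin-kid : ∀ {i v} → i ≤ ℓ → Twin (suc i + N) v → v ∈ kids (c (i + N))
      twin-kid {i} i≤ (inj₁ refl) = kids⁺ (trans (level⇒lev (on-level (s≤s i≤))) (cong suc (sym (level⇒lev (on-level (ℕ.m≤n⇒m≤1+n i≤))))))
                                         (proj₂ chain (suc-range (s≤s i≤)))
      twin-kid {i} i≤ (inj₂ (l , (_ , refl , e) , _)) = kids⁺ (trans (level⇒lev l) (cong suc (sym (level⇒lev (on-level (ℕ.m≤n⇒m≤1+n i≤)))))) e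

      cover-long : Cover (λ v → ∃ λ k → v ∈ down u k) (1 + (degreeBound n * 1 + leftoverBound n))
      cover-long = cover-∪ sort (cover-vertices (u ∷ []))
        (cover-∪ id (cover-⋃ (degreeBound n) path) (cover-≤ (leftover-bound (inj₂ ρ)) (cover-vertices (leftover (inj₂ ρ)))))
        where
        OnPath : ℕ → Vx → Set
        OnPath t v = ∃ λ i → i ≤ suc ℓ × v ≡ transversal t (i + N)
        path : ∀ t → Cover (OnPath t) 1
        path t = let (p , f , _) = chainPiece N (suc ℓ) (transversal-chain t) ≤-refl in
          p ∷ [] , (λ { (i , i≤ , refl) → here (f i i≤) }) , s≤s z≤n
        sort : ∀ {v} → (∃ λ k → v ∈ down u k) → v ∈ u ∷ [] ⊎ ((∃ λ t → t < degreeBound n × OnPath t v) ⊎ v ∈ leftover (inj₂ ρ))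
        sort (zero , v∈) = inj₁ v∈
        sort {v} (suc k , v∈) with k ℕ.≤? ℓ
        ... | yes p = let (t , lt , e) = transversal-hits k (twin-kid p (twins (suc k) v∈ (s≤s p))) in
                      inj₂ (inj₁ (t , lt , suc k , s≤s p , sym e))
        -- The ancestor `w` at depth `suc ℓ` is still a twin of a chain vertex, hence a kid of
        -- `c (ℓ + N)`, where the leftover list starts.
        ... | no q = let eq = ℕ.m∸n+n≡m (s≤s (<⇒≤ (≰⇒> q)))
                         (w , w∈ , v∈′) = down-split (suc k ∸ suc ℓ) (suc ℓ) (subst (λ x → v ∈ down u x) (sym eq) v∈)
                     in inj₂ (inj₂ (tail∈leftover ρ (suc k ∸ suc ℓ) (twin-kid ≤-refl (twins (suc ℓ) w∈ ≤-refl)) v∈′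
                          (≤-trans (≤-reflexive eq) (depth (suc k) v∈))))

    cover-ray : ∀ u → lev u ≡ N → Cover (λ v → ∃ λ k → v ∈ down u k) (1 + (degreeBound n * 1 + leftoverBound n))
    cover-ray u lu with ray u lu
    ... | inj₂ ρ = cover-long lu ρ
    ... | inj₁ short = cover-≤ (≤-trans (leftover-bound (inj₁ short)) (≤-trans (m≤n+m _ (degreeBound n * 1)) (n≤1+n _)))
                        (cover-⊆ (λ (k , v∈) → downs⁺ (short k v∈) v∈) (cover-vertices (downs u (2 + n))))

    inpc-bound : inpc≤ G (leftoverBound n + Δ ^ N * (1 + (Δ * 1 + leftoverBound n)))
    inpc-bound = let (L , c , b) = whole in L , (λ v → c {v} tt) , b
      where
      whole : Cover (λ _ → ⊤) _
      whole = cover-∪ (λ {v} _ → case covered-by v of λ { (inj₁ i) → inj₁ i ; (inj₂ (u , u∈ , lu , d)) → inj₂ (u , u∈ , lu , d) })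
        (cover-≤ (downs-bound root (m≤n+m N 3)) (cover-vertices top))
        (cover-≤ (ℕ.*-monoˡ-≤ _ (down-bound root N))
          (cover-list heads λ u _ → cover-headed u))
        where
        cover-headed : ∀ u → Cover (λ v → lev u ≡ N × ∃ λ k → v ∈ down u k) (1 + (Δ * 1 + leftoverBound n))
        cover-headed u with lev u ℕ.≟ N
        ... | yes lu = cover-⊆ proj₂ (cover-ray u lu)
        ... | no nl = [] , (λ { (lu , _) → ⊥-elim (nl lu) }) , z≤n

-- Path partitions in the absence of twins

module _ (A : ℕ → Graph) (G : Graph) where

  open Pieces A G

  part-list : ∀ {X : Set} {S : X → Fin (V G) → Set} {k} xs → Unique xs → (∀ x → x ∈ xs → Part (S x) k) →
              (∀ {x y v} → x ∈ xs → y ∈ xs → S x v → S y v → x ≡ y) → Part (λ v → ∃ λ x → x ∈ xs × S x v) (length xs * k)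
  part-list [] _ h sep = [] , (λ { (_ , () , _) }) , [] , [] , z≤n
  part-list (x ∷ xs) (x∉ ∷ uniq) h sep = part-∪
    (λ { (_ , here refl , s) → inj₁ s ; (y , there y∈ , s) → inj₂ (y , y∈ , s) })
    (λ s → x , here refl , s) (λ (y , y∈ , s) → y , there y∈ , s)
    (λ s (y , y∈ , s′) → All.lookup x∉ y∈ (sep (here refl) (there y∈) s s′))
    (h x (here refl)) (part-list xs uniq (λ y y∈ → h y (there y∈)) (λ a b → sep (there a) (there b)))

  -- A vertex becomes a piece of its own unless some piece already contains it, so the exceptional
  -- lists may overlap each other and the rays.
  part-extend : ∀ {S k} → (∀ v → Σ (Piece A G) λ p → In v p × (∀ {w} → In w p → w ≡ v)) → ∀ xs →
                Part S k → Part (λ v → S v ⊎ v ∈ xs) (length xs + k)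
  part-extend single [] p = part-resp (λ { (inj₁ s) → s ; (inj₂ ()) }) inj₁ p
  part-extend {S} {k} single (x ∷ xs) p with part-extend single xs p
  ... | q@(L , c , i , ap , b) with Any.any? (λ r → Fin.any? (λ a → proj₁ (proj₂ r) a ≟ x)) L
  ...   | yes hit = part-resp (λ { (inj₁ s) → inj₁ s ; (inj₂ (here refl)) → inside ; (inj₂ (there e)) → inj₂ e })
                              (λ { (inj₁ s) → inj₁ s ; (inj₂ e) → inj₂ (there e) }) (part-≤ (n≤1+n _) q)
    where
    inside : S x ⊎ x ∈ xs
    inside = let (r , r∈ , h) = find hit in All.lookup i r∈ x h
  ...   | no miss = let (r , f , g) = single x in part-∪ {S = λ v → v ≡ x}
      (λ { (inj₁ s) → inj₂ (inj₁ s) ; (inj₂ (here e)) → inj₁ e ; (inj₂ (there e)) → inj₂ (inj₂ e) })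
      (λ e → inj₂ (here e)) (λ { (inj₁ s) → inj₁ s ; (inj₂ e) → inj₂ (there e) })
      (λ { refl s → miss (c s) })
      (part-piece r (λ { refl → f }) g) q

module Twinless (G : Graph) (con : Connected G) (n : ℕ) (1≤n : 1 ≤ n) (noK : ¬ (K n ↪ G)) (noStar : ¬ (Star n ↪ G))
                (noF1 : ¬ (F1 n ↪ G)) (noF2 : ¬ (F2 n ↪ G)) (noF4 : ¬ (F4 n ↪ G)) (noF5 : ¬ (F5 n ↪ G)) where

  open Whole G con
  open BoundedDegree G con n 1≤n noK noStar
  open Pieces 𝒜p G
  open LongRay

  private
    Vx = Fin (V G)

  unique-kid : ∀ {M c} (ch : Chain M c) {j v} → n ≤ j → 2 + j + n ≤ M → Level (suc j) v → adj G (c j) v ≡ true → v ≡ c (suc j)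
  unique-kid {c = c} ch {j} {v} n≤j j≤M lv e with v ≟ c (suc j)
  ... | yes q = q
  ... | no q = ⊥-elim (true≢false (adj-flip G e) (Beside.neither ch n≤j j≤M lv q noF1 noF2 noF4 noF5))

  unique-parent : ∀ {M c} (ch : Chain M c) {j v} → n ≤ j → 2 + j + n ≤ M → Level (suc j) v → adj G v (c (2 + j)) ≡ true → v ≡ c (suc j)
  unique-parent {c = c} ch {j} {v} n≤j j≤M lv e with v ≟ c (suc j)
  ... | yes q = q
  ... | no q = ⊥-elim (true≢false (trans (Beside.both-or-neither ch n≤j j≤M lv q noF1 noF2) e)
                                  (Beside.neither ch n≤j j≤M lv q noF1 noF2 noF4 noF5))

  private
    n≤ : ∀ i → n ≤ i + N
    n≤ i = ≤-trans (n≤1+n n) (m≤n+m N i)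

  module _ {u} (lu : lev u ≡ N) (ρ : LongRay u) where

    down-unique : ∀ i {v} → v ∈ down u i → i ≤ suc (ℓ ρ) → v ≡ c ρ (i + N)
    down-unique zero (here refl) _ = sym (starts ρ)
    down-unique (suc i) {v} v∈ (s≤s i≤) with y , y∈ , v∈′ ← down⁻ i v∈ with refl ← down-unique i y∈ (ℕ.m≤n⇒m≤1+n i≤) =
      unique-kid (chain ρ) (n≤ i) (range ρ i≤)
        (subst (λ x → Level x v) (trans (down-lev (suc i) v∈) (cong (suc i +_) lu)) (lev-level v)) (proj₂ (kids⁻ v∈′))

  -- Once two rays meet, `unique-parent` makes them agree on all levels above the meeting point, up
  -- to level `N`, where they start at their heads.
  rays-disjoint : ∀ {u u′} (ρ : LongRay u) (ρ′ : LongRay u′) i → i ≤ suc (ℓ ρ) → i ≤ suc (ℓ ρ′) →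
                  c ρ (i + N) ≡ c ρ′ (i + N) → u ≡ u′
  rays-disjoint ρ ρ′ zero _ _ e = trans (sym (starts ρ)) (trans e (starts ρ′))
  rays-disjoint ρ ρ′ (suc i) (s≤s i≤) (s≤s i≤′) e = rays-disjoint ρ ρ′ i (ℕ.m≤n⇒m≤1+n i≤) (ℕ.m≤n⇒m≤1+n i≤′)
    (sym (parent i≤ i≤′ e))
    where
    parent : i ≤ ℓ ρ → i ≤ ℓ ρ′ → c ρ (suc i + N) ≡ c ρ′ (suc i + N) → c ρ′ (i + N) ≡ c ρ (i + N)
    -- Level `i + N` is j + 1 for j = i + n; the extreme case i = 0 is just within the range n ≤ j.
    parent p p′ e = subst (λ j → c ρ′ j ≡ c ρ j) (sym (ℕ.+-suc i n))
      (unique-parent (chain ρ) {i + n} (m≤n+m n i)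
        (≤-trans (≤-trans (n≤1+n _) (≤-reflexive (cong (λ x → 2 + x + n) (sym (ℕ.+-suc i n))))) (range ρ p))
        (subst (λ j → Level j (c ρ′ j)) (ℕ.+-suc i n) (on-level ρ′ (ℕ.m≤n⇒m≤1+n p′)))
        (trans (cong₂ (λ j k → adj G (c ρ′ j) (c ρ k)) (sym (ℕ.+-suc i n)) (cong suc (sym (ℕ.+-suc i n))))
          (trans (cong (adj G (c ρ′ (i + N))) e) (proj₂ (chain ρ′) (suc-range ρ′ (s≤s p′))))))

  -- A ray is cut after `suc ℓ` steps, the range in which `down-unique` and `rays-disjoint` hold. A
  -- short head has no ray, all its descendants being leftover.
  OnRay : ∀ {u} → (∀ k {v} → v ∈ down u k → k < 2 + n) ⊎ LongRay u → Vx → Set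
  OnRay (inj₁ _) v = ⊥
  OnRay (inj₂ ρ) v = ∃ λ i → i ≤ suc (ℓ ρ) × v ≡ c ρ (i + N)

  OnRay-unique : ∀ {u u′} (ρ : _ ⊎ LongRay u) (ρ′ : _ ⊎ LongRay u′) {v} → OnRay ρ v → OnRay ρ′ v → u ≡ u′
  OnRay-unique (inj₂ ρ) (inj₂ ρ′) (i , i≤ , e) (i′ , i≤′ , e′)
    with refl ← ℕ.+-cancelʳ-≡ N i i′ (level-unique (subst (Level _) (sym e) (on-level ρ i≤)) (subst (Level _) (sym e′) (on-level ρ′ i≤′)))
    = rays-disjoint ρ ρ′ i i≤ i≤′ (trans (sym e) e′)

  part-ray : ∀ {u} (ρ : _ ⊎ LongRay u) → Part (OnRay ρ) 1
  part-ray (inj₁ _) = [] , (λ ()) , [] , [] , z≤n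
  part-ray (inj₂ ρ) = let (p , f , g) = chainPiece N (suc (ℓ ρ)) (chain ρ) (suc-range ρ ≤-refl) in
    part-piece p (λ { (i , i≤ , refl) → f i i≤ }) g

  below-head : ∀ {u} → lev u ≡ N → (ρ : _ ⊎ LongRay u) → ∀ k {v} → v ∈ down u k → OnRay ρ v ⊎ v ∈ leftover ρ
  below-head lu (inj₁ short) k v∈ = inj₂ (downs⁺ (short k v∈) v∈)
  below-head {u} lu (inj₂ ρ) k {v} v∈ with k ℕ.≤? suc (ℓ ρ)
  ... | yes p = inj₁ (k , p , down-unique lu ρ k v∈ p)
  ... | no q = let eq = ℕ.m∸n+n≡m (<⇒≤ (≰⇒> q))
                   (w , w∈ , v∈′) = down-split (k ∸ suc (ℓ ρ)) (suc (ℓ ρ)) (subst (λ x → v ∈ down u x) (sym eq) v∈)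
                   (y , y∈ , w∈′) = down⁻ (ℓ ρ) w∈
               in inj₂ (tail∈leftover ρ (k ∸ suc (ℓ ρ))
                    (subst (λ x → w ∈ kids x) (down-unique lu ρ (ℓ ρ) y∈ (n≤1+n _)) w∈′) v∈′
                    (≤-trans (≤-reflexive eq) (depth ρ k v∈)))

  heads! : List Vx
  heads! = deduplicate _≟_ heads

  -- `ray` takes a proof that `u` is on level `N`. Carrying it inside the predicate lets `part-from`
  -- speak about every `u`, and uniqueness of equality proofs on ℕ reconciles different choices of
  -- it.
  OnRayFrom : Vx → Vx → Set
  OnRayFrom u v = Σ (lev u ≡ N) λ lu → OnRay (ray u lu) v

  part-from : ∀ u → Part (OnRayFrom u) 1
  part-from u with lev u ℕ.≟ N
  ... | no nl = [] , (λ (lu , _) → ⊥-elim (nl lu)) , [] , [] , z≤n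
  ... | yes lu = part-resp (λ {v} (lu′ , o) → subst (λ q → OnRay (ray u q) v) (ℕ.≡-irrelevant lu′ lu) o) (λ o → lu , o)
                           (part-ray (ray u lu))

  leftoverFrom : Vx → List Vx
  leftoverFrom u with lev u ℕ.≟ N
  ... | no _ = []
  ... | yes lu = leftover (ray u lu)

  leftoverFrom-bound : ∀ u → length (leftoverFrom u) ≤ leftoverBound n
  leftoverFrom-bound u with lev u ℕ.≟ N
  ... | no _ = z≤n
  ... | yes lu = leftover-bound (ray u lu)

  below-from : ∀ {u} → lev u ≡ N → ∀ k {v} → v ∈ down u k → OnRayFrom u v ⊎ v ∈ leftoverFrom u
  below-from {u} lu k v∈ with lev u ℕ.≟ N
  ... | no nl = ⊥-elim (nl lu)
  ... | yes lu′ with below-head lu′ (ray u lu′) k v∈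
  ...   | inj₁ o = inj₁ (lu′ , o)
  ...   | inj₂ i = inj₂ i

  inpp-bound : inpp≤ G ((leftoverBound n + degreeBound n ^ N * leftoverBound n) + degreeBound n ^ N * 1)
  inpp-bound = let (L , c , _ , ap , b) = part-≤ bound
                     (part-extend 𝒜p G vertexPiece rest
                       (part-list 𝒜p G heads! (deduplicate-! _≟_ heads) (λ u _ → part-from u)
                         (λ _ _ (lu , o) (lu′ , o′) → OnRay-unique (ray _ lu) (ray _ lu′) o o′)))
               in L , ((λ v → c (everything v)) , ap) , b
    where
    rest : List Vx
    rest = top ++ concatMap leftoverFrom heads!
    heads≤ : length heads! ≤ degreeBound n ^ N
    heads≤ = ≤-trans (List.length-deduplicate _≟_ heads) (down-bound root N)
    bound : length rest + length heads! * 1 ≤ _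
    bound = ℕ.+-mono-≤ (≤-trans (≤-reflexive (List.length-++ top))
                         (ℕ.+-mono-≤ (downs-bound root (m≤n+m N 3))
                           (≤-trans (length-concatMap leftoverFrom (leftoverBound n) heads! (λ u _ → leftoverFrom-bound u))
                                      (ℕ.*-monoˡ-≤ (leftoverBound n) heads≤))))
                       (ℕ.*-monoˡ-≤ 1 heads≤)
    everything : ∀ v → (∃ λ u → u ∈ heads! × OnRayFrom u v) ⊎ v ∈ rest
    everything v with covered-by v
    ... | inj₁ v∈ = inj₂ (∈-++⁺ˡ v∈)
    ... | inj₂ (u , u∈ , lu , k , v∈) with below-from lu k v∈
    ...   | inj₁ o = inj₁ (u , ∈-deduplicate⁺ _≟_ u∈ , o)
    ...   | inj₂ i = inj₂ (∈-++⁺ʳ top (Any.concatMap⁺ leftoverFrom (Any.map (λ { refl → i }) (∈-deduplicate⁺ _≟_ u∈))))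

-- The four equivalences

P-mono : ∀ n → P n ↪ P (suc n)
P-mono n = Fin.inject₁ , Fin.inject₁-injective , λ u v → trans (P-adj n u v)
  (trans (cong₂ stepᵇ (sym (Fin.toℕ-inject₁ u)) (sym (Fin.toℕ-inject₁ v))) (sym (P-adj (suc n) (Fin.inject₁ u) (Fin.inject₁ v))))

-- The star bounds exclude `P (suc n)` because a chain that reaches level `n` has n + 1 vertices.
P-free-suc : ∀ G n → ¬ (P n ↪ G) → ¬ (P (suc n) ↪ G)
P-free-suc G n noP emb = noP (↪-trans {P n} {P (suc n)} {G} (P-mono n) emb)

sufficiency : ∀ {μ≤ ℋ 𝒳} c → ℋ ⊑ 𝒳 → (∀ G → Connected G → All (λ X → ¬ (X ↪ G)) 𝒳 → μ≤ G c) → Bounded μ≤ ℋ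
sufficiency c le h = c , λ G con free → h G con (All.tabulate λ {X} X∈ X↪G →
  let (H , H∈ , H↪X) = le X X∈ in free H H∈ (↪-trans {H} {X} {G} H↪X X↪G))

theorem5p1 : (ℋ : List Graph) → All Connected ℋ →
    (Bounded insc≤ ℋ ⇔ (∃ λ n → 4 ≤ n × ℋ ⊑ (K n ∷ S* n ∷ P n ∷ [])))
    × (Bounded insp≤ ℋ ⇔ (∃ λ n → 4 ≤ n × ℋ ⊑ (K n ∷ S* n ∷ S~ n ∷ P n ∷ [])))
    × (Bounded inpc≤ ℋ ⇔ (∃ λ n → 4 ≤ n × ℋ ⊑ (K n ∷ Star n ∷ F1 n ∷ F2 n ∷ [])))
    × (Bounded inpp≤ ℋ ⇔ (∃ λ n → 4 ≤ n × ℋ ⊑ (K n ∷ Star n ∷ F1 n ∷ F2 n ∷ F4 n ∷ F5 n ∷ [])))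
theorem5p1 ℋ con =
    mk⇔ (necessity-insc ℋ) (λ (n , _ , le) → sufficiency {insc≤} _ le λ { G cG (noK ∷ noS* ∷ noP ∷ []) →
      insc-bound G n cG noK noS* (P-free-suc G n noP) })
  , mk⇔ (necessity-insp ℋ) (λ (n , _ , le) → sufficiency {insp≤} _ le λ { G cG (noK ∷ noS* ∷ noS~ ∷ noP ∷ []) →
      insp-bound G n cG noK noS* noS~ (P-free-suc G n noP) })
  , mk⇔ (necessity-inpc ℋ con) (λ (n , 4≤n , le) → sufficiency {inpc≤} _ le λ { G cG (noK ∷ noStar ∷ noF1 ∷ noF2 ∷ []) →
      BoundedDegree.inpc-bound G cG n (≤-trans (s≤s z≤n) 4≤n) noK noStar noF1 noF2 })
  , mk⇔ (necessity-inpp ℋ con) (λ (n , 4≤n , le) → sufficiency {inpp≤} _ le λ { G cG (noK ∷ noStar ∷ noF1 ∷ noF2 ∷ noF4 ∷ noF5 ∷ []) →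
      Twinless.inpp-bound G cG n (≤-trans (s≤s z≤n) 4≤n) noK noStar noF1 noF2 noF4 noF5 })
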